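{- Let $d\ge 3$. (i) The $d$-dimensional simplex $\alpha_d$ has $z$-vector $z(\alpha_d)=(d+1)^{d!/2}$; that is, it has exactly $d!/2$ zigzags (up to reversal), all of length $d+1$ and without self-intersections. Every zigzag has intersection vector $(0,1)^{d+1}$ if $d\ge 4$, and $(1,1)^2$ if $d=3$. (ii) The $d$-dimensional cross-polytope $\beta_d$ has $z$-vector $z(\beta_d)=(2d)^{2^{d-2}(d-1)!}$; that is, it has exactly $2^{d-2}(d-1)!$ zigzags (up to reversal), all of length $2d$ and without self-intersections. Every zigzag has intersection vector $(0,2)^d$.
   Context: For a $d$-polytope $P$, a flag is a maximal chain $F_1\subset F_2\subset\dots\subset F_d$ of proper nonempty faces with $\dim F_i=i-1$. For $1\le i\le d$, $\sigma_i$ is the involution on flags replacing $F_i$ by the unique other face $F_i'\neq F_i$ with $F_{i-1}\subset F_i'\subset F_{i+1}$ (where $F_0=\emptyset$, $F_{d+1}=P$). Put $T=\sigma_d\sigma_{d-1}\cdots\sigma_1$ ($\sigma_1$ applied first). A zigzag is a circuit $Z=(f_1,\dots,f_l)$ of flags (an orbit of $T$, listed cyclically, up to cyclic shift) with $f_{j+1}=T(f_j)$, indices modulo $l$; $l$ is its length. For a flag $f=(F_1,\dots,F_d)$ there is a unique family of faces $(x_{i,j})_{1\le i\le d,1\le j\le d+1-i}$ with $x_{i,1}=F_i$, $\dim x_{i,j}=i-1$, $x_{i,j}\subset x_{i+1,j}$, $x_{i,j}\subset x_{i+1,j-1}$, and $x_{i,j}\ne x_{i,j-1}$ whenever the indices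 make sense; the reverse of $f$ is the flag $f^t=(x_{1,d},x_{2,d-1},\dots,x_{d,1})$. The reverse of $Z=(f_1,\dots,f_l)$ is the zigzag $Z^t=(f_l^t,\dots,f_1^t)$. A zigzag is identified with its reverse (so zigzags are counted up to reversal). $Z$ has no self-intersections if for no flag $f$ of $Z$ does $\sigma_1(f)$ belong to $Z$ or $Z^t$. For two distinct zigzags $Z_1=(f_{1},\dots,f_{l})$ and $Z_2$, $n_I$ is the number of $j$ with $\sigma_1(f_j)\in Z_2$ and $n_{II}$ the number of $j$ with $\sigma_1(f_j)\in Z_2^t$; replacing $Z_2$ by $Z_2^t$ exchanges the two numbers, and the normalized signature is the pair $(n_I,n_{II})$ with orientation chosen so that $n_I\le n_{II}$. The intersection vector of a zigzag $Z$ is the list of its nonzero normalized signatures with all other zigzags, multiplicities being written as exponents: e.g. $(a,b)^m$ means that $Z$ has normalized signature $(a,b)$ with exactly $m$ other zigzags and $(0,0)$ with all remaining ones. In the $z$-vector, $l^m$ means $m$ zigzags of length $l$ without self-intersections. -}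

module Defs where

open import Algebra.Properties.CommutativeMonoid.Sum using (sum)
open import Data.Bool.Base using (if_then_else_)
open import Data.Fin.Base as Fin using (Fin; toℕ; fromℕ; inject₁; opposite; splitAt)
open import Data.Fin.Properties using (_≟_)
open import Data.Fin.Subset using (Subset; _∈_; _∉_; _⊂_; Nonempty; ∣_∣)
open import Data.Integer.Base as ℤ using (ℤ; 0ℤ; 1ℤ)
open import Data.Integer.Properties using (+-0-commutativeMonoid)
open import Data.List.Base using (List; length)
open import Data.List.Relation.Unary.All using (All)
open import Data.List.Relation.Unary.AllPairs using (AllPairs)
open import Data.List.Relation.Unary.Any using (Any)
open import Data.Nat.Base using (ℕ; suc; _+_; _<_; _≤_)
open import Data.Product.Base using (Σ; ∃; ∃-syntax; _×_; _,_)
open import Data.Sum.Base using (_⊎_; [_,_]′)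
open import Data.Unit.Base using (⊤)
open import Data.Vec.Functional using (Vector)
open import Function.Base using (_∘_)
open import Function.Bundles using (_⇔_)
open import Relation.Binary.PropositionalEquality using (_≡_; _≢_)
open import Relation.Nullary using (¬_; does)

Σℤ : ∀ {n} → Vector ℤ n → ℤ
Σℤ = sum +-0-commutativeMonoid

_·_ : ∀ {m} → Vector ℤ m → Vector ℤ m → ℤ
c · v = Σℤ (λ k → c k ℤ.* v k)

basis : ∀ {m} → Fin m → Vector ℤ m
basis i k = if does (i ≟ k) then 1ℤ else 0ℤ

AffinelyIndependent : ∀ {k m} → (Fin k → Vector ℤ m) → Set
AffinelyIndependent p =
  ∀ a → Σℤ a ≡ 0ℤ → (∀ t → Σℤ (λ i → a i ℤ.* p i t) ≡ 0ℤ) → ∀ i → a i ≡ 0ℤ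

-- α_d is the convex hull of the standard basis of ℝ^(d+1).
simplex : ∀ d → Fin (suc d) → Vector ℤ (suc d)
simplex d = basis

-- β_d is the convex hull of ±e₁, …, ±e_d in ℝ^d: the first d indices carry
-- the e_i, the last d the -e_i.
crossPolytope : ∀ d → Fin (d + d) → Vector ℤ d
crossPolytope d v = [ basis , (λ i k → ℤ.- basis i k) ]′ (splitAt d v)

-- P has exactly m solutions, counted up to _~_.
Exactly : {A : Set} → (A → A → Set) → ℕ → (A → Set) → Set
Exactly {A} _~_ m P =
  Σ (List A) λ xs →
    length xs ≡ m × AllPairs (λ x y → ¬ (x ~ y)) xs × All P xs ×
    (∀ x → P x → Any (x ~_) xs)

Count : ∀ {l} → (Fin l → Set) → ℕ → Set
Count {l} P n = Σ (Subset l) λ S → ∣ S ∣ ≡ n × (∀ j → j ∈ S ⇔ P j)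

-- V lists the vertices, without repetition, of a d-polytope whose vertices
-- are integral.
module _ {n m : ℕ} (V : Fin n → Vector ℤ m) (d : ℕ) where

  -- A face is encoded by the set of its vertices; the proper nonempty faces
  -- are cut out by supporting hyperplanes.  As the vertices are integral, the
  -- normal and the offset may be taken integral too.
  record IsFace (S : Subset n) : Set where
    field
      nonempty : Nonempty S
      proper   : ∃[ v ] v ∉ S
      normal   : Vector ℤ m
      offset   : ℤ
      bound    : ∀ v → normal · V v ℤ.≤ offset
      tight    : ∀ v → v ∈ S ⇔ normal · V v ≡ offset

  HasDim : Subset n → ℕ → Set
  HasDim S k =
    (Σ (Fin (suc k) → Fin n) λ w →
       (∀ i → w i ∈ S) × AffinelyIndependent (V ∘ w)) ×
    ((w : Fin (suc (suc k)) → Fin n) →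
       (∀ i → w i ∈ S) → ¬ AffinelyIndependent (V ∘ w))

  -- face i is F_{i+1}.  Having one face in each of the dimensions
  -- 0, …, d-1, the chain is maximal.
  record Flag : Set where
    field
      face   : Fin d → Subset n
      isFace : ∀ i → IsFace (face i)
      hasDim : ∀ i → HasDim (face i) (toℕ i)
      chain  : ∀ {i j} → i Fin.< j → face i ⊂ face j

  open Flag public

  infix 4 _≈_ _∈ᶻ_ _∈ᵗ_ _≅_ _~_

  _≈_ : Flag → Flag → Set
  f ≈ g = ∀ i → face f i ≡ face g i

  -- The graph of σ_{i+1}: σ i f g says that g is the image of f.  That the new
  -- face lies between its neighbours is part of g being a flag.
  σ : Fin d → Flag → Flag → Set
  σ i f g = face g i ≢ face f i × (∀ j → j ≢ i → face g j ≡ face f j)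

  σ₁ : Flag → Flag → Set
  σ₁ f g = Σ (Fin d) λ i → toℕ i ≡ 0 × σ i f g

  -- The graph of T = σ_d ⋯ σ₁, with h i the flag obtained after i steps.
  T : Flag → Flag → Set
  T f g = Σ (Fin (suc d) → Flag) λ h →
    h Fin.zero ≈ f × (∀ i → σ i (h (inject₁ i)) (h (Fin.suc i))) × h (fromℕ d) ≈ g

  -- x a b is x_{a+1,b+1}; it is meaningful only for a + b < d.
  record Triangle (f : Flag) : Set where
    field
      x        : ℕ → ℕ → Subset n
      x-isFace : ∀ {a b} → a + b < d → IsFace (x a b)
      x-hasDim : ∀ {a b} → a + b < d → HasDim (x a b) a
      base     : ∀ i → x (toℕ i) 0 ≡ face f i
      up       : ∀ {a b} → suc a + b < d → x a b ⊂ x (suc a) b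
      diagonal : ∀ {a b} → a + suc b < d → x a (suc b) ⊂ x (suc a) b
      distinct : ∀ {a b} → a + suc b < d → x a (suc b) ≢ x a b

  open Triangle public using (x)

  -- The graph of f ↦ fᵗ.
  Reverse : Flag → Flag → Set
  Reverse f g = Σ (Triangle f) λ t → ∀ i → face g i ≡ x t (toℕ i) (toℕ (opposite i))

  -- A circuit of flags, as a sequence indexed by ℕ modulo len.
  record Zigzag : Set where
    field
      len      : ℕ
      0<len    : 0 < len
      flag     : ℕ → Flag
      periodic : ∀ j → flag (j + len) ≈ flag j
      step     : ∀ j → T (flag j) (flag (suc j))
      distinct : ∀ {i j} → i < len → j < len → flag i ≈ flag j → i ≡ j

  open Zigzag public using (len; flag)

  _≅_ : Zigzag → Zigzag → Set
  Z ≅ W = len Z ≡ len W × ∃[ k ] (∀ j → flag W j ≈ flag Z (j + k))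

  -- W = Zᵗ.  Counting from 0, the flag of Zᵗ at position len-1-i is the
  -- reverse of the flag of Z at position i.
  IsReverse : Zigzag → Zigzag → Set
  IsReverse Z W =
    len Z ≡ len W × (∀ i j → suc (i + j) ≡ len Z → Reverse (flag Z i) (flag W j))

  _~_ : Zigzag → Zigzag → Set
  Z ~ W = Z ≅ W ⊎ (∃[ Zᵗ ] IsReverse Z Zᵗ × Zᵗ ≅ W)

  _∈ᶻ_ : Flag → Zigzag → Set
  g ∈ᶻ Z = ∃[ j ] g ≈ flag Z j

  _∈ᵗ_ : Flag → Zigzag → Set
  g ∈ᵗ Z = ∃[ Zᵗ ] IsReverse Z Zᵗ × g ∈ᶻ Zᵗ

  NoSelfIntersections : Zigzag → Set
  NoSelfIntersections Z =
    ∀ f → f ∈ᶻ Z → ∀ g → σ₁ f g → ¬ (g ∈ᶻ Z ⊎ g ∈ᵗ Z)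

  Signature : Zigzag → Zigzag → ℕ × ℕ → Set
  Signature Z W (a , b) =
    Count {len Z} (λ j → ∃[ g ] σ₁ (flag Z (toℕ j)) g × g ∈ᶻ W) a ×
    Count {len Z} (λ j → ∃[ g ] σ₁ (flag Z (toℕ j)) g × g ∈ᵗ W) b

  NormalizedSignature : Zigzag → Zigzag → ℕ × ℕ → Set
  NormalizedSignature Z W (a , b) =
    a ≤ b × (Signature Z W (a , b) ⊎ Signature Z W (b , a))

  -- z-vector l^m.
  ZVector : ℕ → ℕ → Set
  ZVector l m =
    Exactly _~_ m (λ _ → ⊤) × (∀ Z → len Z ≡ l × NoSelfIntersections Z)

  -- Z has intersection vector s^m.
  IntersectionVector : Zigzag → ℕ × ℕ → ℕ → Set
  IntersectionVector Z s m =
    Exactly _~_ m (λ W → ¬ (Z ~ W) × NormalizedSignature Z W s) ×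
    (∀ W → ¬ (Z ~ W) → NormalizedSignature Z W s ⊎ NormalizedSignature Z W (0 , 0))

{-# OPTIONS --safe #-}

-- A flag of either polytope is a sequence of d distinct vertices, no two of
-- them antipodal, and T drops the first vertex and appends the only one that
-- completes the rest to a new facet.  A zigzag is therefore an n-periodic word
-- in which each of the n vertices occurs once per period (with letters d apart
-- antipodal for the cross-polytope), its flags are the windows of length d, and
-- the reverse zigzag reads the word backwards.  σ₁ at position j exchanges two
-- consecutive letters, and by the rigidity of facets the resulting flag lies on
-- the word obtained by exchanging these letters everywhere.  Comparing which
-- vertices are neighbours in the exchanged words shows which of them agree up
-- to rotation and reflection; rotating and reflecting every word into a normal
-- form counts the zigzags.

module Submission where

open import Defs
open import Algebra.Properties.CommutativeMonoid.Sum using (∑-distrib-+)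
open import Data.Bool.Base as Bool using (true; false; if_then_else_)
open import Data.Bool.Properties as Boolₚ using ()
open import Data.Fin.Base as Fin
  using (Fin; zero; suc; toℕ; fromℕ; fromℕ<; inject₁; opposite; punchIn; punchOut; remQuot;
    combine; splitAt; _↑ˡ_; _↑ʳ_; finToFun; funToFin)
open import Data.Fin.Induction using (<-weakInduction; >-weakInduction)
open import Data.Fin.Properties as Finₚ
  using (_≟_; any?; all?; toℕ<n; toℕ-injective; toℕ-fromℕ; toℕ-fromℕ<; toℕ-inject₁;
    opposite-prop; injective⇒≤; punchIn-injective; punchInᵢ≢i; punchIn-mono-≤;
    punchIn-cancel-≤; punchIn-punchOut; punchOut-injective; remQuot-combine; combine-remQuot;
    splitAt-↑ˡ; splitAt-↑ʳ; splitAt⁻¹-↑ˡ; splitAt⁻¹-↑ʳ; funToFin-finToFin; finToFun-funToFin)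
open import Data.Fin.Subset
  using (Subset; inside; outside; _∈_; _∉_; _⊆_; _⊂_; Nonempty; ∣_∣; ⁅_⁆; _∪_; ⊥)
open import Data.Fin.Subset.Properties as Subsetₚ
  using (_∈?_; ⊆-antisym; p⊂q⇒∣p∣<∣q∣; p⊂q⇒p⊆q; x∈⁅x⁆; x∈⁅y⁆⇒x≡y; x∈p∪q⁺; x∈p∪q⁻; ∣⁅x⁆∣≡1;
    ∣⊥∣≡0; ∣⊤∣≡n; ⊆⊤; ∈⊤)
open import Data.Integer.Base as ℤ using (ℤ; 0ℤ; 1ℤ; +≤+; -≤+)
open import Data.Integer.Properties as ℤₚ using (+-0-commutativeMonoid)
open import Data.List.Base using (tabulate)
open import Data.List.Properties using (length-tabulate)
open import Data.List.Relation.Unary.All.Properties as Allₚ using ()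
open import Data.List.Relation.Unary.AllPairs.Properties as AllPairsₚ using ()
open import Data.List.Relation.Unary.Any.Properties as Anyₚ using ()
open import Data.Nat.Base
open import Data.Nat.DivMod
  using (m≡m%n+[m/n]*n; m%n<n; m/n≡1+[m∸n]/n; [m+n]%n≡m%n; m<n⇒m/n≡0; m<n⇒m%n≡m; m*n/n≡m)
open import Data.Nat.Properties as ℕₚ
  using (≤-refl; ≤-trans; <-≤-trans; ≤-<-trans; <-trans; ≤-total; +-comm; +-assoc; +-suc;
    m≤m+n; m≤n+m; 1+n≰n; n<1+n; m+[n∸m]≡n; m∸n+n≡m)
open import Data.Nat.Solver using (module +-*-Solver)
open import Data.Product.Base using (∃; _×_; _,_; proj₁; proj₂)
open import Data.Sum.Base as Sum using (_⊎_; inj₁; inj₂; [_,_]′)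
open import Data.Unit.Base using (⊤)
open import Data.Vec.Base using ([]; _∷_; here; there)
open import Data.Vec.Functional using (Vector)
open import Data.Vec.Properties as Vecₚ using ()
open import Function.Base using (_∘_; id)
open import Function.Bundles using (_⇔_; mk⇔; Equivalence)
open import Function.Definitions using (Injective)
open import Relation.Binary.Definitions using (tri<; tri≈; tri>)
open import Relation.Binary.PropositionalEquality
  using (_≡_; _≢_; refl; sym; trans; cong; cong₂; subst; subst₂; module ≡-Reasoning)
open import Relation.Nullary using (¬_; Dec; yes; no; does; contradiction; _×-dec_; _⊎-dec_; ¬?)
open import Relation.Nullary.Decidable using (map′)

-- Finite sets

-- The polytopes differ in how a window of d letters continues. The turn rule w (q + i) = τ (w i)
-- absorbs this difference, so that one argument about words serves both. The exponents come from
-- counting positions. The automorphism exchanging x with y also exchanges τ x with τ y, so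
-- positions q apart give the same exchanged word. For the simplex q = n, hence n neighbours, each
-- met once; for the cross-polytope q = n / 2, hence d neighbours, each met twice. The other entry
-- of the signature is 0, since no word is a rotation of its own reversal. The obstacle is the
-- shortest cycle. Exchanged words are told apart by two vertices that are adjacent in one and up to
-- three positions apart in the other; on a cycle of length 4, distance three is adjacency again.
-- For the tetrahedron the exchanges two positions apart indeed agree up to reversal, and the four
-- positions form two classes, each met once in either orientation.

injective⇒surjective : ∀ {n} {f : Fin n → Fin n} → Injective _≡_ _≡_ f →
                       ∀ y → ∃ λ x → f x ≡ y
injective⇒surjective {suc n} {f} inj y with any? (λ x → f x ≟ y)
... | yes p = p
... | no ¬p = contradiction
  (injective⇒≤ {f = λ x → punchOut (avoids x)}
    (λ {a} {b} eq → inj (punchOut-injective (avoids a) (avoids b) eq)))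
  1+n≰n
  where
  avoids : ∀ x → y ≢ f x
  avoids x eq = ¬p (x , sym eq)

members : ∀ {n} (S : Subset n) → Fin ∣ S ∣ → Fin n
members (inside ∷ S) zero = zero
members (inside ∷ S) (suc i) = suc (members S i)
members (outside ∷ S) i = suc (members S i)

members-∈ : ∀ {n} (S : Subset n) i → members S i ∈ S
members-∈ (inside ∷ S) zero = here
members-∈ (inside ∷ S) (suc i) = there (members-∈ S i)
members-∈ (outside ∷ S) i = there (members-∈ S i)

members-injective : ∀ {n} (S : Subset n) → Injective _≡_ _≡_ (members S)
members-injective (inside ∷ S) {zero} {zero} eq = refl
members-injective (inside ∷ S) {suc i} {suc j} eq =
  cong suc (members-injective S (Finₚ.suc-injective eq))
members-injective (outside ∷ S) eq = members-injective S (Finₚ.suc-injective eq)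

⊆∧≢⇒⊂ : ∀ {n} {A B : Subset n} → A ⊆ B → A ≢ B → A ⊂ B
⊆∧≢⇒⊂ {A = A} {B} A⊆B A≢B with any? (λ x → x ∈? B ×-dec ¬? (x ∈? A))
... | yes p = A⊆B , p
... | no ¬p = contradiction (⊆-antisym A⊆B back) A≢B
  where
  back : B ⊆ A
  back {x} x∈B with x ∈? A
  ... | yes x∈A = x∈A
  ... | no x∉A = contradiction (x , x∈B , x∉A) ¬p

⊆∧≥⇒≡ : ∀ {n} {A B : Subset n} → A ⊆ B → ∣ B ∣ ≤ ∣ A ∣ → A ≡ B
⊆∧≥⇒≡ {A = A} {B} A⊆B B≤A with Vecₚ.≡-dec Boolₚ._≟_ A B
... | yes eq = eq
... | no ne = contradiction (<-≤-trans (p⊂q⇒∣p∣<∣q∣ (⊆∧≢⇒⊂ A⊆B ne)) B≤A) (ℕₚ.<-irrefl refl)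

singleton : ∀ {n} {S : Subset n} → ∣ S ∣ ≡ 1 → ∃ λ x → S ≡ ⁅ x ⁆
singleton {S = S} eq = y , sym (⊆∧≥⇒≡ sub (ℕₚ.≤-reflexive (trans eq (sym (∣⁅x⁆∣≡1 y)))))
  where
  y = members S (subst Fin (sym eq) zero)
  sub : ⁅ y ⁆ ⊆ S
  sub z∈ = subst (_∈ S) (sym (x∈⁅y⁆⇒x≡y y z∈)) (members-∈ S _)

-- Cyclic words

-- For the simplex τ is the identity and q = n = d + 1; for the cross-polytope τ
-- is the antipodal map, q = d and n = 2 d.  In both cases x # y says that x and
-- y span an edge, and q is the number of pairwise adjacent vertices that, up to
-- τ, exhaust all vertices.
data Shape (n d q : ℕ) (τ : Fin n → Fin n) : Set where
  untwisted : q ≡ suc d → n ≡ q → (∀ x → τ x ≡ x) → Shape n d q τ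
  twisted   : q ≡ d → n ≡ q + q → (∀ x → τ x ≢ x) → Shape n d q τ

record Complex : Set where
  field
    n d q : ℕ
    τ     : Fin n → Fin n

  infix 4 _#_
  _#_ : Fin n → Fin n → Set
  x # y = x ≢ y × x ≢ τ y

  field
    3≤d          : 3 ≤ d
    τ-involutive : ∀ x → τ (τ x) ≡ x
    shape        : Shape n d q τ
    cover        : (v : Fin q → Fin n) → (∀ {r s} → r ≢ s → v r # v s) →
                   ∀ x → ∃ λ r → x ≡ v r ⊎ x ≡ τ (v r)

module Words (C : Complex) where
  open Complex C public

  #-sym : ∀ {x y} → x # y → y # x
  #-sym (x≢y , x≢τy) = (x≢y ∘ sym) , λ y≡τx → x≢τy (trans (sym (τ-involutive _)) (cong τ (sym y≡τx)))

  #-τ : ∀ {x y} → x # y → x # τ y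
  #-τ (x≢y , x≢τy) = x≢τy , λ eq → x≢y (trans eq (τ-involutive _))

  τ-# : ∀ {x y} → x # y → τ x # τ y
  τ-# p = #-τ (#-sym (#-τ (#-sym p)))

  d≤q : d ≤ q
  d≤q with shape
  ... | untwisted eq _ _ = subst (d ≤_) (sym eq) (ℕₚ.n≤1+n d)
  ... | twisted eq _ _ = ℕₚ.≤-reflexive (sym eq)

  q≤n : q ≤ n
  q≤n with shape
  ... | untwisted _ eq _ = ℕₚ.≤-reflexive (sym eq)
  ... | twisted _ eq _ = subst (q ≤_) (sym eq) (m≤m+n q q)

  3≤q : 3 ≤ q
  3≤q = ≤-trans 3≤d d≤q

  d<n : d < n
  d<n with shape
  ... | untwisted eq eq′ _ = ℕₚ.≤-reflexive (sym (trans eq′ eq))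
  ... | twisted eq eq′ _ = subst₂ (_<_) eq (sym eq′) (ℕₚ.+-mono-≤ (≤-trans (s≤s z≤n) 3≤q) (≤-refl {q}))

  4≤n : 4 ≤ n
  4≤n = ≤-trans (s≤s 3≤d) d<n

  instance
    n-nonZero : NonZero n
    n-nonZero = >-nonZero (≤-trans (s≤s z≤n) 4≤n)

  Separated : (ℕ → Fin n) → Set
  Separated w = ∀ {e} i → 0 < e → e < q → w i # w (e + i)

  separated-≢ : ∀ {w} → Separated w → ∀ {i j} → i < q → j < q → i ≢ j → w i # w j
  separated-≢ {w} sep {i} {j} i<q j<q i≢j with ℕₚ.<-cmp i j
  ... | tri≈ _ i≡j _ = contradiction i≡j i≢j
  ... | tri< i<j _ _ = subst (w i #_) (cong w (m∸n+n≡m (ℕₚ.<⇒≤ i<j)))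
    (sep i (ℕₚ.m<n⇒0<n∸m i<j) (≤-<-trans (ℕₚ.m∸n≤m j i) j<q))
  ... | tri> _ _ j<i = #-sym (subst (w j #_) (cong w (m∸n+n≡m (ℕₚ.<⇒≤ j<i)))
    (sep j (ℕₚ.m<n⇒0<n∸m j<i) (≤-<-trans (ℕₚ.m∸n≤m i j) i<q)))

  record Word : Set where
    no-eta-equality
    field
      letter    : ℕ → Fin n
      separated : Separated letter
      turn      : ∀ i → letter (q + i) ≡ τ (letter i)

    periodic : ∀ i → letter (n + i) ≡ letter i
    periodic i with shape
    ... | untwisted _ eq τ≗id =
      trans (cong (λ k → letter (k + i)) eq) (trans (turn i) (τ≗id _))
    ... | twisted _ eq _ = begin
      letter (n + i)       ≡⟨ cong (λ k → letter (k + i)) eq ⟩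
      letter (q + q + i)   ≡⟨ cong letter (+-assoc q q i) ⟩
      letter (q + (q + i)) ≡⟨ turn _ ⟩
      τ (letter (q + i))   ≡⟨ cong τ (turn i) ⟩
      τ (τ (letter i))     ≡⟨ τ-involutive _ ⟩
      letter i             ∎
      where open ≡-Reasoning

    -- In the twisted case `separated` covers only e < q. For e = q the letters are antipodal and τ
    -- has no fixed point; for e > q the letter at e + i is the antipode of the one at e - q + i,
    -- and `#` excludes antipodes too.
    distinct : ∀ {e} i → 0 < e → e < n → letter (e + i) ≢ letter i
    distinct {e} i 0<e e<n eq with shape
    ... | untwisted _ n≡q _ = proj₁ (separated i 0<e (subst (e <_) n≡q e<n)) (sym eq)
    ... | twisted _ n≡q+q τ≢id with ℕₚ.<-cmp e q
    ...   | tri< e<q _ _ = proj₁ (separated i 0<e e<q) (sym eq)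
    ...   | tri≈ _ refl _ = τ≢id _ (trans (sym (turn i)) eq)
    ...   | tri> _ _ q<e = proj₂ (separated i (ℕₚ.m<n⇒0<n∸m q<e) f<q) (sym (begin
      τ (letter (e ∸ q + i))   ≡⟨ turn _ ⟨
      letter (q + (e ∸ q + i)) ≡⟨ cong letter (sym (+-assoc q (e ∸ q) i)) ⟩
      letter (q + (e ∸ q) + i) ≡⟨ cong (λ k → letter (k + i)) (m+[n∸m]≡n (ℕₚ.<⇒≤ q<e)) ⟩
      letter (e + i)           ≡⟨ eq ⟩
      letter i                 ∎))
      where
      open ≡-Reasoning
      f<q : e ∸ q < q
      f<q = ℕₚ.+-cancelˡ-< q (e ∸ q) q
        (subst₂ _<_ (sym (m+[n∸m]≡n (ℕₚ.<⇒≤ q<e))) n≡q+q e<n)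

  open Word public

  Periodic : (ℕ → Fin n) → Set
  Periodic v = ∀ i → v (n + i) ≡ v i

  periodic-* : ∀ {v} → Periodic v → ∀ k i → v (k * n + i) ≡ v i
  periodic-* p zero i = refl
  periodic-* {v} p (suc k) i = trans (cong v (+-assoc n (k * n) i)) (trans (p _) (periodic-* {v} p k i))

  period-divides : ∀ W {e} i → letter W (e + i) ≡ letter W i → e ≡ (e / n) * n
  period-divides W {e} i eq with e % n in eq%
  ... | zero = trans (m≡m%n+[m/n]*n e n) (cong (_+ e / n * n) eq%)
  ... | suc r = contradiction (begin
    letter W (e % n + i)                 ≡⟨ periodic-* {letter W} (periodic W) (e / n) _ ⟨
    letter W (e / n * n + (e % n + i))   ≡⟨ cong (letter W) (sym (+-assoc (e / n * n) (e % n) i)) ⟩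
    letter W (e / n * n + e % n + i)     ≡⟨ cong (λ k → letter W (k + i)) (+-comm (e / n * n) (e % n)) ⟩
    letter W (e % n + e / n * n + i)     ≡⟨ cong (λ k → letter W (k + i)) (m≡m%n+[m/n]*n e n) ⟨
    letter W (e + i)                     ≡⟨ eq ⟩
    letter W i                           ∎)
    (distinct W i (subst (0 <_) (sym eq%) z<s) (m%n<n e n))
    where open ≡-Reasoning

  transfer-≤ : ∀ W {v} → Periodic v → ∀ {i j} → i ≤ j → letter W j ≡ letter W i → v j ≡ v i
  transfer-≤ W {v} p {i} {j} i≤j eq = begin
    v j                     ≡⟨ cong v (m∸n+n≡m i≤j) ⟨
    v (j ∸ i + i)           ≡⟨ cong (λ k → v (k + i)) (period-divides W i (trans (cong (letter W) (m∸n+n≡m i≤j)) eq)) ⟩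
    v ((j ∸ i) / n * n + i) ≡⟨ periodic-* {v} p ((j ∸ i) / n) i ⟩
    v i                     ∎
    where open ≡-Reasoning

  -- Equal letters of W stand at positions that differ by a multiple of n, so every n-periodic
  -- sequence factors through the letters of W. Applied to the sequence of following letters, this
  -- makes `next` independent of the occurrence that `index` picks.
  transfer : ∀ W {v} → Periodic v → ∀ {i j} → letter W i ≡ letter W j → v i ≡ v j
  transfer W p {i} {j} eq with ≤-total i j
  ... | inj₁ i≤j = sym (transfer-≤ W p i≤j (sym eq))
  ... | inj₂ j≤i = transfer-≤ W p j≤i eq

  letter-injective-≤ : ∀ W {i j} → i ≤ j → j < n → letter W i ≡ letter W j → i ≡ j
  letter-injective-≤ W {i} {j} i≤j j<n eq with ℕₚ.m≤n⇒m<n∨m≡n i≤j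
  ... | inj₂ i≡j = i≡j
  ... | inj₁ i<j = contradiction
    (trans (cong (letter W) (m∸n+n≡m i≤j)) (sym eq))
    (distinct W i (ℕₚ.m<n⇒0<n∸m i<j) (≤-<-trans (ℕₚ.m∸n≤m j i) j<n))

  letter-injective : ∀ W {i j} → i < n → j < n → letter W i ≡ letter W j → i ≡ j
  letter-injective W {i} {j} i<n j<n eq with ≤-total i j
  ... | inj₁ i≤j = letter-injective-≤ W i≤j j<n eq
  ... | inj₂ j≤i = sym (letter-injective-≤ W j≤i i<n (sym eq))

  position : ∀ W x → ∃ λ (r : Fin n) → letter W (toℕ r) ≡ x
  position W = injective⇒surjective
    (λ eq → toℕ-injective (letter-injective W (toℕ<n _) (toℕ<n _) eq))

  index : Word → Fin n → ℕ
  index W x = toℕ (proj₁ (position W x))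

  index<n : ∀ W x → index W x < n
  index<n W x = toℕ<n _

  letter-index : ∀ W x → letter W (index W x) ≡ x
  letter-index W x = proj₂ (position W x)

  index-letter : ∀ W {i} → i < n → index W (letter W i) ≡ i
  index-letter W i<n = letter-injective W (index<n W _) i<n (letter-index W _)

  next : Word → Fin n → Fin n
  next W x = letter W (suc (index W x))

  next-letter : ∀ W i → next W (letter W i) ≡ letter W (suc i)
  next-letter W i = transfer W {letter W ∘ suc}
    (λ k → trans (cong (letter W) (sym (+-suc n k))) (periodic W (suc k)))
    (letter-index W (letter W i))

  next-surjective : ∀ W x → ∃ λ y → next W y ≡ x
  next-surjective W x = letter W (pred n + index W x) , (begin
    next W (letter W (pred n + index W x))  ≡⟨ next-letter W _ ⟩
    letter W (suc (pred n) + index W x)     ≡⟨ cong (λ k → letter W (k + index W x)) (ℕₚ.suc-pred n) ⟩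
    letter W (n + index W x)                ≡⟨ periodic W _ ⟩
    letter W (index W x)                    ≡⟨ letter-index W x ⟩
    x                                       ∎)
    where open ≡-Reasoning

  -- Up to rotation a word is determined by its successor function, and reversing
  -- the word inverts this function; so no comparison of positions is needed.
  record Rot (W W′ : Word) : Set where
    constructor rot
    field next-same : ∀ x → next W x ≡ next W′ x

  record Anti (W W′ : Word) : Set where
    constructor anti
    field next-next : ∀ x → next W′ (next W x) ≡ x

  open Rot public
  open Anti public

  Dih : Word → Word → Set
  Dih W W′ = Rot W W′ ⊎ Anti W W′

  Rot-refl : ∀ {W} → Rot W W
  Rot-refl = rot λ _ → refl

  Rot-sym : ∀ {W W′} → Rot W W′ → Rot W′ W
  Rot-sym (rot r) = rot (sym ∘ r)

  Rot-trans : ∀ {W W′ W″} → Rot W W′ → Rot W′ W″ → Rot W W″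
  Rot-trans (rot r) (rot s) = rot λ x → trans (r x) (s x)

  -- `Anti` asks for a one-sided inverse only; surjectivity of `next W` makes it two-sided.
  Anti-sym : ∀ {W W′} → Anti W W′ → Anti W′ W
  Anti-sym {W} {W′} (anti a) = anti λ x → let y , eq = next-surjective W x in
    subst (λ x → next W (next W′ x) ≡ x) eq (cong (next W) (a y))

  Rot-Anti : ∀ {W W′ W″} → Rot W W′ → Anti W′ W″ → Anti W W″
  Rot-Anti {W″ = W″} (rot r) (anti a) = anti λ x → trans (cong (next W″) (r x)) (a x)

  Anti-Rot : ∀ {W W′ W″} → Anti W W′ → Rot W′ W″ → Anti W W″
  Anti-Rot (anti a) (rot r) = anti λ x → trans (sym (r _)) (a x)

  Anti-Anti : ∀ {W W′ W″} → Anti W W′ → Anti W′ W″ → Rot W W″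
  Anti-Anti {W} {W′} {W″} a (anti b) = rot λ x → let y , eq = next-surjective W′ x in
    subst (λ x → next W x ≡ next W″ x) eq (trans (next-next (Anti-sym a) y) (sym (b y)))

  Dih-sym : ∀ {W W′} → Dih W W′ → Dih W′ W
  Dih-sym (inj₁ r) = inj₁ (Rot-sym r)
  Dih-sym (inj₂ a) = inj₂ (Anti-sym a)

  Dih-trans : ∀ {W W′ W″} → Dih W W′ → Dih W′ W″ → Dih W W″
  Dih-trans (inj₁ r) (inj₁ s) = inj₁ (Rot-trans r s)
  Dih-trans (inj₁ r) (inj₂ s) = inj₂ (Rot-Anti r s)
  Dih-trans (inj₂ r) (inj₁ s) = inj₂ (Anti-Rot r s)
  Dih-trans (inj₂ r) (inj₂ s) = inj₁ (Anti-Anti r s)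

  Rot? : ∀ W W′ → Dec (Rot W W′)
  Rot? W W′ = map′ rot next-same (all? (λ x → next W x ≟ next W′ x))

  Anti? : ∀ W W′ → Dec (Anti W W′)
  Anti? W W′ = map′ anti next-next (all? (λ x → next W′ (next W x) ≟ x))

  -- Being successor functions on a finite set, the words can be compared effectively; this later
  -- decides whether a given zigzag is met at all.
  Dih? : ∀ W W′ → Dec (Dih W W′)
  Dih? W W′ = Rot? W W′ ⊎-dec Anti? W W′

  -- Otherwise `next W` would be an involution and letters two apart would coincide, while n ≥ 4.
  -- This keeps the two types of intersection apart.
  ¬Anti-self : ∀ W → ¬ Anti W W
  ¬Anti-self W (anti a) = distinct W {2} 0 z<s (≤-trans (s≤s (s≤s (s≤s z≤n))) 4≤n) (begin
    letter W 2                    ≡⟨ next-letter W 1 ⟨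
    next W (letter W 1)           ≡⟨ cong (next W) (next-letter W 0) ⟨
    next W (next W (letter W 0))  ≡⟨ a _ ⟩
    letter W 0                    ∎)
    where open ≡-Reasoning

  shift : Word → ℕ → Word
  shift W j = record
    { letter    = λ m → letter W (m + j)
    ; separated = λ {e} i 0<e e<q → subst (λ k → letter W (i + j) # letter W k)
                    (sym (+-assoc e i j)) (separated W (i + j) 0<e e<q)
    ; turn      = λ i → trans (cong (letter W) (+-assoc q i j)) (turn W (i + j))
    }

  index-from : ∀ W j x → ∃ λ m → letter W (m + j) ≡ x
  index-from W j x = index (shift W j) x , letter-index (shift W j) x

  aligned⇒Rot : ∀ {W W′} j k → (∀ m → letter W (m + j) ≡ letter W′ (m + k)) → Rot W W′
  aligned⇒Rot {W} {W′} j k eq = rot λ x → let m , at = index-from W j x in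
    subst (λ x → next W x ≡ next W′ x) at (begin
    next W (letter W (m + j))    ≡⟨ next-letter W _ ⟩
    letter W (suc m + j)         ≡⟨ eq (suc m) ⟩
    letter W′ (suc m + k)        ≡⟨ next-letter W′ _ ⟨
    next W′ (letter W′ (m + k))  ≡⟨ cong (next W′) (eq m) ⟨
    next W′ (letter W (m + j))   ∎)
    where open ≡-Reasoning

  Rot-shift : ∀ W j → Rot W (shift W j)
  Rot-shift W j = aligned⇒Rot j 0
    (λ m → cong (λ i → letter W (i + j)) (sym (ℕₚ.+-identityʳ m)))

  Rot-align : ∀ {W W′} → Rot W W′ → ∀ {j k} → letter W j ≡ letter W′ k →
              ∀ m → letter W (m + j) ≡ letter W′ (m + k)
  Rot-align r eq zero = eq
  Rot-align {W} {W′} e@(rot r) {j} {k} eq (suc m) = begin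
    letter W (suc m + j)         ≡⟨ next-letter W _ ⟨
    next W (letter W (m + j))    ≡⟨ r _ ⟩
    next W′ (letter W (m + j))   ≡⟨ cong (next W′) (Rot-align e eq m) ⟩
    next W′ (letter W′ (m + k))  ≡⟨ next-letter W′ _ ⟩
    letter W′ (suc m + k)        ∎
    where open ≡-Reasoning

  -- W is read backwards from k while W′ is read forwards from j; the equation m + t ≡ k replaces a
  -- truncated subtraction.
  Anti-align : ∀ {W W′} → Anti W W′ → ∀ {j k} → letter W k ≡ letter W′ j →
               ∀ m t → m + t ≡ k → letter W t ≡ letter W′ (m + j)
  Anti-align a eq zero t refl = eq
  Anti-align {W} {W′} e@(anti a) {j} {k} eq (suc m) t m+t≡k = begin
    letter W t                    ≡⟨ a _ ⟨
    next W′ (next W (letter W t)) ≡⟨ cong (next W′) (next-letter W t) ⟩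
    next W′ (letter W (suc t))    ≡⟨ cong (next W′) (Anti-align e eq m (suc t) (trans (+-suc m t) m+t≡k)) ⟩
    next W′ (letter W′ (m + j))   ≡⟨ next-letter W′ _ ⟩
    letter W′ (suc m + j)         ∎
    where open ≡-Reasoning

  block-determines : ∀ W W′ → (∀ {m} → m < q → letter W m ≡ letter W′ m) →
                     ∀ m → letter W m ≡ letter W′ m
  block-determines W W′ eq m = subst (λ k → letter W k ≡ letter W′ k)
    (trans (+-comm _ (m % q)) (sym (m≡m%n+[m/n]*n m q))) (go (m / q))
    where
    instance
      q-nonZero : NonZero q
      q-nonZero = >-nonZero (≤-trans (s≤s z≤n) 3≤q)
    go : ∀ k → letter W (k * q + m % q) ≡ letter W′ (k * q + m % q)
    go zero = eq (m%n<n m q)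
    go (suc k) rewrite +-assoc q (k * q) (m % q) =
      trans (turn W _) (trans (cong τ (go k)) (sym (turn W′ _)))

  -- This is the rigidity of facets. In the cross-polytope d letters already fill a block. In the
  -- simplex one letter is missing: `cover` finds it among the q letters of W′, and the first d of
  -- these already occur earlier in W.
  window-extends : ∀ W W′ → (∀ {m} → m < d → letter W m ≡ letter W′ m) →
                   ∀ {m} → m < q → letter W m ≡ letter W′ m
  window-extends W W′ eq {m} m<q with shape
  ... | twisted q≡d _ _ = eq (subst (m <_) q≡d m<q)
  ... | untwisted q≡1+d _ τ≗id with ℕₚ.m≤n⇒m<n∨m≡n (s≤s⁻¹ (subst (m <_) q≡1+d m<q))
  ...   | inj₁ m<d = eq m<d
  ...   | inj₂ refl with cover (letter W′ ∘ toℕ) (separated-≢ {letter W′} (separated W′) (toℕ<n _) (toℕ<n _) ∘ (_∘ toℕ-injective)) (letter W m)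
  ...     | r , found with ℕₚ.m≤n⇒m<n∨m≡n (s≤s⁻¹ (subst (toℕ r <_) q≡1+d (toℕ<n r)))
  ...       | inj₂ r≡d = trans ([ id , (λ e → trans e (τ≗id _)) ]′ found) (cong (letter W′) r≡d)
  ...       | inj₁ r<d = contradiction (letter-injective W (<-≤-trans m<q q≤n) (<-≤-trans (toℕ<n r) q≤n)
    (trans ([ id , (λ e → trans e (τ≗id _)) ]′ found) (sym (eq r<d))))
    (λ e → ℕₚ.<-irrefl (sym e) r<d)

  window-determines : ∀ {W W′} j k → (∀ {m} → m < d → letter W (m + j) ≡ letter W′ (m + k)) → Rot W W′
  window-determines {W} {W′} j k eq = aligned⇒Rot j k
    (block-determines (shift W j) (shift W′ k) (window-extends (shift W j) (shift W′ k) eq))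

  -- ρ i is congruent to - i modulo n.
  ρ : ℕ → ℕ
  ρ zero = 0
  ρ (suc i) = pred n + ρ i

  ρ-+ : ∀ e i → ρ (e + i) ≡ e * pred n + ρ i
  ρ-+ zero i = refl
  ρ-+ (suc e) i = trans (cong (pred n +_) (ρ-+ e i)) (sym (+-assoc (pred n) (e * pred n) (ρ i)))

  ρ-cancel : ∀ W e i → letter W (e + ρ (e + i)) ≡ letter W (ρ i)
  ρ-cancel W e i = begin
    letter W (e + ρ (e + i))            ≡⟨ cong (λ k → letter W (e + k)) (ρ-+ e i) ⟩
    letter W (e + (e * pred n + ρ i))   ≡⟨ cong (letter W) (+-assoc e _ _) ⟨
    letter W (e + e * pred n + ρ i)     ≡⟨ cong (λ k → letter W (k + ρ i)) (ℕₚ.*-suc e (pred n)) ⟨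
    letter W (e * suc (pred n) + ρ i)   ≡⟨ cong (λ k → letter W (e * k + ρ i)) (ℕₚ.suc-pred n) ⟩
    letter W (e * n + ρ i)              ≡⟨ periodic-* {letter W} (periodic W) e (ρ i) ⟩
    letter W (ρ i)                      ∎
    where open ≡-Reasoning

  rev : Word → Word
  rev W = record
    { letter    = letter W ∘ ρ
    ; separated = λ {e} i 0<e e<q → #-sym (subst (letter W (ρ (e + i)) #_) (ρ-cancel W e i)
                    (separated W (ρ (e + i)) 0<e e<q))
    ; turn      = λ i → trans (sym (τ-involutive _))
                    (cong τ (trans (sym (turn W (ρ (q + i)))) (ρ-cancel W q i)))
    }

  Anti-rev : ∀ W → Anti W (rev W)
  Anti-rev W = Anti-sym (anti λ x → let m , at = index-from (rev W) 0 x in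
    subst (λ x → next W (next (rev W) x) ≡ x) at (begin
      next W (next (rev W) (letter (rev W) (m + 0)))  ≡⟨ cong (next W) (next-letter (rev W) (m + 0)) ⟩
      next W (letter W (ρ (suc (m + 0))))             ≡⟨ next-letter W _ ⟩
      letter W (suc (ρ (1 + (m + 0))))                ≡⟨ ρ-cancel W 1 (m + 0) ⟩
      letter (rev W) (m + 0)                          ∎))
    where open ≡-Reasoning

-- Exchanging two consecutive letters

module Swaps (C : Complex) where
  open Words C

  τ-injective : ∀ {x y} → τ x ≡ τ y → x ≡ y
  τ-injective eq = trans (sym (τ-involutive _)) (trans (cong τ eq) (τ-involutive _))

  -- τ is either the identity or free of fixed points, so a single fixed vertex identifies the
  -- simplex. This settles the cases in which the clauses of `exchange` overlap.
  τ-fixed : ∀ {x} → τ x ≡ x → ∀ y → τ y ≡ y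
  τ-fixed {x} eq with shape
  ... | untwisted _ _ τ≗id = τ≗id
  ... | twisted _ _ τ≢id = contradiction eq (τ≢id x)

  -- The automorphism of the polytope that exchanges x with y and τ x with τ y.
  exchange : Fin n → Fin n → Fin n → Fin n
  exchange x y z with z ≟ x | z ≟ τ x | z ≟ y | z ≟ τ y
  ... | yes _ | _     | _     | _     = y
  ... | no _  | yes _ | _     | _     = τ y
  ... | no _  | no _  | yes _ | _     = x
  ... | no _  | no _  | no _  | yes _ = τ x
  ... | no _  | no _  | no _  | no _  = z

  module _ {x y : Fin n} (x#y : x # y) where

    exchange-fst : exchange x y x ≡ y
    exchange-fst with x ≟ x
    ... | yes _ = refl
    ... | no x≢x = contradiction refl x≢x

    exchange-τfst : exchange x y (τ x) ≡ τ y
    exchange-τfst with τ x ≟ x | τ x ≟ τ x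
    ... | yes eq | _ = sym (τ-fixed eq y)
    ... | no _ | yes _ = refl
    ... | no _ | no ≢ = contradiction refl ≢

    exchange-snd : exchange x y y ≡ x
    exchange-snd with y ≟ x | y ≟ τ x | y ≟ y
    ... | yes eq | _ | _ = contradiction (sym eq) (proj₁ x#y)
    ... | no _ | yes eq | _ = contradiction eq (proj₂ (#-sym x#y))
    ... | no _ | no _ | yes _ = refl
    ... | no _ | no _ | no ≢ = contradiction refl ≢

    exchange-τsnd : exchange x y (τ y) ≡ τ x
    exchange-τsnd with τ y ≟ x | τ y ≟ τ x | τ y ≟ y | τ y ≟ τ y
    ... | yes eq | _ | _ | _ = contradiction (sym eq) (proj₂ x#y)
    ... | no _ | yes eq | _ | _ = contradiction (τ-injective (sym eq)) (proj₁ x#y)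
    ... | no _ | no _ | yes eq | _ = sym (τ-fixed eq x)
    ... | no _ | no _ | no _ | yes _ = refl
    ... | no _ | no _ | no _ | no ≢ = contradiction refl ≢

    exchange-other : ∀ {z} → x # z → y # z → exchange x y z ≡ z
    exchange-other {z} x#z y#z with z ≟ x | z ≟ τ x | z ≟ y | z ≟ τ y
    ... | yes eq | _ | _ | _ = contradiction (sym eq) (proj₁ x#z)
    ... | no _ | yes eq | _ | _ = contradiction eq (proj₂ (#-sym x#z))
    ... | no _ | no _ | yes eq | _ = contradiction (sym eq) (proj₁ y#z)
    ... | no _ | no _ | no _ | yes eq = contradiction eq (proj₂ (#-sym y#z))
    ... | no _ | no _ | no _ | no _ = refl

    data Place : Fin n → Set where
      fst   : Place x
      τfst  : Place (τ x)
      snd   : Place y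
      τsnd  : Place (τ y)
      other : ∀ {z} → x # z → y # z → Place z

    place : ∀ z → Place z
    place z with z ≟ x | z ≟ τ x | z ≟ y | z ≟ τ y
    ... | yes refl | _ | _ | _ = fst
    ... | no _ | yes refl | _ | _ = τfst
    ... | no _ | no _ | yes refl | _ = snd
    ... | no _ | no _ | no _ | yes refl = τsnd
    ... | no z≢x | no z≢τx | no z≢y | no z≢τy = other (#-sym (z≢x , z≢τx)) (#-sym (z≢y , z≢τy))

    exchange-involutive : ∀ z → exchange x y (exchange x y z) ≡ z
    exchange-involutive z with place z
    ... | fst = trans (cong (exchange x y) exchange-fst) exchange-snd
    ... | τfst = trans (cong (exchange x y) exchange-τfst) exchange-τsnd
    ... | snd = trans (cong (exchange x y) exchange-snd) exchange-fst
    ... | τsnd = trans (cong (exchange x y) exchange-τsnd) exchange-τfst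
    ... | other p q = trans (cong (exchange x y) (exchange-other p q)) (exchange-other p q)

    exchange-injective : ∀ {a b} → exchange x y a ≡ exchange x y b → a ≡ b
    exchange-injective eq = trans (sym (exchange-involutive _))
      (trans (cong (exchange x y) eq) (exchange-involutive _))

    exchange-τ : ∀ z → exchange x y (τ z) ≡ τ (exchange x y z)
    exchange-τ z with place z
    ... | fst = trans exchange-τfst (cong τ (sym exchange-fst))
    ... | τfst = trans (cong (exchange x y) (τ-involutive x)) (trans exchange-fst
      (trans (sym (τ-involutive y)) (cong τ (sym exchange-τfst))))
    ... | snd = trans exchange-τsnd (cong τ (sym exchange-snd))
    ... | τsnd = trans (cong (exchange x y) (τ-involutive y)) (trans exchange-snd
      (trans (sym (τ-involutive x)) (cong τ (sym exchange-τsnd))))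
    ... | other p q = trans (exchange-other (#-τ p) (#-τ q)) (cong τ (sym (exchange-other p q)))

    exchange-# : ∀ {a b} → a # b → exchange x y a # exchange x y b
    exchange-# (a≢b , a≢τb) = (a≢b ∘ exchange-injective) ,
      λ eq → a≢τb (exchange-injective (trans eq (sym (exchange-τ _))))

  exchange-ττ : ∀ {x y} → x # y → ∀ z → exchange (τ x) (τ y) z ≡ exchange x y z
  exchange-ττ {x} {y} x#y z with place x#y z
  ... | τfst = trans (exchange-fst τx#τy) (sym (exchange-τfst x#y))
    where τx#τy = τ-# x#y
  ... | τsnd = trans (exchange-snd τx#τy) (sym (exchange-τsnd x#y))
    where τx#τy = τ-# x#y
  ... | other p q = trans (exchange-other (τ-# x#y) (#-sym (#-τ (#-sym p))) (#-sym (#-τ (#-sym q))))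
    (sym (exchange-other x#y p q))
  ... | fst = trans (cong (exchange (τ x) (τ y)) (sym (τ-involutive x)))
    (trans (exchange-τfst (τ-# x#y)) (trans (τ-involutive y) (sym (exchange-fst x#y))))
  ... | snd = trans (cong (exchange (τ x) (τ y)) (sym (τ-involutive y)))
    (trans (exchange-τsnd (τ-# x#y)) (trans (τ-involutive x) (sym (exchange-snd x#y))))

  module _ (W : Word) (j : ℕ) where

    swapLetters : Fin n → Fin n
    swapLetters = exchange (letter W j) (letter W (suc j))

    private
      adjacent : letter W j # letter W (suc j)
      adjacent = separated W j z<s (≤-trans (s≤s (s≤s z≤n)) 3≤q)

    swap : Word
    swap = record
      { letter    = swapLetters ∘ letter W
      ; separated = λ i 0<e e<q → exchange-# adjacent (separated W i 0<e e<q)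
      ; turn      = λ i → trans (cong swapLetters (turn W i)) (exchange-τ adjacent _)
      }

    swap-here : letter swap j ≡ letter W (suc j)
    swap-here = exchange-fst adjacent

    swap-suc : letter swap (suc j) ≡ letter W j
    swap-suc = exchange-snd adjacent

    swap-far : ∀ {e} → 2 ≤ e → e < q → letter swap (e + j) ≡ letter W (e + j)
    swap-far {suc e} (s≤s 1≤e) e<q = exchange-other adjacent (separated W j z<s e<q)
      (subst (letter W (suc j) #_) (cong (letter W) (+-suc e j))
        (separated W (suc j) 1≤e (<-trans (n<1+n e) e<q)))

  swap-before : ∀ W i → letter (swap W (suc i)) i ≡ letter W i
  swap-before W i = exchange-other
    (separated W (suc i) z<s (≤-trans (s≤s (s≤s z≤n)) 3≤q))
    (#-sym (separated W i z<s (≤-trans (s≤s (s≤s z≤n)) 3≤q)))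
    (#-sym (separated W i z<s 3≤q))

  -- Positions q apart carry τ-related letters, and exchanging τ x with τ y is the same automorphism
  -- as exchanging x with y. For the cross-polytope this makes each neighbour appear twice.
  swap-turn : ∀ W k → Rot (swap W (q + k)) (swap W k)
  swap-turn W k = aligned⇒Rot 0 0 λ m →
    trans (cong₂ (λ x y → exchange x y (letter W (m + 0))) (turn W k)
      (trans (cong (letter W) (sym (+-suc q k))) (turn W (suc k))))
    (exchange-ττ (separated W k z<s (≤-trans (s≤s (s≤s z≤n)) 3≤q)) (letter W (m + 0)))

  -- Unordered, hence invariant under both rotation and reflection; all inequivalences of words
  -- below are detected by it.
  Adj : Word → Fin n → Fin n → Set
  Adj W x y = next W x ≡ y ⊎ next W y ≡ x

  Adj-sym : ∀ {W x y} → Adj W x y → Adj W y x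
  Adj-sym (inj₁ p) = inj₂ p
  Adj-sym (inj₂ p) = inj₁ p

  Adj-Dih : ∀ {W W′ x y} → Dih W W′ → Adj W x y → Adj W′ x y
  Adj-Dih (inj₁ (rot r)) (inj₁ p) = inj₁ (trans (sym (r _)) p)
  Adj-Dih (inj₁ (rot r)) (inj₂ p) = inj₂ (trans (sym (r _)) p)
  Adj-Dih {W′ = W′} (inj₂ (anti a)) (inj₁ p) = inj₂ (trans (cong (next W′) (sym p)) (a _))
  Adj-Dih {W′ = W′} (inj₂ (anti a)) (inj₂ p) = inj₁ (trans (cong (next W′) (sym p)) (a _))

  Adj-letters : ∀ W i {x y} → letter W i ≡ x → letter W (suc i) ≡ y → Adj W x y
  Adj-letters W i refl refl = inj₁ (next-letter W i)

  -- The bound `suc e < n` excludes letters that are neighbours across the end of the period.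
  ¬Adj-letters : ∀ W {e} i {x y} → 2 ≤ e → suc e < n →
                 letter W i ≡ x → letter W (e + i) ≡ y → ¬ Adj W x y
  ¬Adj-letters W {suc e} i (s≤s 1≤e) e<n refl refl (inj₁ p) = distinct W (suc i) 1≤e
    (<-trans (n<1+n e) (<-trans (n<1+n (suc e)) e<n))
    (trans (cong (letter W) (+-suc e i)) (trans (sym p) (next-letter W i)))
  ¬Adj-letters W {e} i _ e<n refl refl (inj₂ p) = distinct W i z<s e<n
    (trans (sym (next-letter W (e + i))) p)

  -- The vertices w j and w (j + 2) are neighbours after the exchange but two positions apart before
  -- it.
  swap-¬Dih-self : ∀ W j → ¬ Dih W (swap W j)
  swap-¬Dih-self W j dih = ¬Adj-letters W j ≤-refl 4≤n refl refl
    (Adj-Dih (Dih-sym dih)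
      (Adj-letters (swap W j) (suc j) (swap-suc W j) (swap-far W j ≤-refl 3≤q)))

  -- The vertices w k and w (k + 1) are neighbours in swap W k but not in
  -- swap W (k + 1).
  swap-¬Dih-suc : ∀ W k → ¬ Dih (swap W k) (swap W (suc k))
  swap-¬Dih-suc W k dih = ¬Adj-letters (swap W (suc k)) k ≤-refl 4≤n
    (swap-before W k) (swap-suc W (suc k))
    (Adj-sym {swap W (suc k)}
      (Adj-Dih dih (Adj-letters (swap W k) k (swap-here W k) (swap-suc W k))))

  -- With j = e + 1 + k, the vertices w (j - 1) and w (j + 1) are neighbours in
  -- swap W j; in swap W k they are three positions apart if j = k + 2, and two
  -- otherwise.
  swap-¬Dih-apart : 5 ≤ n → ∀ W k {e} → 1 ≤ e → 2 + e < q → ¬ Dih (swap W k) (swap W (suc e + k))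
  swap-¬Dih-apart 5≤n W k {e} 1≤e e<q dih = go 1≤e e<q
    (Adj-Dih (Dih-sym dih)
      (Adj-letters (swap W (suc e + k)) (e + k) (swap-before W (e + k)) (swap-here W (suc e + k))))
    where
    go : ∀ {e} → 1 ≤ e → 2 + e < q → ¬ Adj (swap W k) (letter W (e + k)) (letter W (2 + e + k))
    -- Distance three is adjacency on a cycle of length 4, so the argument breaks down for the
    -- tetrahedron exactly here.
    go {1} _ e<q = ¬Adj-letters (swap W k) k (s≤s (s≤s z≤n)) 5≤n
      (swap-here W k) (swap-far W k (s≤s (s≤s z≤n)) e<q)
    go {e@(suc (suc _))} _ e<q = ¬Adj-letters (swap W k) (e + k) ≤-refl 4≤n
      (swap-far W k (s≤s (s≤s z≤n)) (<-trans (n<1+n e) (<-trans (n<1+n (suc e)) e<q)))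
      (swap-far W k (s≤s (s≤s z≤n)) e<q)

  swap-¬Dih : 5 ≤ n → ∀ W {k j} → k < j → j < q → ¬ Dih (swap W k) (swap W j)
  swap-¬Dih 5≤n W {k} {j} k<j j<q dih with j ∸ k in eq | m∸n+n≡m (ℕₚ.<⇒≤ k<j)
  ... | zero | refl = ℕₚ.<-irrefl refl k<j
  ... | 1 | refl = swap-¬Dih-suc W k dih
  ... | suc e@(suc _) | refl with ℕₚ.m≤n⇒m<n∨m≡n (≤-trans (s≤s (m≤m+n (suc e) k)) j<q)
  ...   | inj₁ 2+e<q = swap-¬Dih-apart 5≤n W k (s≤s z≤n) 2+e<q dih
  -- Here j + 1 = q + k, where the exchange agrees with the one at k; so k and j are consecutive
  -- around the cycle, in the order j, k.
  ...   | inj₂ 2+e≡q = swap-¬Dih-suc W (suc e + k) (Dih-sym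
    (Dih-trans
      (inj₁ (subst (λ i → Rot (swap W (i + k)) (swap W k)) (sym 2+e≡q) (swap-turn W k))) dih))

  -- For the tetrahedron, with period a b c d, the swaps b a c d and a b d c are
  -- reverse to each other.
  swap-opposite : n ≡ 4 → q ≡ 4 → ∀ W k → Anti (swap W k) (swap W (2 + k))
  swap-opposite n≡4 q≡4 W k = anti λ x →
    subst (λ y → next S′ (next S y) ≡ y) (letter-index (shift S k) x)
      (go (index (shift S k) x) (subst (index (shift S k) x <_) n≡4 (index<n (shift S k) x)))
    where
    S  = swap W k
    S′ = swap W (2 + k)
    open ≡-Reasoning
    <q : ∀ {m} → m < 4 → m < q
    <q = subst (_ <_) (sym q≡4)
    far : ∀ {m} → 2 ≤ m → m < 4 → letter S (m + k) ≡ letter W (m + k)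
    far 2≤m m<4 = swap-far W k 2≤m (<q m<4)
    e₀ : letter S (1 + k) ≡ letter S′ k
    e₀ = trans (swap-suc W k) (sym (exchange-other
      (separated W (2 + k) z<s (<q (s≤s (s≤s z≤n))))
      (#-sym (separated W k z<s (<q (s≤s (s≤s (s≤s z≤n))))))
      (#-sym (separated W k z<s (<q ≤-refl)))))
    e₁ : letter S k ≡ letter S′ (1 + k)
    e₁ = trans (swap-here W k) (sym (swap-before W (suc k)))
    e₂ : letter S (3 + k) ≡ letter S′ (2 + k)
    e₂ = trans (far (s≤s (s≤s z≤n)) ≤-refl) (sym (swap-here W (2 + k)))
    e₃ : letter S (2 + k) ≡ letter S′ (3 + k)
    e₃ = trans (far ≤-refl (s≤s (s≤s (s≤s z≤n)))) (sym (swap-suc W (2 + k)))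
    back : ∀ V → letter V (4 + k) ≡ letter V k
    back V = trans (cong (λ m → letter V (m + k)) (sym n≡4)) (periodic V k)
    step₂ : ∀ i p → letter S (suc i) ≡ letter S′ p → letter S i ≡ letter S′ (suc p) →
            next S′ (next S (letter S i)) ≡ letter S i
    step₂ i p eq eq′ = begin
      next S′ (next S (letter S i)) ≡⟨ cong (next S′) (next-letter S i) ⟩
      next S′ (letter S (suc i))    ≡⟨ cong (next S′) eq ⟩
      next S′ (letter S′ p)         ≡⟨ next-letter S′ p ⟩
      letter S′ (suc p)             ≡⟨ eq′ ⟨
      letter S i                    ∎
    go : ∀ m → m < 4 → next S′ (next S (letter S (m + k))) ≡ letter S (m + k)
    go 0 _ = step₂ k k e₀ e₁
    go 1 _ = step₂ (1 + k) (3 + k) e₃ (trans e₀ (sym (back S′)))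
    go 2 _ = step₂ (2 + k) (2 + k) e₂ e₃
    go 3 _ = step₂ (3 + k) (1 + k) (trans (back S) e₁) e₂
    go (suc (suc (suc (suc _)))) (s≤s (s≤s (s≤s (s≤s ()))))

-- Words from blocks of q letters

module Blocks (C : Complex) where
  open Words C

  private instance
    q-nonZero : NonZero q
    q-nonZero = >-nonZero (≤-trans (s≤s z≤n) 3≤q)

  module _ (v : Fin q → Fin n) (v-# : ∀ {r s} → r ≢ s → v r # v s) where

    private
      τ^ : ℕ → Fin n → Fin n
      τ^ zero    x = x
      τ^ (suc k) x = τ (τ^ k x)

      letterAt : ℕ → Fin n
      letterAt i = τ^ (i / q) (v (fromℕ< (m%n<n i q)))

      v-cong : ∀ {i j} .(p : i < q) .(r : j < q) → i ≡ j → v (fromℕ< p) ≡ v (fromℕ< r)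
      v-cong p r refl = refl

      letterAt-turn : ∀ i → letterAt (q + i) ≡ τ (letterAt i)
      letterAt-turn i = cong₂ τ^
        (trans (m/n≡1+[m∸n]/n (m≤m+n q i)) (cong (λ k → suc (k / q)) (ℕₚ.m+n∸m≡n q i)))
        (v-cong _ _ (trans (cong (_% q) (+-comm q i)) ([m+n]%n≡m%n i q)))

      letterAt-* : ∀ k i → letterAt (k * q + i) ≡ τ^ k (letterAt i)
      letterAt-* zero i = refl
      letterAt-* (suc k) i = trans (cong letterAt (+-assoc q (k * q) i))
        (trans (letterAt-turn _) (cong τ (letterAt-* k i)))

      letterAt-< : ∀ {i} (i<q : i < q) → letterAt i ≡ v (fromℕ< i<q)
      letterAt-< i<q = cong₂ τ^ (m<n⇒m/n≡0 i<q) (v-cong _ _ (m<n⇒m%n≡m i<q))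

      v-#< : ∀ {i j} (i<q : i < q) (j<q : j < q) → i ≢ j → v (fromℕ< i<q) # v (fromℕ< j<q)
      v-#< i<q j<q i≢j = v-# (i≢j ∘ Finₚ.fromℕ<-injective _ _ i<q j<q)

      τ^-# : ∀ k {x y} → x # y → τ^ k x # τ^ k y
      τ^-# zero p = p
      τ^-# (suc k) p = τ-# (τ^-# k p)

      -- If e + r overruns the block, the letter there is τ of the block letter at s = e + r - q.
      -- Since s < r, block letters s and r are distinct positions, and `#` does not notice τ.
      separated-< : ∀ {e r} → r < q → 0 < e → e < q → letterAt r # letterAt (e + r)
      separated-< {e} {r} r<q 0<e e<q with e + r ℕₚ.<? q
      ... | yes e+r<q = subst₂ _#_ (sym (letterAt-< r<q)) (sym (letterAt-< e+r<q))
        (v-#< r<q e+r<q (λ eq → ℕₚ.<-irrefl eq (ℕₚ.+-monoˡ-< r 0<e)))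
      ... | no ≮ = subst₂ _#_ (sym (letterAt-< r<q))
        (trans (cong τ (sym (letterAt-< s<q))) (trans (sym (letterAt-turn s)) (cong letterAt q+s)))
        (#-τ (v-#< r<q s<q (λ eq → ℕₚ.<-irrefl (sym eq) s<r)))
        where
        s = e + r ∸ q
        q+s : q + s ≡ e + r
        q+s = m+[n∸m]≡n (ℕₚ.≮⇒≥ ≮)
        s<r : s < r
        s<r = ℕₚ.+-cancelˡ-< q s r (subst (_< q + r) (sym q+s) (ℕₚ.+-monoˡ-< r e<q))
        s<q : s < q
        s<q = <-trans s<r r<q

    blockWord : Word
    blockWord = record
      { letter    = letterAt
      ; separated = λ {e} i 0<e e<q → subst₂ _#_
          (trans (sym (letterAt-* (i / q) (i % q))) (cong letterAt (sym (split i))))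
          (trans (sym (letterAt-* (i / q) (e + i % q))) (cong letterAt (sym (split-+ e i))))
          (τ^-# (i / q) (separated-< (m%n<n i q) 0<e e<q))
      ; turn      = letterAt-turn
      }
      where
      split : ∀ i → i ≡ i / q * q + i % q
      split i = trans (m≡m%n+[m/n]*n i q) (+-comm (i % q) _)
      split-+ : ∀ e i → e + i ≡ i / q * q + (e + i % q)
      split-+ e i = begin
        e + i                     ≡⟨ cong (e +_) (split i) ⟩
        e + (i / q * q + i % q)   ≡⟨ +-assoc e _ _ ⟨
        e + i / q * q + i % q     ≡⟨ cong (_+ i % q) (+-comm e _) ⟩
        i / q * q + e + i % q     ≡⟨ +-assoc (i / q * q) e _ ⟩
        i / q * q + (e + i % q)   ∎
        where open ≡-Reasoning

    blockWord-letter : ∀ r → letter blockWord (toℕ r) ≡ v r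
    blockWord-letter r = trans (letterAt-< (toℕ<n r)) (cong v (Finₚ.fromℕ<-toℕ r (toℕ<n r)))

  letters-# : ∀ W {r s : Fin q} → r ≢ s → letter W (toℕ r) # letter W (toℕ s)
  letters-# W r≢s = separated-≢ {letter W} (separated W) (toℕ<n _) (toℕ<n _) (r≢s ∘ toℕ-injective)

  ≗-block : ∀ {W W′} → (∀ (r : Fin q) → letter W (toℕ r) ≡ letter W′ (toℕ r)) →
            ∀ m → letter W m ≡ letter W′ m
  ≗-block {W} {W′} eq = block-determines W W′ λ m<q →
    subst (λ m → letter W m ≡ letter W′ m) (toℕ-fromℕ< m<q) (eq (fromℕ< m<q))

-- Every word is rotated so that a comes first; since reversal then maps position
-- i to n - i, exactly one of the word and its reverse has b before c.
module Canonical (C : Complex) {a b c : Fin (Complex.n C)} (a≢b : a ≢ b) (a≢c : a ≢ c) (b≢c : b ≢ c) where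
  open Words C

  Canon : Word → Set
  Canon W = letter W 0 ≡ a × index W b < index W c

  index>0 : ∀ W {y} → letter W 0 ≢ y → 0 < index W y
  index>0 W {y} ≢y with index W y in eq
  ... | zero = contradiction (trans (cong (letter W) (sym eq)) (letter-index W y)) ≢y
  ... | suc _ = z<s

  Anti-index : ∀ {W W′} → Anti W W′ → letter W 0 ≡ letter W′ 0 → ∀ {y} → letter W 0 ≢ y →
               index W y + index W′ y ≡ n
  Anti-index {W} {W′} flips eq {y} ≢y = trans (cong (index W y +_) pos) (m+[n∸m]≡n (ℕₚ.<⇒≤ (index<n W y)))
    where
    m = n ∸ index W y
    at : y ≡ letter W′ m
    at = begin
      y                       ≡⟨ letter-index W y ⟨
      letter W (index W y)    ≡⟨ Anti-align flips (trans (cong (letter W) (sym (ℕₚ.+-identityʳ n))) (trans (periodic W 0) eq)) m _ (m∸n+n≡m (ℕₚ.<⇒≤ (index<n W y))) ⟩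
      letter W′ (m + 0)       ≡⟨ cong (letter W′) (ℕₚ.+-identityʳ m) ⟩
      letter W′ m             ∎
      where open ≡-Reasoning
    m<n : m < n
    m<n = ℕₚ.∸-monoʳ-< (index>0 W ≢y) (ℕₚ.<⇒≤ (index<n W y))
    pos : index W′ y ≡ m
    pos = trans (cong (index W′) at) (index-letter W′ m<n)

  Anti-flips : ∀ {W W′} → Anti W W′ → letter W 0 ≡ a → letter W′ 0 ≡ a →
               index W b < index W c → index W′ c < index W′ b
  Anti-flips {W} {W′} flips 0≡a 0≡a′ b<c = ℕₚ.+-cancelˡ-< (index W c) _ _
    (subst (_< index W c + index W′ b)
      (trans (sum b a≢b) (sym (sum c a≢c)))
      (ℕₚ.+-monoˡ-< (index W′ b) b<c))
    where
    sum : ∀ y → a ≢ y → index W y + index W′ y ≡ n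
    sum y a≢y = Anti-index flips (trans 0≡a (sym 0≡a′)) (λ eq → a≢y (trans (sym 0≡a) eq))

  canonical-unique : ∀ {W W′} → Canon W → Canon W′ → Dih W W′ → ∀ m → letter W m ≡ letter W′ m
  canonical-unique {W} {W′} (p , _) (p′ , _) (inj₁ turns) m = subst (λ k → letter W k ≡ letter W′ k)
    (ℕₚ.+-identityʳ m) (Rot-align turns (trans p (sym p′)) m)
  canonical-unique {W} {W′} (p , b<c) (p′ , b<c′) (inj₂ flips) =
    contradiction (Anti-flips flips p p′ b<c) (ℕₚ.<-asym b<c′)

  canonical-exists : ∀ W → ∃ λ W′ → Canon W′ × Dih W W′
  canonical-exists W with ℕₚ.<-cmp (index W₁ b) (index W₁ c)
    where W₁ = shift W (index W a)
  ... | tri< b<c _ _ = shift W (index W a) , (letter-index W a , b<c) , inj₁ (Rot-shift W (index W a))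
  ... | tri≈ _ eq _ = contradiction
    (trans (sym (letter-index W₁ b)) (trans (cong (letter W₁) eq) (letter-index W₁ c))) b≢c
    where W₁ = shift W (index W a)
  ... | tri> _ _ c<b = rev W₁ , (letter-index W a , flipped) ,
    inj₂ (Rot-Anti (Rot-shift W (index W a)) (Anti-rev W₁))
    where
    W₁ = shift W (index W a)
    sum : ∀ y → a ≢ y → index W₁ y + index (rev W₁) y ≡ n
    sum y a≢y = Anti-index (Anti-rev W₁) refl (λ eq → a≢y (trans (sym (letter-index W a)) eq))
    flipped : index (rev W₁) b < index (rev W₁) c
    flipped = ℕₚ.+-cancelˡ-< (index W₁ b) _ _
      (subst (_< index W₁ b + index (rev W₁) c) (trans (sum c a≢c) (sym (sum b a≢b)))
        (ℕₚ.+-monoˡ-< (index (rev W₁) c) c<b))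

-- Affine geometry

Σℤ-cong : ∀ {k} {f g : Vector ℤ k} → (∀ i → f i ≡ g i) → Σℤ f ≡ Σℤ g
Σℤ-cong {zero} eq = refl
Σℤ-cong {suc k} eq = cong₂ ℤ._+_ (eq zero) (Σℤ-cong (eq ∘ suc))

Σℤ-zero : ∀ {k} {f : Vector ℤ k} → (∀ i → f i ≡ 0ℤ) → Σℤ f ≡ 0ℤ
Σℤ-zero {zero} eq = refl
Σℤ-zero {suc k} eq = cong₂ ℤ._+_ (eq zero) (Σℤ-zero (eq ∘ suc))

Σℤ-single : ∀ {k} {f : Vector ℤ k} i → (∀ j → j ≢ i → f j ≡ 0ℤ) → Σℤ f ≡ f i
Σℤ-single {f = f} zero eq = trans (cong (ℤ._+_ (f zero)) (Σℤ-zero (λ j → eq (suc j) λ ())))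
  (ℤₚ.+-identityʳ _)
Σℤ-single {f = f} (suc i) eq = trans (cong₂ ℤ._+_ (eq zero λ ())
  (Σℤ-single {f = f ∘ suc} i (λ j j≢i → eq (suc j) (j≢i ∘ Finₚ.suc-injective)))) (ℤₚ.+-identityˡ _)

basis-same : ∀ {m} (i : Fin m) → basis i i ≡ 1ℤ
basis-same i with i ≟ i
... | yes _ = refl
... | no ≢ = contradiction refl ≢

basis-other : ∀ {m} {i j : Fin m} → i ≢ j → basis i j ≡ 0ℤ
basis-other {i = i} {j} i≢j with i ≟ j
... | yes i≡j = contradiction i≡j i≢j
... | no _ = refl

·-basis : ∀ {k} (c : Vector ℤ k) v → c · basis v ≡ c v
·-basis c v = trans (Σℤ-single v (λ j j≢v → trans (cong (c j ℤ.*_) (basis-other (j≢v ∘ sym))) (ℤₚ.*-zeroʳ (c j))))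
  (trans (cong (c v ℤ.*_) (basis-same v)) (ℤₚ.*-identityʳ (c v)))

-- The dependence is e_i - e_j: its coefficients add up to 0, and it combines the points to p i - p
-- j = 0.
repetition⇒dependent : ∀ {k m} {p : Fin k → Vector ℤ m} {i j} → i ≢ j → p i ≡ p j →
                       ¬ AffinelyIndependent p
repetition⇒dependent {k} {p = p} {i} {j} i≢j pᵢ≡pⱼ indep =
  contradiction (trans (sym aᵢ≡1) (indep a Σa≡0 Σap≡0 i)) λ ()
  where
  open ≡-Reasoning
  a : Vector ℤ k
  a l = basis i l ℤ.+ ℤ.- basis j l
  aᵢ≡1 : a i ≡ 1ℤ
  aᵢ≡1 = cong₂ (λ x y → x ℤ.+ ℤ.- y) (basis-same i) (basis-other (i≢j ∘ sym))
  Σaf : ∀ (f : Vector ℤ k) → Σℤ (λ l → a l ℤ.* f l) ≡ f i ℤ.- f j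
  Σaf f = begin
    Σℤ (λ l → a l ℤ.* f l)
      ≡⟨ Σℤ-cong (λ l → ℤₚ.*-distribʳ-+ (f l) (basis i l) (ℤ.- basis j l)) ⟩
    Σℤ (λ l → basis i l ℤ.* f l ℤ.+ ℤ.- basis j l ℤ.* f l)
      ≡⟨ ∑-distrib-+ +-0-commutativeMonoid (λ l → basis i l ℤ.* f l) (λ l → ℤ.- basis j l ℤ.* f l) ⟩
    Σℤ (λ l → basis i l ℤ.* f l) ℤ.+ Σℤ (λ l → ℤ.- basis j l ℤ.* f l)
      ≡⟨ cong₂ ℤ._+_
           (Σℤ-single i (λ l l≢i → cong (ℤ._* f l) (basis-other (l≢i ∘ sym))))
           (Σℤ-single j (λ l l≢j → cong (λ b → ℤ.- b ℤ.* f l) (basis-other (l≢j ∘ sym)))) ⟩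
    basis i i ℤ.* f i ℤ.+ ℤ.- basis j j ℤ.* f j
      ≡⟨ cong₂ (λ b c → b ℤ.* f i ℤ.+ ℤ.- c ℤ.* f j) (basis-same i) (basis-same j) ⟩
    1ℤ ℤ.* f i ℤ.+ ℤ.-1ℤ ℤ.* f j
      ≡⟨ cong₂ ℤ._+_ (ℤₚ.*-identityˡ (f i)) (ℤₚ.-1*i≡-i (f j)) ⟩
    f i ℤ.- f j ∎
  Σa≡0 : Σℤ a ≡ 0ℤ
  Σa≡0 = trans (Σℤ-cong (λ l → sym (ℤₚ.*-identityʳ (a l)))) (Σaf (λ _ → 1ℤ))
  Σap≡0 : ∀ t → Σℤ (λ l → a l ℤ.* p l t) ≡ 0ℤ
  Σap≡0 t = trans (Σaf (λ l → p l t)) (trans (cong (λ v → v t ℤ.- p j t) pᵢ≡pⱼ) (ℤₚ.+-inverseʳ (p j t)))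

-- A proper superset of A that is a proper subset of A ∪ {x , y} is A ∪ {x} or
-- A ∪ {y}.
diamond : ∀ {n} {A S B C Top : Subset n} {x y} →
          A ⊆ S → (∃ λ z → z ∈ S × z ∉ A) → S ⊂ Top →
          (∀ {z} → z ∈ Top → z ∈ A ⊎ z ≡ x ⊎ z ≡ y) →
          (∀ {z} → z ∈ B → z ∈ A ⊎ z ≡ x) → A ⊆ B → x ∈ B →
          (∀ {z} → z ∈ C → z ∈ A ⊎ z ≡ y) → A ⊆ C → y ∈ C →
          S ≢ B → S ≡ C
diamond {A = A} {S} {B} {C} {Top} {x} {y} A⊆S (z , z∈S , z∉A) (S⊆Top , u , u∈Top , u∉S)
        top⁻ b⁻ A⊆B x∈B c⁻ A⊆C y∈C S≢B with y ∈? S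
... | no y∉S = contradiction (⊆-antisym S⊆B B⊆S) S≢B
  where
  S⁻ : ∀ {z} → z ∈ S → z ∈ A ⊎ z ≡ x
  S⁻ z∈S with top⁻ (S⊆Top z∈S)
  ... | inj₁ z∈A = inj₁ z∈A
  ... | inj₂ (inj₁ z≡x) = inj₂ z≡x
  ... | inj₂ (inj₂ z≡y) = contradiction (subst (_∈ S) z≡y z∈S) y∉S
  S⊆B : S ⊆ B
  S⊆B z∈S = [ A⊆B , (λ z≡x → subst (_∈ B) (sym z≡x) x∈B) ]′ (S⁻ z∈S)
  x∈S : x ∈ S
  x∈S = [ (λ z∈A → contradiction z∈A z∉A) , (λ z≡x → subst (_∈ S) z≡x z∈S) ]′ (S⁻ z∈S)
  B⊆S : B ⊆ S
  B⊆S z∈B = [ A⊆S , (λ z≡x → subst (_∈ S) (sym z≡x) x∈S) ]′ (b⁻ z∈B)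
... | yes y∈S = ⊆-antisym S⊆C (λ z∈C → [ A⊆S , (λ z≡y → subst (_∈ S) (sym z≡y) y∈S) ]′ (c⁻ z∈C))
  where
  x∉S : x ∉ S
  x∉S x∈S = u∉S ([ A⊆S , [ (λ e → subst (_∈ S) (sym e) x∈S) , (λ e → subst (_∈ S) (sym e) y∈S) ]′ ]′ (top⁻ u∈Top))
  S⊆C : S ⊆ C
  S⊆C z∈S with top⁻ (S⊆Top z∈S)
  ... | inj₁ z∈A = A⊆C z∈A
  ... | inj₂ (inj₁ z≡x) = contradiction (subst (_∈ S) z≡x z∈S) x∉S
  ... | inj₂ (inj₂ z≡y) = subst (_∈ C) (sym z≡y) y∈C

-- Zigzags and words

-- Supporting hyperplanes enter only here: the proper nonempty faces are the proper nonempty sets of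
-- vertices pairwise related by `#`. What follows uses these sets and their sizes.
record Realisation (C : Complex) : Set where
  open Complex C
  field
    {dimension}   : ℕ
    V             : Fin n → Vector ℤ dimension
    face-#        : ∀ {S} → IsFace V d S → ∀ {x y} → x ∈ S → y ∈ S → x ≢ y → x # y
    face-size     : ∀ {S} → IsFace V d S → ∣ S ∣ ≤ d
    #-isFace      : ∀ {S} → Nonempty S → (∃ λ v → v ∉ S) →
                    (∀ {x y} → x ∈ S → y ∈ S → x ≢ y → x # y) → IsFace V d S
    #-independent : ∀ {k} {w : Fin k → Fin n} → (∀ {i j} → i ≢ j → w i # w j) →
                    AffinelyIndependent (V ∘ w)

module Windows {n : ℕ} where

  -- The window has i + 1 letters, so that i is its dimension and its index in a flag.
  win : (ℕ → Fin n) → ℕ → ℕ → Subset n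
  win w j zero    = ⁅ w j ⁆
  win w j (suc i) = ⁅ w j ⁆ ∪ win w (suc j) i

  ∈-win⁺ : ∀ w j {m i} → m ≤ i → w (m + j) ∈ win w j i
  ∈-win⁺ w j {zero} {zero} _ = x∈⁅x⁆ _
  ∈-win⁺ w j {zero} {suc i} _ = x∈p∪q⁺ (inj₁ (x∈⁅x⁆ _))
  ∈-win⁺ w j {suc m} {suc i} (s≤s m≤i) = x∈p∪q⁺ (inj₂
    (subst (λ k → w k ∈ win w (suc j) i) (+-suc m j) (∈-win⁺ w (suc j) m≤i)))

  ∈-win⁻ : ∀ w j i {x} → x ∈ win w j i → ∃ λ m → m ≤ i × x ≡ w (m + j)
  ∈-win⁻ w j zero x∈ = 0 , z≤n , x∈⁅y⁆⇒x≡y _ x∈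
  ∈-win⁻ w j (suc i) x∈ with x∈p∪q⁻ ⁅ w j ⁆ _ x∈
  ... | inj₁ x∈₁ = 0 , z≤n , x∈⁅y⁆⇒x≡y _ x∈₁
  ... | inj₂ x∈₂ with m , m≤i , eq ← ∈-win⁻ w (suc j) i x∈₂ =
    suc m , s≤s m≤i , trans eq (cong w (+-suc m j))

  win-cong : ∀ {w w′ j k} i → (∀ {m} → m ≤ i → w (m + j) ≡ w′ (m + k)) → win w j i ≡ win w′ k i
  win-cong zero eq = cong ⁅_⁆ (eq z≤n)
  win-cong {w} {w′} {j} {k} (suc i) eq = cong₂ (λ x S → ⁅ x ⁆ ∪ S) (eq z≤n)
    (win-cong i λ {m} m≤i → trans (cong w (+-suc m j)) (trans (eq (s≤s m≤i)) (cong w′ (sym (+-suc m k)))))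

  ⁅⁆-injective : {x y : Fin n} → ⁅ x ⁆ ≡ ⁅ y ⁆ → x ≡ y
  ⁅⁆-injective {x} {y} eq = x∈⁅y⁆⇒x≡y y (subst (x ∈_) eq (x∈⁅x⁆ x))

module Zigzags {C : Complex} (R : Realisation C) where
  open Words C
  open Swaps C
  open Windows
  open Realisation R public

  private
    0<d : 0 < d
    0<d = ≤-trans (s≤s z≤n) 3≤d
    Flagᴾ = Flag V d
    Zigzagᴾ = Zigzag V d

  offset-injective : ∀ W j {m m′} → m < n → m′ < n → letter W (m + j) ≡ letter W (m′ + j) → m ≡ m′
  offset-injective W j = letter-injective (shift W j)

  win-⊂ : ∀ W j {i i′} → i < i′ → i′ < n → win (letter W) j i ⊂ win (letter W) j i′
  win-⊂ W j {i} {i′} i<i′ i′<n = sub , _ , ∈-win⁺ (letter W) j ≤-refl , new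
    where
    sub : win (letter W) j i ⊆ win (letter W) j i′
    sub x∈ with m , m≤i , refl ← ∈-win⁻ (letter W) j i x∈ =
      ∈-win⁺ (letter W) j (≤-trans m≤i (ℕₚ.<⇒≤ i<i′))
    new : letter W (i′ + j) ∉ win (letter W) j i
    new x∈ with m , m≤i , eq ← ∈-win⁻ (letter W) j i x∈ = ℕₚ.<-irrefl
      (offset-injective W j (≤-<-trans m≤i (<-trans i<i′ i′<n)) i′<n (sym eq)) (≤-<-trans m≤i i<i′)

  first∉win-suc : ∀ W j {i} → suc i < n → letter W j ∉ win (letter W) (suc j) i
  first∉win-suc W j {i} i<n x∈ with m , m≤i , eq ← ∈-win⁻ (letter W) (suc j) i x∈ =
    contradiction (offset-injective W j {0} {suc m} (≤-trans (s≤s z≤n) 4≤n) (≤-<-trans (s≤s m≤i) i<n)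
      (trans eq (cong (letter W) (+-suc m j)))) λ ()

  -- This inclusion makes the intermediate flags of `T` chains: the smaller faces have already moved
  -- on by one letter, the larger ones not yet.
  win-suc-⊂ : ∀ W j {i i′} → i < i′ → i′ < n → win (letter W) (suc j) i ⊂ win (letter W) j i′
  win-suc-⊂ W j {i} {i′} i<i′ i′<n = sub , _ , ∈-win⁺ (letter W) j {0} {i′} z≤n , first∉win-suc W j (≤-<-trans i<i′ i′<n)
    where
    sub : win (letter W) (suc j) i ⊆ win (letter W) j i′
    sub x∈ with m , m≤i , refl ← ∈-win⁻ (letter W) (suc j) i x∈ =
      subst (λ k → letter W k ∈ win (letter W) j i′) (sym (+-suc m j))
        (∈-win⁺ (letter W) j (≤-<-trans m≤i i<i′))

  win-isFace : ∀ W j {i} → i < d → IsFace V d (win (letter W) j i)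
  win-isFace W j {i} i<d = #-isFace
    (_ , ∈-win⁺ (letter W) j {0} {i} z≤n)
    (letter W (suc i + j) , λ x∈ → let (m , m≤i , eq) = ∈-win⁻ (letter W) j i x∈ in
      ℕₚ.<-irrefl (sym (offset-injective W j (≤-<-trans i<d d<n) (≤-<-trans m≤i (<-trans i<d d<n)) eq)) (s≤s m≤i))
    λ x∈ y∈ → compatible (∈-win⁻ (letter W) j i x∈) (∈-win⁻ (letter W) j i y∈)
    where
    <q : ∀ {m} → m ≤ i → m < q
    <q m≤i = ≤-<-trans m≤i (<-≤-trans i<d d≤q)
    compatible : ∀ {x y} → (∃ λ m → m ≤ i × x ≡ letter W (m + j)) → (∃ λ m → m ≤ i × y ≡ letter W (m + j)) →
                 x ≢ y → x # y
    compatible (m , m≤i , refl) (m′ , m′≤i , refl) x≢y =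
      separated-≢ {letter (shift W j)} (separated (shift W j)) (<q m≤i) (<q m′≤i)
        (x≢y ∘ cong (λ k → letter W (k + j)))

  -- The i + 1 letters are independent because they are pairwise `#`; any i + 2 vertices of the
  -- window contain a repetition by the pigeonhole principle.
  win-hasDim : ∀ W j {i} → i < d → HasDim V d (win (letter W) j i) i
  win-hasDim W j {i} i<d =
    ((λ r → letter W (toℕ r + j)) ,
     (λ r → ∈-win⁺ (letter W) j (s≤s⁻¹ (toℕ<n r))) ,
     #-independent (λ r≢s → separated-≢ {letter (shift W j)} (separated (shift W j)) (<q _) (<q _) (r≢s ∘ toℕ-injective))) ,
    dependent
    where
    <q : ∀ (r : Fin (suc i)) → toℕ r < q
    <q r = <-≤-trans (toℕ<n r) (≤-trans i<d d≤q)
    dependent : (w : Fin (suc (suc i)) → Fin n) → (∀ r → w r ∈ win (letter W) j i) →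
                ¬ AffinelyIndependent (V ∘ w)
    dependent w w∈ with r , s , r<s , eq ← Finₚ.pigeonhole {suc i} {suc (suc i)} ≤-refl
                          (λ r → fromℕ< (s≤s (proj₁ (proj₂ (∈-win⁻ (letter W) j i (w∈ r)))))) =
      repetition⇒dependent {p = V ∘ w} (λ r≡s → ℕₚ.<-irrefl (cong toℕ r≡s) r<s)
        (cong V (trans (proj₂ (proj₂ (at r))) (trans (cong (λ m → letter W (m + j))
          (Finₚ.fromℕ<-injective _ _ (s≤s (proj₁ (proj₂ (at r)))) (s≤s (proj₁ (proj₂ (at s)))) eq)) (sym (proj₂ (proj₂ (at s)))))))
      where
      at : ∀ r → ∃ λ m → m ≤ i × w r ≡ letter W (m + j)
      at r = ∈-win⁻ (letter W) j i (w∈ r)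

  -- The faces of the flag reached from window j after σ₁, …, σ_k.
  mixed : Word → ℕ → ℕ → ℕ → Subset n
  mixed W j k i = if i <ᵇ k then win (letter W) (suc j) i else win (letter W) j i

  mixed-< : ∀ W j {k i} → i < k → mixed W j k i ≡ win (letter W) (suc j) i
  mixed-< W j {k} {i} i<k with i <ᵇ k | ℕₚ.<⇒<ᵇ i<k
  ... | true | _ = refl

  mixed-≥ : ∀ W j {k i} → k ≤ i → mixed W j k i ≡ win (letter W) j i
  mixed-≥ W j {k} {i} k≤i with i <ᵇ k in eq
  ... | false = refl
  ... | true = contradiction (ℕₚ.<ᵇ⇒< i k (subst Bool.T (sym eq) _)) (ℕₚ.≤⇒≯ k≤i)

  mixed-view : ∀ W j k i → mixed W j k i ≡ win (letter W) (suc j) i ⊎ mixed W j k i ≡ win (letter W) j i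
  mixed-view W j k i with i <ᵇ k
  ... | true = inj₁ refl
  ... | false = inj₂ refl

  wordFlag : Word → ℕ → ℕ → Flagᴾ
  wordFlag W j k = record
    { face   = λ i → mixed W j k (toℕ i)
    ; isFace = λ i → [ (λ e → subst (IsFace V d) (sym e) (win-isFace W (suc j) (toℕ<n i)))
                     , (λ e → subst (IsFace V d) (sym e) (win-isFace W j (toℕ<n i))) ]′ (mixed-view W j k (toℕ i))
    ; hasDim = λ i → [ (λ e → subst (λ S → HasDim V d S (toℕ i)) (sym e) (win-hasDim W (suc j) (toℕ<n i)))
                     , (λ e → subst (λ S → HasDim V d S (toℕ i)) (sym e) (win-hasDim W j (toℕ<n i))) ]′ (mixed-view W j k (toℕ i))
    ; chain  = λ {i} {i′} i<i′ → ordered i<i′ (<-trans (toℕ<n i′) d<n)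
    }
    where
    ordered : ∀ {i i′} → i < i′ → i′ < n → mixed W j k i ⊂ mixed W j k i′
    ordered {i} {i′} i<i′ i′<n with ℕₚ.<-≤-connex i k | ℕₚ.<-≤-connex i′ k
    ... | inj₁ i<k | inj₁ i′<k = subst₂ _⊂_ (sym (mixed-< W j i<k)) (sym (mixed-< W j i′<k)) (win-⊂ W (suc j) i<i′ i′<n)
    ... | inj₁ i<k | inj₂ k≤i′ = subst₂ _⊂_ (sym (mixed-< W j i<k)) (sym (mixed-≥ W j k≤i′)) (win-suc-⊂ W j i<i′ i′<n)
    ... | inj₂ k≤i | inj₁ i′<k = contradiction (<-trans (≤-<-trans k≤i i<i′) i′<k) (ℕₚ.<-irrefl refl)
    ... | inj₂ k≤i | inj₂ k≤i′ = subst₂ _⊂_ (sym (mixed-≥ W j k≤i)) (sym (mixed-≥ W j k≤i′)) (win-⊂ W j i<i′ i′<n)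

  win-moves : ∀ W j {i} → i < d → win (letter W) (suc j) i ≢ win (letter W) j i
  win-moves W j {i} i<d eq = first∉win-suc W j (≤-<-trans i<d d<n)
    (subst (letter W j ∈_) (sym eq) (∈-win⁺ (letter W) j {0} {i} z≤n))

  wordStep : ∀ W j → T V d (wordFlag W j 0) (wordFlag W (suc j) 0)
  wordStep W j = (wordFlag W j ∘ toℕ) , (λ _ → refl) , moves ,
    λ i → mixed-< W j (subst (toℕ i <_) (sym (toℕ-fromℕ d)) (toℕ<n i))
    where
    moves : ∀ i → σ V d i (wordFlag W j (toℕ (inject₁ i))) (wordFlag W j (suc (toℕ i)))
    moves i = subst (λ k → σ V d i (wordFlag W j k) (wordFlag W j (suc (toℕ i)))) (sym (toℕ-inject₁ i))
      ((λ eq → win-moves W j (toℕ<n i) (trans (sym (mixed-< W j {suc (toℕ i)} ≤-refl)) (trans eq (mixed-≥ W j {toℕ i} ≤-refl)))) , others)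
      where
      others : ∀ i′ → i′ ≢ i → mixed W j (suc (toℕ i)) (toℕ i′) ≡ mixed W j (toℕ i) (toℕ i′)
      others i′ i′≢i with ℕₚ.<-cmp (toℕ i′) (toℕ i)
      ... | tri< lt _ _ = trans (mixed-< W j (<-trans lt ≤-refl)) (sym (mixed-< W j lt))
      ... | tri≈ _ eq _ = contradiction (toℕ-injective eq) i′≢i
      ... | tri> _ _ gt = trans (mixed-≥ W j gt) (sym (mixed-≥ W j (ℕₚ.<⇒≤ gt)))

  firstFace : Fin d
  firstFace = fromℕ< 0<d

  firstFace-face : ∀ (f : Flagᴾ) w j → (∀ i → face f i ≡ win w j (toℕ i)) → face f firstFace ≡ ⁅ w j ⁆
  firstFace-face f w j eq = trans (eq firstFace) (cong (win w j) (toℕ-fromℕ< 0<d))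

  zigzag : Word → Zigzagᴾ
  zigzag W = record
    { len      = n
    ; 0<len    = ≤-trans (s≤s z≤n) 4≤n
    ; flag     = λ j → wordFlag W j 0
    ; periodic = λ j i → win-cong {w = letter W} {letter W} {j + n} {j} (toℕ i) λ {m} _ → begin
        letter W (m + (j + n))  ≡⟨ cong (letter W) (sym (+-assoc m j n)) ⟩
        letter W (m + j + n)    ≡⟨ cong (letter W) (+-comm (m + j) n) ⟩
        letter W (n + (m + j))  ≡⟨ periodic W (m + j) ⟩
        letter W (m + j)        ∎
    ; step     = wordStep W
    ; distinct = λ {i} {j} i<n j<n eq → letter-injective W i<n j<n (⁅⁆-injective
        (trans (sym (firstFace-face (wordFlag W i 0) (letter W) i (λ _ → refl)))
          (trans (eq firstFace) (firstFace-face (wordFlag W j 0) (letter W) j (λ _ → refl)))))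
    }
    where open ≡-Reasoning

-- From zigzags to words

module Reading {C : Complex} (R : Realisation C) where
  open Words C
  open Windows
  open Zigzags R

  private
    0<d : 0 < d
    0<d = ≤-trans (s≤s z≤n) 3≤d

  pred-Fin : ∀ (i : Fin d) {k} → toℕ i ≡ suc k → ∃ λ (i′ : Fin d) → toℕ i′ ≡ k
  pred-Fin i {k} eq = fromℕ< k<d , toℕ-fromℕ< k<d
    where
    k<d : k < d
    k<d = <-trans (n<1+n k) (subst (_< d) eq (toℕ<n i))

  module _ (f : Flag V d) where

    face-≥ : ∀ k i → toℕ i ≡ k → suc k ≤ ∣ face f i ∣
    face-≥ zero i eq = ≤-trans (ℕₚ.≤-reflexive (sym (∣⁅x⁆∣≡1 (proj₁ v)))) (Subsetₚ.p⊆q⇒∣p∣≤∣q∣ λ z∈ →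
        subst (_∈ face f i) (sym (x∈⁅y⁆⇒x≡y _ z∈)) (proj₂ v))
      where v = IsFace.nonempty (isFace f i)
    face-≥ (suc k) i eq with i′ , eq′ ← pred-Fin i eq =
      ≤-<-trans (face-≥ k i′ eq′) (p⊂q⇒∣p∣<∣q∣ (chain f (subst₂ _<_ (sym eq′) (sym eq) ≤-refl)))

    face-+-≤ : ∀ m i → m + suc (toℕ i) ≡ d → ∣ face f i ∣ + m ≤ d
    face-+-≤ zero i eq = subst (_≤ d) (sym (ℕₚ.+-identityʳ _)) (face-size (isFace f i))
    face-+-≤ (suc m) i eq = ≤-trans
      (subst (_≤ ∣ face f i′ ∣ + m) (sym (+-suc _ m))
        (ℕₚ.+-monoˡ-≤ m (p⊂q⇒∣p∣<∣q∣ (chain f (ℕₚ.≤-reflexive (sym i′≡))))))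
      (face-+-≤ m i′ (trans (cong (λ k → m + suc k) i′≡) (trans (+-suc m _) eq)))
      where
      1+i<d : suc (toℕ i) < d
      1+i<d = subst (suc (toℕ i) <_) eq (s≤s (m≤n+m _ m))
      i′ = fromℕ< 1+i<d
      i′≡ : toℕ i′ ≡ suc (toℕ i)
      i′≡ = toℕ-fromℕ< 1+i<d

    -- The chain grows strictly. Climbing from the bottom gives at least i + 1 vertices, descending
    -- from the facet, which has at most d, gives at most i + 1.
    ∣face∣ : ∀ i → ∣ face f i ∣ ≡ suc (toℕ i)
    ∣face∣ i = ℕₚ.≤-antisym
      (ℕₚ.+-cancelʳ-≤ m _ _ (subst (∣ face f i ∣ + m ≤_) (trans (sym m+) (+-comm m _)) (face-+-≤ m i m+)))
      (face-≥ (toℕ i) i refl)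
      where
      m = d ∸ suc (toℕ i)
      m+ : m + suc (toℕ i) ≡ d
      m+ = m∸n+n≡m (toℕ<n i)

    firstVertex : ∃ λ v → face f firstFace ≡ ⁅ v ⁆
    firstVertex = singleton (trans (∣face∣ firstFace) (cong suc (toℕ-fromℕ< 0<d)))

  same-size : ∀ (f g : Flag V d) i → face f i ⊆ face g i → face f i ≡ face g i
  same-size f g i sub = ⊆∧≥⇒≡ sub (ℕₚ.≤-reflexive (trans (∣face∣ g i) (sym (∣face∣ f i))))

  module _ {f g : Flag V d} (t : T V d f g) where

    private
      h = proj₁ t
      h-first = proj₁ (proj₂ t)
      h-σ = proj₁ (proj₂ (proj₂ t))
      h-last = proj₂ (proj₂ (proj₂ t))

      old : ∀ k i → toℕ k ≤ toℕ i → face (h k) i ≡ face f i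
      old = <-weakInduction _ (λ i _ → h-first i)
        λ k IH i k<i → trans (proj₂ (h-σ k) i (λ i≡k → ℕₚ.<-irrefl (cong toℕ (sym i≡k)) k<i))
          (IH i (subst (_≤ toℕ i) (sym (toℕ-inject₁ k)) (ℕₚ.<⇒≤ k<i)))

      new : ∀ k i → toℕ i < toℕ k → face (h k) i ≡ face g i
      new = >-weakInduction _ (λ i _ → h-last i)
        λ k IH i i<k → let i<k′ = subst (toℕ i <_) (toℕ-inject₁ k) i<k in
          trans (sym (proj₂ (h-σ k) i (λ i≡k → ℕₚ.<-irrefl (cong toℕ i≡k) i<k′))) (IH i (<-trans i<k′ ≤-refl))

    -- In T f = g only the face i changes at step i, so that G_i ≠ F_i, and right
    -- after this step G_i and F_(i+1) belong to a common flag.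
    T-moves : ∀ i → face g i ≢ face f i
    T-moves i eq = proj₁ (h-σ i) (trans (new (suc i) i ≤-refl)
      (trans eq (sym (old (inject₁ i) i (ℕₚ.≤-reflexive (toℕ-inject₁ i))))))

    T-⊂ : ∀ {i i′} → toℕ i < toℕ i′ → face g i ⊂ face f i′
    T-⊂ {i} {i′} i<i′ = subst₂ _⊂_ (new (suc i) i ≤-refl) (old (suc i) i′ i<i′) (chain (h (suc i)) i<i′)

    module _ {v} (v-first : face f firstFace ≡ ⁅ v ⁆) where

      v∈face : ∀ i → v ∈ face f i
      v∈face i with toℕ i in eq
      ... | zero = subst (v ∈_) (trans (sym v-first) (cong (face f)
              (toℕ-injective (trans (toℕ-fromℕ< 0<d) (sym eq))))) (x∈⁅x⁆ v)
      ... | suc k = p⊂q⇒p⊆q (chain f (subst₂ _<_ (sym (toℕ-fromℕ< 0<d)) (sym eq) z<s))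
              (subst (v ∈_) (sym v-first) (x∈⁅x⁆ v))

      -- Both v and G_i lie in F_(i+1), which has just one vertex more than G_i. Iterated along a
      -- zigzag, this spells every face by the first vertices of successive flags.
      peel : ∀ {i i′} → toℕ i′ ≡ suc (toℕ i) → v ∉ face g i → face f i′ ≡ ⁅ v ⁆ ∪ face g i
      peel {i} {i′} i′≡ v∉ = sym (⊆∧≥⇒≡ sub (ℕₚ.≤-trans
        (ℕₚ.≤-reflexive (trans (∣face∣ f i′) (cong suc (trans i′≡ (sym (∣face∣ g i))))))
        (p⊂q⇒∣p∣<∣q∣ ((λ x∈ → x∈p∪q⁺ (inj₂ x∈)) , v , x∈p∪q⁺ (inj₁ (x∈⁅x⁆ v)) , v∉))))
        where
        sub : ⁅ v ⁆ ∪ face g i ⊆ face f i′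
        sub x∈ with x∈p∪q⁻ ⁅ v ⁆ (face g i) x∈
        ... | inj₁ x∈₁ = subst (_∈ face f i′) (sym (x∈⁅y⁆⇒x≡y v x∈₁)) (v∈face i′)
        ... | inj₂ x∈₂ = p⊂q⇒p⊆q (T-⊂ (ℕₚ.≤-reflexive (sym i′≡))) x∈₂

      -- If v lay in G_i, then F_i, which is {v} ∪ G_(i-1) by `peel` (or {v} itself at the bottom),
      -- would be contained in G_i and equal to it by size, against `T-moves`.
      v∉T : ∀ k i → toℕ i ≡ k → v ∉ face g i
      v∉T zero i eq v∈ = T-moves i (sym (same-size f g i λ x∈ →
        subst (_∈ face g i) (sym (x∈⁅y⁆⇒x≡y v (subst (_ ∈_) (trans (cong (face f)
          (toℕ-injective (trans eq (sym (toℕ-fromℕ< 0<d))))) v-first) x∈))) v∈))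
      v∉T (suc k) i eq v∈ with i′ , eq′ ← pred-Fin i eq =
        T-moves i (sym (same-size f g i sub))
        where
        i≡ : toℕ i ≡ suc (toℕ i′)
        i≡ = trans eq (cong suc (sym eq′))
        sub : face f i ⊆ face g i
        sub x∈ with x∈p∪q⁻ ⁅ v ⁆ (face g i′) (subst (_ ∈_) (peel i≡ (v∉T k i′ eq′)) x∈)
        ... | inj₁ x∈₁ = subst (_∈ face g i) (sym (x∈⁅y⁆⇒x≡y v x∈₁)) v∈
        ... | inj₂ x∈₂ = p⊂q⇒p⊆q (chain g (ℕₚ.≤-reflexive (sym i≡))) x∈₂

  record Reads (Z : Zigzag V d) (W : Word) : Set where
    constructor spells
    field
      len-n     : len Z ≡ n
      flag-face : ∀ j i → face (flag Z j) i ≡ win (letter W) j (toℕ i)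

  open Reads public

  module _ (Z : Zigzag V d) where

    private
      w : ℕ → Fin n
      w j = proj₁ (firstVertex (flag Z j))

      w-first : ∀ j → face (flag Z j) firstFace ≡ ⁅ w j ⁆
      w-first j = proj₂ (firstVertex (flag Z j))

      face-win : ∀ k j i → toℕ i ≡ k → face (flag Z j) i ≡ win w j k
      face-win zero j i eq = trans (cong (face (flag Z j))
        (toℕ-injective (trans eq (sym (toℕ-fromℕ< 0<d))))) (w-first j)
      face-win (suc k) j i eq with i′ , eq′ ← pred-Fin i eq = trans
        (peel {flag Z j} {flag Z (suc j)} (Zigzag.step Z j) (w-first j) {i′} {i} (trans eq (cong suc (sym eq′)))
          (v∉T {flag Z j} {flag Z (suc j)} (Zigzag.step Z j) (w-first j) (toℕ i′) i′ refl))
        (cong (⁅ w j ⁆ ∪_) (face-win k (suc j) i′ eq′))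

      last : Fin d
      last = fromℕ< (ℕₚ.≤-reflexive (ℕₚ.suc-pred d {{>-nonZero 0<d}}))

      toℕ-last : toℕ last ≡ pred d
      toℕ-last = toℕ-fromℕ< _

      ≤last : ∀ {m} → m < d → m ≤ pred d
      ≤last m<d = s≤s⁻¹ (subst (_ <_) (sym (ℕₚ.suc-pred d {{>-nonZero 0<d}})) m<d)

      -- The facet of the next flag consists of the next d letters and misses w i. The extreme case
      -- e = d goes beyond a single facet: it completes separation for the simplex, and for the
      -- cross-polytope it forces w (q + i) to differ from w i.
      w-≢ : ∀ {e} i → 0 < e → e ≤ d → w i ≢ w (e + i)
      w-≢ {suc e} i _ e≤d eq = v∉T {flag Z i} {flag Z (suc i)} (Zigzag.step Z i) (w-first i) (pred d) last toℕ-last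
        (subst (_∈ face (flag Z (suc i)) last) (sym (trans eq (cong w (sym (+-suc e i)))))
          (subst (w (e + suc i) ∈_) (sym (face-win (pred d) (suc i) last toℕ-last))
            (∈-win⁺ w (suc i) (≤last e≤d))))

      w-# : ∀ {e} i → 0 < e → e < d → w i # w (e + i)
      w-# {e} i 0<e e<d = face-# (isFace (flag Z i) last)
        (subst (w i ∈_) (sym (face-win (pred d) i last toℕ-last)) (∈-win⁺ w i {0} {pred d} z≤n))
        (subst (w (e + i) ∈_) (sym (face-win (pred d) i last toℕ-last)) (∈-win⁺ w i (≤last e<d)))
        (w-≢ i 0<e (ℕₚ.<⇒≤ e<d))

      w-separated : Separated w
      w-separated {e} i 0<e e<q with shape
      ... | twisted q≡d _ _ = w-# i 0<e (subst (e <_) q≡d e<q)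
      ... | untwisted q≡1+d _ τ≗id = w≢ , λ eq → w≢ (trans eq (τ≗id _))
        where w≢ = w-≢ i 0<e (s≤s⁻¹ (subst (e <_) q≡1+d e<q))

      -- By `cover` the letter w (q + i) is, up to τ, one of the q letters before it. All but the
      -- first of these are fewer than q positions away and thus separated from it; only w i
      -- remains.
      w-turn : ∀ i → w (q + i) ≡ τ (w i)
      w-turn i with cover (λ r → w (toℕ r + i))
                     (λ r≢s → separated-≢ {λ m → w (m + i)}
                       (λ {e} m 0<e e<q → subst (λ k → w (m + i) # w k) (sym (+-assoc e m i)) (w-separated (m + i) 0<e e<q))
                       (toℕ<n _) (toℕ<n _) (r≢s ∘ toℕ-injective)) (w (q + i))
      ... | r , found with toℕ r in eq
      ...   | suc k = contradiction found
        [ (λ e → proj₁ apart (sym e)) , proj₂ (#-sym apart) ]′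
        where
        k<q : suc k < q
        k<q = subst (_< q) eq (toℕ<n r)
        apart : w (suc k + i) # w (q + i)
        apart = subst (w (suc k + i) #_) (cong w (trans (sym (+-assoc (q ∸ suc k) (suc k) i))
            (cong (_+ i) (m∸n+n≡m (ℕₚ.<⇒≤ k<q)))))
          (w-separated (suc k + i) (ℕₚ.m<n⇒0<n∸m k<q) (ℕₚ.∸-monoʳ-< {q} {suc k} {0} z<s (ℕₚ.<⇒≤ k<q)))
      ...   | zero with found
      ...     | inj₂ e = e
      ...     | inj₁ e with shape
      ...       | untwisted _ _ τ≗id = trans e (sym (τ≗id _))
      ...       | twisted q≡d _ _ = contradiction (sym e) (w-≢ i (≤-trans (s≤s z≤n) 3≤q) (ℕₚ.≤-reflexive q≡d))

    word : Word
    word = record { letter = w ; separated = w-separated ; turn = w-turn }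

    private
      ≈-of-letters : ∀ {j k} → (∀ m → w (m + j) ≡ w (m + k)) → _≈_ V d (flag Z j) (flag Z k)
      ≈-of-letters {j} {k} eq i = trans (face-win (toℕ i) j i refl)
        (trans (win-cong {w = w} {w} {j} {k} (toℕ i) (λ {m} _ → eq m)) (sym (face-win (toℕ i) k i refl)))

      letter-of-≈ : ∀ {j k} → _≈_ V d (flag Z j) (flag Z k) → w j ≡ w k
      letter-of-≈ {j} {k} eq = ⁅⁆-injective (trans (sym (w-first j)) (trans (eq firstFace) (w-first k)))

      -- A shorter circuit would repeat a letter within n consecutive positions, a longer one would
      -- repeat a flag.
      len≡n : len Z ≡ n
      len≡n with ℕₚ.<-cmp (len Z) n
      ... | tri< l<n _ _ = contradiction (letter-of-≈ (Zigzag.periodic Z 0))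
        (subst (λ k → w k ≢ w 0) (+-comm (len Z) 0) (distinct word 0 (Zigzag.0<len Z) l<n))
      ... | tri≈ _ eq _ = eq
      ... | tri> _ _ n<l = contradiction
        (Zigzag.distinct Z n<l (Zigzag.0<len Z) (≈-of-letters λ m →
          trans (cong w (+-comm m n)) (trans (periodic word m) (cong w (sym (ℕₚ.+-identityʳ m))))))
        (λ n≡0 → ℕₚ.<-irrefl (sym n≡0) (≤-trans (s≤s z≤n) 4≤n))

    reads : Reads Z word
    reads = spells len≡n λ j i → face-win (toℕ i) j i refl

-- Rotation, reversal and σ₁ in terms of words

module Correspondence {C : Complex} (R : Realisation C) where
  open Words C
  open Swaps C
  open Windows
  open Zigzags R
  open Reading R public using (Reads; spells; len-n; flag-face; word; reads)

  private
    0<d : 0 < d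
    0<d = ≤-trans (s≤s z≤n) 3≤d

    infix 4 _≅ᴾ_ _~ᴾ_
    _≅ᴾ_ = _≅_ V d
    _~ᴾ_ = _~_ V d

  zigzag-reads : ∀ W → Reads (zigzag W) W
  zigzag-reads W = spells refl λ _ _ → refl

  reads-first : ∀ {Z W} → Reads Z W → ∀ j → face (flag Z j) firstFace ≡ ⁅ letter W j ⁆
  reads-first {Z} {W} rd j = firstFace-face (flag Z j) (letter W) j (flag-face rd j)

  ≅⇒Rot : ∀ {Z Z′ W W′} → Reads Z W → Reads Z′ W′ → Z ≅ᴾ Z′ → Rot W W′
  ≅⇒Rot {Z} {Z′} {W} {W′} rd rd′ (_ , k , eq) = aligned⇒Rot k 0 λ m →
    ⁅⁆-injective (trans (sym (reads-first rd (m + k)))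
      (trans (sym (eq m firstFace)) (trans (reads-first rd′ m) (cong (⁅_⁆ ∘ letter W′) (sym (ℕₚ.+-identityʳ m))))))

  reads-unique : ∀ {Z W W′} → Reads Z W → Reads Z W′ → Rot W W′
  reads-unique {Z} {W} {W′} rd rd′ = aligned⇒Rot 0 0 λ m → ⁅⁆-injective
    (trans (sym (reads-first {Z} {W} rd (m + 0))) (reads-first {Z} {W′} rd′ (m + 0)))

  Rot⇒≅ : ∀ {Z Z′ W W′} → Reads Z W → Reads Z′ W′ → Rot W W′ → Z ≅ᴾ Z′
  Rot⇒≅ {W = W} {W′} (spells l rd) (spells l′ rd′) turns = trans l (sym l′) , k , λ j i →
    trans (rd′ j i) (trans (win-cong {w = letter W′} {letter W} {j} {j + k} (toℕ i) (λ {m} _ → begin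
      letter W′ (m + j)        ≡⟨ cong (letter W′) (ℕₚ.+-identityʳ (m + j)) ⟨
      letter W′ (m + j + 0)    ≡⟨ Rot-align turns {k} {0} (letter-index W (letter W′ 0)) (m + j) ⟨
      letter W (m + j + k)     ≡⟨ cong (letter W) (+-assoc m j k) ⟩
      letter W (m + (j + k))   ∎)) (sym (rd (j + k) i)))
    where
    open ≡-Reasoning
    k = index W (letter W′ 0)

  module _ {Z W} (rd : Reads Z W) where

    private w = letter W

    -- Uniqueness of the family behind the reverse. The face x (a+1) (b+1) lies strictly between x a
    -- (b+1) and x (a+2) b, which differ by two letters; `distinct` excludes the candidate x (a+1)
    -- b, so by `diamond` the window starting one letter later is left. At the bottom the empty set
    -- plays the part of the lower face.
    triangle-win : ∀ {i₀} (t : Triangle V d (flag Z i₀)) b a → a + b < d → x t a b ≡ win w (b + i₀) a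
    triangle-win {i₀} t zero a a<d = begin
      x t a 0                       ≡⟨ cong (λ k → x t k 0) (toℕ-fromℕ< a<d′) ⟨
      x t (toℕ (fromℕ< a<d′)) 0     ≡⟨ Triangle.base t (fromℕ< a<d′) ⟩
      face (flag Z i₀) (fromℕ< a<d′) ≡⟨ flag-face rd i₀ (fromℕ< a<d′) ⟩
      win w i₀ (toℕ (fromℕ< a<d′))  ≡⟨ cong (win w i₀) (toℕ-fromℕ< a<d′) ⟩
      win w i₀ a                    ∎
      where
      open ≡-Reasoning
      a<d′ : a < d
      a<d′ = subst (_< d) (ℕₚ.+-identityʳ a) a<d
    triangle-win {i₀} t (suc b) zero b<d = diamond {A = ⊥} {B = win w j 0} {Top = win w j 1}
      (λ z∈ → contradiction z∈ Subsetₚ.∉⊥)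
      (let z , z∈ = IsFace.nonempty (Triangle.x-isFace t {0} {suc b} b<d) in z , z∈ , Subsetₚ.∉⊥)
      (subst (x t 0 (suc b) ⊂_) (triangle-win t b 1 b<d) (Triangle.diagonal t {0} {b} b<d))
      (λ z∈ → [ inj₂ ∘ inj₁ ∘ x∈⁅y⁆⇒x≡y _ , inj₂ ∘ inj₂ ∘ x∈⁅y⁆⇒x≡y _ ]′ (x∈p∪q⁻ ⁅ w j ⁆ _ z∈))
      (inj₂ ∘ x∈⁅y⁆⇒x≡y _) (λ z∈ → contradiction z∈ Subsetₚ.∉⊥) (x∈⁅x⁆ _)
      (inj₂ ∘ x∈⁅y⁆⇒x≡y _) (λ z∈ → contradiction z∈ Subsetₚ.∉⊥) (x∈⁅x⁆ _)
      (λ eq → Triangle.distinct t {0} {b} b<d (trans eq (sym (triangle-win t b 0 (<-trans (n<1+n b) b<d)))))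
      where j = b + i₀
    triangle-win {i₀} t (suc b) (suc a) ab<d = diamond
      {A = win w (suc j) a} {B = win w j (suc a)} {Top = win w j (2 + a)}
      (proj₁ (A⊂S (triangle-win t (suc b) a (<-trans (n<1+n _) ab<d)))) (proj₂ (A⊂S (triangle-win t (suc b) a (<-trans (n<1+n _) ab<d))))
      (subst (x t (suc a) (suc b) ⊂_) (triangle-win t b (2 + a) ab<d′) (Triangle.diagonal t {suc a} {b} ab<d))
      (λ z∈ → [ inj₂ ∘ inj₁ ∘ x∈⁅y⁆⇒x≡y _ , [ inj₁ , inj₂ ∘ inj₂ ]′ ∘ C⁻ ]′ (x∈p∪q⁻ ⁅ w j ⁆ _ z∈))
      (λ z∈ → [ inj₂ ∘ x∈⁅y⁆⇒x≡y _ , inj₁ ]′ (x∈p∪q⁻ ⁅ w j ⁆ _ z∈))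
      (λ z∈ → x∈p∪q⁺ (inj₂ z∈)) (x∈p∪q⁺ (inj₁ (x∈⁅x⁆ _)))
      C⁻
      (proj₁ (win-⊂ W (suc j) (n<1+n a) (<-trans (≤-<-trans (m≤m+n (suc a) (suc b)) ab<d) d<n)))
      (∈-win⁺ w (suc j) {suc a} ≤-refl)
      (λ eq → Triangle.distinct t {suc a} {b} ab<d (trans eq (sym (triangle-win t b (suc a) (<-trans (n<1+n _) ab<d′)))))
      where
      j = b + i₀
      ab<d′ : 2 + a + b < d
      ab<d′ = subst (_< d) (+-suc (suc a) b) ab<d
      A⊂S : x t a (suc b) ≡ win w (suc j) a → win w (suc j) a ⊂ x t (suc a) (suc b)
      A⊂S eq = subst (_⊂ x t (suc a) (suc b)) eq (Triangle.up t {a} {suc b} ab<d)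
      C⁻ : ∀ {z} → z ∈ win w (suc j) (suc a) → z ∈ win w (suc j) a ⊎ z ≡ w (suc a + suc j)
      C⁻ z∈ with ∈-win⁻ w (suc j) (suc a) z∈
      ... | m , m≤ , refl with ℕₚ.m≤n⇒m<n∨m≡n m≤
      ...   | inj₁ (s≤s m≤a) = inj₁ (∈-win⁺ w (suc j) m≤a)
      ...   | inj₂ refl = inj₂ refl

    triangle : ∀ i₀ → Triangle V d (flag Z i₀)
    triangle i₀ = record
      { x        = λ a b → win w (b + i₀) a
      ; x-isFace = λ {a} {b} ab<d → win-isFace W (b + i₀) (≤-<-trans (m≤m+n a b) ab<d)
      ; x-hasDim = λ {a} {b} ab<d → win-hasDim W (b + i₀) (≤-<-trans (m≤m+n a b) ab<d)
      ; base     = λ i → sym (flag-face rd i₀ i)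
      ; up       = λ {a} {b} ab<d → win-⊂ W (b + i₀) (n<1+n a) (<-trans (≤-<-trans (m≤m+n (suc a) b) ab<d) d<n)
      ; diagonal = λ {a} {b} ab<d → win-suc-⊂ W (b + i₀) (n<1+n a) (≤-<-trans (subst (suc a ≤_) (sym (+-suc a b)) (s≤s (m≤m+n a b))) (<-trans ab<d d<n))
      ; distinct = λ {a} {b} ab<d → win-moves W (b + i₀) (≤-<-trans (m≤m+n a (suc b)) ab<d)
      }

  -- The vertex of a reversed flag is x 0 (d - 1), the last letter of the window. As i + j is
  -- constant, the word of the reverse zigzag runs through these letters backwards.
  IsReverse⇒Anti : ∀ {Z Z′ W W′} → Reads Z W → Reads Z′ W′ → IsReverse V d Z Z′ → Anti W W′
  IsReverse⇒Anti {Z} {Z′} {W} {W′} rd rd′ (_ , rev′) = Anti-sym (anti λ y →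
    subst (λ y → next W (next W′ y) ≡ y) (letter-index W′ y) (back (index W′ y) (index<n W′ y)))
    where
    open ≡-Reasoning
    opposite-first : toℕ (opposite firstFace) ≡ pred d
    opposite-first = trans (opposite-prop firstFace)
      (trans (cong (λ k → d ∸ suc k) (toℕ-fromℕ< 0<d)) (sym (ℕₚ.pred[m∸n]≡m∸[1+n] d 0)))
    at : ∀ i j → suc (i + j) ≡ n → letter W′ j ≡ letter W (pred d + i)
    at i j i+j with t , eq ← rev′ i j (trans i+j (sym (len-n rd))) = ⁅⁆-injective (begin
      ⁅ letter W′ j ⁆                                ≡⟨ reads-first rd′ j ⟨
      face (flag Z′ j) firstFace                     ≡⟨ eq firstFace ⟩
      x t (toℕ firstFace) (toℕ (opposite firstFace)) ≡⟨ cong₂ (x t) (toℕ-fromℕ< 0<d) opposite-first ⟩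
      x t 0 (pred d)                                 ≡⟨ triangle-win rd t (pred d) 0 (ℕₚ.≤-reflexive (ℕₚ.suc-pred d {{>-nonZero 0<d}})) ⟩
      ⁅ letter W (pred d + i) ⁆                      ∎)
    back : ∀ j → j < n → next W (next W′ (letter W′ j)) ≡ letter W′ j
    back j j<n with n ∸ suc j in eq | m∸n+n≡m j<n
    ... | suc i | i+j = begin
      next W (next W′ (letter W′ j))      ≡⟨ cong (next W) (next-letter W′ j) ⟩
      next W (letter W′ (suc j))          ≡⟨ cong (next W) (at i (suc j) i+j) ⟩
      next W (letter W (pred d + i))      ≡⟨ next-letter W _ ⟩
      letter W (suc (pred d + i))         ≡⟨ cong (letter W) (+-suc (pred d) i) ⟨
      letter W (pred d + suc i)           ≡⟨ at (suc i) j (trans (cong suc (sym (+-suc i j))) i+j) ⟨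
      letter W′ j                         ∎
    -- For j = n - 1 the next position n lies outside the range of `at`, so periodicity brings it
    -- back to 0.
    ... | zero | 1+j≡n = begin
      next W (next W′ (letter W′ j))            ≡⟨ cong (next W) (next-letter W′ j) ⟩
      next W (letter W′ (suc j))                ≡⟨ cong (next W ∘ letter W′) (trans 1+j≡n (sym (ℕₚ.+-identityʳ n))) ⟩
      next W (letter W′ (n + 0))                ≡⟨ cong (next W) (periodic W′ 0) ⟩
      next W (letter W′ 0)                      ≡⟨ cong (next W) (at j 0 (trans (cong suc (ℕₚ.+-identityʳ j)) 1+j≡n)) ⟩
      next W (letter W (pred d + j))            ≡⟨ next-letter W _ ⟩
      letter W (suc (pred d + j))               ≡⟨ cong (letter W) (trans (sym (+-suc (pred d) j)) (+-comm (pred d) (suc j))) ⟩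
      letter W (suc j + pred d)                 ≡⟨ cong (λ k → letter W (k + pred d)) 1+j≡n ⟩
      letter W (n + pred d)                     ≡⟨ periodic W (pred d) ⟩
      letter W (pred d)                         ≡⟨ cong (letter W) (ℕₚ.+-identityʳ (pred d)) ⟨
      letter W (pred d + 0)                     ≡⟨ at 0 j 1+j≡n ⟨
      letter W′ j                               ∎

  reverse-exists : ∀ {Z W} → Reads Z W → ∃ λ Zᵗ → ∃ λ Wᵗ → IsReverse V d Z Zᵗ × Reads Zᵗ Wᵗ × Anti W Wᵗ
  reverse-exists {Z} {W} rd = zigzag Wᵗ , Wᵗ ,
    (len-n rd , λ i j i+j → triangle rd i , λ a → same i j (trans i+j (len-n rd)) (toℕ a) (toℕ (opposite a)) (a+o a)) ,
    zigzag-reads Wᵗ , flips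
    where
    -- A letter's positions in W and in its reverse add up to K: the offsets within the two windows
    -- and the column of the triangle contribute d - 1, the places i and j of the two flags n - 1.
    K = pred d + pred n
    k = index (rev W) (letter W K)
    Wᵗ = shift (rev W) k
    flips : Anti W Wᵗ
    flips = Anti-Rot (Anti-rev W) (Rot-shift (rev W) k)
    a+o : ∀ (a : Fin d) → toℕ a + toℕ (opposite a) ≡ pred d
    a+o a = trans (cong (toℕ a +_) (opposite-prop a)) (ℕₚ.suc-injective
      (trans (m+[n∸m]≡n (toℕ<n a)) (sym (ℕₚ.suc-pred d {{>-nonZero 0<d}}))))
    module _ (i j : ℕ) (i+j : suc (i + j) ≡ n) (a o : ℕ) (a+o≡ : a + o ≡ pred d) where
      mirror : ∀ p s → p + s ≡ a → letter W (s + (o + i)) ≡ letter Wᵗ (p + j)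
      mirror p s p+s = trans (Anti-align flips {0} {K} (sym (letter-index (rev W) (letter W K))) (p + j) (s + (o + i)) (begin
        p + j + (s + (o + i))  ≡⟨ solve 5 (λ p j s o i → p :+ j :+ (s :+ (o :+ i)) := p :+ s :+ o :+ (i :+ j)) refl p j s o i ⟩
        p + s + o + (i + j)    ≡⟨ cong₂ _+_ (trans (cong (_+ o) p+s) a+o≡) (cong pred i+j) ⟩
        K                      ∎)) (cong (letter Wᵗ) (ℕₚ.+-identityʳ (p + j)))
        where
        open ≡-Reasoning
        open +-*-Solver
      same : win (letter Wᵗ) j a ≡ win (letter W) (o + i) a
      same = ⊆-antisym
        (λ z∈ → let m , m≤a , eq = ∈-win⁻ (letter Wᵗ) j a z∈ in
          subst (_∈ win (letter W) (o + i) a) (trans (mirror m (a ∸ m) (m+[n∸m]≡n m≤a)) (sym eq))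
            (∈-win⁺ (letter W) (o + i) (ℕₚ.m∸n≤m a m)))
        (λ z∈ → let m , m≤a , eq = ∈-win⁻ (letter W) (o + i) a z∈ in
          subst (_∈ win (letter Wᵗ) j a) (trans (sym (mirror (a ∸ m) m (m∸n+n≡m m≤a))) (sym eq))
            (∈-win⁺ (letter Wᵗ) j (ℕₚ.m∸n≤m a m)))

  ~⇒Dih : ∀ {Z Z′ W W′} → Reads Z W → Reads Z′ W′ → Z ~ᴾ Z′ → Dih W W′
  ~⇒Dih {Z} {Z′} {W} {W′} rd rd′ (inj₁ iso) = inj₁ (≅⇒Rot {Z} {Z′} {W} {W′} rd rd′ iso)
  ~⇒Dih {Z} {Z′} {W} {W′} rd rd′ (inj₂ (Zᵗ , isRev , iso)) = inj₂ (Anti-Rot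
    (IsReverse⇒Anti {Z} {Zᵗ} {W} {word Zᵗ} rd (reads Zᵗ) isRev)
    (≅⇒Rot {Zᵗ} {Z′} {word Zᵗ} {W′} (reads Zᵗ) rd′ iso))

  Dih⇒~ : ∀ {Z Z′ W W′} → Reads Z W → Reads Z′ W′ → Dih W W′ → Z ~ᴾ Z′
  Dih⇒~ {Z} {Z′} {W} {W′} rd rd′ (inj₁ turns) = inj₁ (Rot⇒≅ {Z} {Z′} {W} {W′} rd rd′ turns)
  Dih⇒~ {Z} {Z′} {W} {W′} rd rd′ (inj₂ flips) = via (reverse-exists {Z} {W} rd)
    where
    via : (∃ λ Zᵗ → ∃ λ Wᵗ → IsReverse V d Z Zᵗ × Reads Zᵗ Wᵗ × Anti W Wᵗ) → Z ~ᴾ Z′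
    via (Zᵗ , Wᵗ , isRev , rdᵗ , flipsᵗ) =
      inj₂ (Zᵗ , isRev , Rot⇒≅ {Zᵗ} {Z′} {Wᵗ} {W′} rdᵗ rd′ (Anti-Anti (Anti-sym flipsᵗ) flips))

  -- Each window adds one letter. Were the new letter of W an earlier one of W′, it would lie in the
  -- preceding window, common to both words, and W would repeat a letter.
  win-letters : ∀ W W′ j k → (∀ {i} → i < d → win (letter W) j i ≡ win (letter W′) k i) →
                ∀ {m} → m < d → letter W (m + j) ≡ letter W′ (m + k)
  win-letters W W′ j k eq {zero} 0<d = ⁅⁆-injective (eq 0<d)
  win-letters W W′ j k eq {suc m} m<d
    with m′ , m′≤ , at ← ∈-win⁻ (letter W′) k (suc m) (subst (letter W (suc m + j) ∈_) (eq m<d) (∈-win⁺ (letter W) j {suc m} ≤-refl))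
    with ℕₚ.m≤n⇒m<n∨m≡n m′≤
  ... | inj₂ refl = at
  ... | inj₁ (s≤s m′≤m)
    with l , l≤m , at′ ← ∈-win⁻ (letter W) j m (subst (letter W′ (m′ + k) ∈_) (sym (eq (<-trans (n<1+n m) m<d))) (∈-win⁺ (letter W′) k m′≤m)) =
    contradiction (s≤s l≤m) (ℕₚ.<-irrefl (sym (offset-injective W j (<-trans m<d d<n)
      (≤-<-trans l≤m (<-trans (n<1+n m) (<-trans m<d d<n))) (trans at at′))))

  win-swap : ∀ W j {i} → suc i < q → win (letter (swap W j)) j (suc i) ≡ win (letter W) j (suc i)
  win-swap W j {zero} _ = trans (cong₂ (λ x y → ⁅ x ⁆ ∪ ⁅ y ⁆) (swap-here W j) (swap-suc W j))
    (Subsetₚ.∪-comm _ _)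
  win-swap W j {suc i} i<q = begin
    ⁅ s j ⁆ ∪ (⁅ s (suc j) ⁆ ∪ rest)
      ≡⟨ cong₂ (λ x y → ⁅ x ⁆ ∪ (⁅ y ⁆ ∪ rest)) (swap-here W j) (swap-suc W j) ⟩
    ⁅ w (suc j) ⁆ ∪ (⁅ w j ⁆ ∪ rest)   ≡⟨ Subsetₚ.∪-assoc _ _ _ ⟨
    (⁅ w (suc j) ⁆ ∪ ⁅ w j ⁆) ∪ rest   ≡⟨ cong₂ _∪_ (Subsetₚ.∪-comm _ _) far ⟩
    (⁅ w j ⁆ ∪ ⁅ w (suc j) ⁆) ∪ rest′  ≡⟨ Subsetₚ.∪-assoc _ _ _ ⟩
    ⁅ w j ⁆ ∪ (⁅ w (suc j) ⁆ ∪ rest′)  ∎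
    where
    open ≡-Reasoning
    s = letter (swap W j)
    w = letter W
    rest = win s (2 + j) i
    rest′ = win w (2 + j) i
    far : rest ≡ rest′
    far = win-cong {w = s} {w} {2 + j} {2 + j} i λ {m} m≤i →
      subst (λ k → s k ≡ w k) (sym (trans (+-suc m (suc j)) (cong suc (+-suc m j))))
        (swap-far W j (s≤s (s≤s z≤n)) (≤-<-trans (s≤s (s≤s m≤i)) i<q))

  Switches : Zigzag V d → ℕ → (Flag V d → Set) → Set
  Switches Z j P = ∃ λ g → σ₁ V d (flag Z j) g × P g

  -- The edge spanned by w j and w (j + 1) stays, so σ₁ can only replace w j by w (j + 1); the new
  -- flag is then window j of `swap W j`, and a word is determined up to rotation by one of its
  -- windows.
  switch⇒Rot : ∀ {Z Z′ W W′} → Reads Z W → Reads Z′ W′ → ∀ j →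
               Switches Z j (λ g → _∈ᶻ_ V d g Z′) → Rot (swap W j) W′
  switch⇒Rot {Z} {Z′} {W} {W′} rd rd′ j (g , (i₀ , i₀≡0 , moved , others) , k , g≈) =
    window-determines j k (win-letters (swap W j) W′ j k λ i<d →
      subst (λ i → win (letter (swap W j)) j i ≡ win (letter W′) k i) (toℕ-fromℕ< i<d)
        (trans (sym (faces (fromℕ< i<d))) (trans (g≈ (fromℕ< i<d)) (flag-face rd′ k (fromℕ< i<d)))))
    where
    w = letter W
    1<d : 1 < d
    1<d = ≤-trans (s≤s (s≤s z≤n)) 3≤d
    i₁ = fromℕ< 1<d
    i₁≢i₀ : i₁ ≢ i₀
    i₁≢i₀ eq = contradiction (trans (sym (toℕ-fromℕ< 1<d)) (trans (cong toℕ eq) i₀≡0)) λ ()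
    f-face : ∀ {i k} → toℕ i ≡ k → face (flag Z j) i ≡ win w j k
    f-face refl = flag-face rd j _
    moved-face : face g i₀ ≡ ⁅ w (suc j) ⁆
    moved-face = diamond {A = ⊥} {B = ⁅ w j ⁆} {Top = win w j 1}
      (λ z∈ → contradiction z∈ Subsetₚ.∉⊥)
      (let z , z∈ = IsFace.nonempty (isFace g i₀) in z , z∈ , Subsetₚ.∉⊥)
      (subst (face g i₀ ⊂_) (trans (others i₁ i₁≢i₀) (f-face (toℕ-fromℕ< 1<d)))
        (chain g (subst₂ _<_ (sym i₀≡0) (sym (toℕ-fromℕ< 1<d)) z<s)))
      (λ z∈ → [ inj₂ ∘ inj₁ ∘ x∈⁅y⁆⇒x≡y _ , inj₂ ∘ inj₂ ∘ x∈⁅y⁆⇒x≡y _ ]′ (x∈p∪q⁻ ⁅ w j ⁆ _ z∈))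
      (inj₂ ∘ x∈⁅y⁆⇒x≡y _) (λ z∈ → contradiction z∈ Subsetₚ.∉⊥) (x∈⁅x⁆ _)
      (inj₂ ∘ x∈⁅y⁆⇒x≡y _) (λ z∈ → contradiction z∈ Subsetₚ.∉⊥) (x∈⁅x⁆ _)
      (λ eq → moved (trans eq (sym (f-face i₀≡0))))
    faces : ∀ i → face g i ≡ win (letter (swap W j)) j (toℕ i)
    faces i with toℕ i in eq
    ... | zero = trans (cong (face g) (toℕ-injective (trans eq (sym i₀≡0))))
      (trans moved-face (cong ⁅_⁆ (sym (swap-here W j))))
    ... | suc m = trans (others i (λ i≡i₀ → contradiction (trans (sym eq) (trans (cong toℕ i≡i₀) i₀≡0)) λ ()))
      (trans (f-face eq) (sym (win-swap W j (<-≤-trans (subst (_< d) eq (toℕ<n i)) d≤q))))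

  Rot⇒switch : ∀ {Z Z′ W W′} → Reads Z W → Reads Z′ W′ → ∀ j →
               Rot (swap W j) W′ → Switches Z j (λ g → _∈ᶻ_ V d g Z′)
  Rot⇒switch {Z} {Z′} {W} {W′} rd rd′ j turns =
    flag Z′ k , (firstFace , toℕ-fromℕ< 0<d , moved , others) , k , λ _ → refl
    where
    w = letter W
    k = index W′ (letter (swap W j) j)
    g-face : ∀ i → face (flag Z′ k) i ≡ win (letter (swap W j)) j (toℕ i)
    g-face i = trans (flag-face rd′ k i) (win-cong {w = letter W′} {letter (swap W j)} {k} {j} (toℕ i) λ {m} _ →
      sym (Rot-align turns {j} {k} (sym (letter-index W′ _)) m))
    moved : face (flag Z′ k) firstFace ≢ face (flag Z j) firstFace
    moved eq = distinct W {1} j z<s (≤-trans (s≤s (s≤s z≤n)) 4≤n) (⁅⁆-injective (trans (cong ⁅_⁆ (sym (swap-here W j)))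
      (trans (sym (firstFace-face (flag Z′ k) (letter (swap W j)) j g-face)) (trans eq (reads-first rd j)))))
    others : ∀ i → i ≢ firstFace → face (flag Z′ k) i ≡ face (flag Z j) i
    others i i≢ with toℕ i in eq
    ... | zero = contradiction (toℕ-injective (trans eq (sym (toℕ-fromℕ< 0<d)))) i≢
    ... | suc m = trans (g-face i) (trans (cong (win (letter (swap W j)) j) eq)
      (trans (win-swap W j (<-≤-trans (subst (_< d) eq (toℕ<n i)) d≤q))
        (trans (cong (win w j) (sym eq)) (sym (flag-face rd j i)))))

  switch⇒Anti : ∀ {Z Z′ W W′} → Reads Z W → Reads Z′ W′ → ∀ j →
                Switches Z j (λ g → _∈ᵗ_ V d g Z′) → Anti (swap W j) W′
  switch⇒Anti {Z} {Z′} {W} {W′} rd rd′ j (g , sw , Zᵗ , isRev , g∈) = Rot-Anti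
    (switch⇒Rot {Z} {Zᵗ} {W} {word Zᵗ} rd (reads Zᵗ) j (g , sw , g∈))
    (Anti-sym (IsReverse⇒Anti {Z′} {Zᵗ} {W′} {word Zᵗ} rd′ (reads Zᵗ) isRev))

  Anti⇒switch : ∀ {Z Z′ W W′} → Reads Z W → Reads Z′ W′ → ∀ j →
                Anti (swap W j) W′ → Switches Z j (λ g → _∈ᵗ_ V d g Z′)
  Anti⇒switch {Z} {Z′} {W} {W′} rd rd′ j flips = via (reverse-exists {Z′} {W′} rd′)
    where
    via : (∃ λ Zᵗ → ∃ λ Wᵗ → IsReverse V d Z′ Zᵗ × Reads Zᵗ Wᵗ × Anti W′ Wᵗ) →
          Switches Z j (λ g → _∈ᵗ_ V d g Z′)
    via (Zᵗ , Wᵗ , isRev , rdᵗ , flipsᵗ) =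
      let g , sw , g∈ = Rot⇒switch {Z} {Zᵗ} {W} {Wᵗ} rd rdᵗ j (Anti-Anti flips flipsᵗ)
      in g , sw , Zᵗ , isRev , g∈

-- Intersections

Count-cong : ∀ {l c} {P Q : Fin l → Set} → (∀ j → P j ⇔ Q j) → Count P c → Count Q c
Count-cong P⇔Q (S , ∣S∣ , S⇔P) = S , ∣S∣ , λ j →
  mk⇔ (Equivalence.to (P⇔Q j) ∘ Equivalence.to (S⇔P j)) (Equivalence.from (S⇔P j) ∘ Equivalence.from (P⇔Q j))

Count-resize : ∀ {l l′ c} {P : ℕ → Set} → l ≡ l′ → Count {l} (P ∘ toℕ) c → Count {l′} (P ∘ toℕ) c
Count-resize refl cnt = cnt

Count-none : ∀ {l} {P : Fin l → Set} → (∀ j → ¬ P j) → Count P 0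
Count-none {l} none = ⊥ , ∣⊥∣≡0 l , λ j → mk⇔ (λ j∈ → contradiction j∈ Subsetₚ.∉⊥) (λ p → contradiction p (none j))

Count-witness : ∀ {l c} {P : Fin l → Set} → Count P c → 0 < c → ∃ P
Count-witness (S , ∣S∣ , S⇔P) 0<c = j , Equivalence.to (S⇔P j) (members-∈ S _)
  where j = members S (fromℕ< (subst (0 <_) (sym ∣S∣) 0<c))

module Intersections {C : Complex} (R : Realisation C) where
  open Words C
  open Swaps C
  open Zigzags R
  open Correspondence R

  noSelfIntersections : ∀ Z → NoSelfIntersections V d Z
  noSelfIntersections Z f (j , f≈) g (i , i≡0 , moved , others) = λ where
      (inj₁ g∈) → swap-¬Dih-self W j (Dih-sym (inj₁ (switch⇒Rot {Z} {Z} {W} {W} (reads Z) (reads Z) j (g , switched , g∈))))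
      (inj₂ g∈) → swap-¬Dih-self W j (Dih-sym (inj₂ (switch⇒Anti {Z} {Z} {W} {W} (reads Z) (reads Z) j (g , switched , g∈))))
    where
    W = word Z
    switched : σ₁ V d (flag Z j) g
    switched = i , i≡0 , (λ eq → moved (trans eq (sym (f≈ i)))) , λ k k≢i → trans (others k k≢i) (f≈ k)

  -- The exchanges at the n positions represent p zigzags up to reversal; each is reached from b
  -- positions in the orientation of its representative and from a positions in the opposite one.
  -- Since 0 < b, the signature reveals which zigzags are met.
  record SwapClasses (p a b : ℕ) : Set where
    field
      a≤b   : a ≤ b
      0<b   : 0 < b
      cover : ∀ W {j} → j < n → ∃ λ k → k < p × Dih (swap W j) (swap W k)
      apart : ∀ W {k j} → k < j → j < p → ¬ Dih (swap W k) (swap W j)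
      rots  : ∀ W {k} → k < p → Count {n} (λ j → Rot (swap W (toℕ j)) (swap W k)) b
      antis : ∀ W {k} → k < p → Count {n} (λ j → Anti (swap W (toℕ j)) (swap W k)) a

  module _ {p a b} (classes : SwapClasses p a b) (Z : Zigzag V d) where
    open SwapClasses classes hiding (cover)
    private
      W = word Z
      U = swap W
      rd = reads Z
      cov = SwapClasses.cover classes

    module _ (Z′ : Zigzag V d) where
      private
        W′ = word Z′
        rd′ = reads Z′

      ∈ᶻ-count : ∀ {c} → Count {n} (λ j → Rot (U (toℕ j)) W′) c →
                 Count {len Z} (λ j → Switches Z (toℕ j) (λ g → _∈ᶻ_ V d g Z′)) c
      ∈ᶻ-count cnt = Count-cong
        (λ j → mk⇔ (Rot⇒switch {Z} {Z′} {W} {W′} rd rd′ (toℕ j)) (switch⇒Rot {Z} {Z′} {W} {W′} rd rd′ (toℕ j)))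
        (Count-resize {P = λ j → Rot (U j) W′} (sym (len-n rd)) cnt)

      ∈ᵗ-count : ∀ {c} → Count {n} (λ j → Anti (U (toℕ j)) W′) c →
                 Count {len Z} (λ j → Switches Z (toℕ j) (λ g → _∈ᵗ_ V d g Z′)) c
      ∈ᵗ-count cnt = Count-cong
        (λ j → mk⇔ (Anti⇒switch {Z} {Z′} {W} {W′} rd rd′ (toℕ j)) (switch⇒Anti {Z} {Z′} {W} {W′} rd rd′ (toℕ j)))
        (Count-resize {P = λ j → Anti (U j) W′} (sym (len-n rd)) cnt)

      meets : ∀ {k} → k < p → Dih (U k) W′ → NormalizedSignature V d Z Z′ (a , b)
      meets {k} k<p (inj₁ turns) = a≤b , inj₂
        ( ∈ᶻ-count (Count-cong (λ j → mk⇔ (λ r → Rot-trans r turns)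
            (λ r → Rot-trans r (Rot-sym turns))) (rots W k<p))
        , ∈ᵗ-count (Count-cong (λ j → mk⇔ (λ r → Anti-Rot r turns)
            (λ r → Anti-Rot r (Rot-sym turns))) (antis W k<p)) )
      meets {k} k<p (inj₂ flips) = a≤b , inj₁
        ( ∈ᶻ-count (Count-cong (λ j → mk⇔ (λ r → Anti-Anti r flips)
            (λ r → Rot-Anti r (Anti-sym flips))) (antis W k<p))
        , ∈ᵗ-count (Count-cong (λ j → mk⇔ (λ r → Rot-Anti r flips)
            (λ r → Anti-Anti r (Anti-sym flips))) (rots W k<p)) )

      met : NormalizedSignature V d Z Z′ (a , b) → ∃ λ k → k < p × Dih (U k) W′
      met (_ , sig) = let j , j<n , dih = switching sig
                          k , k<p , dih′ = cov W j<n
                      in k , k<p , Dih-trans (Dih-sym dih′) dih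
        where
        switching : Signature V d Z Z′ (a , b) ⊎ Signature V d Z Z′ (b , a) → ∃ λ j → j < n × Dih (U j) W′
        switching (inj₁ (_ , cnt)) = let j , sw = Count-witness cnt 0<b in
          toℕ j , subst (toℕ j <_) (len-n rd) (toℕ<n j) , inj₂ (switch⇒Anti {Z} {Z′} {W} {W′} rd rd′ (toℕ j) sw)
        switching (inj₂ (cnt , _)) = let j , sw = Count-witness cnt 0<b in
          toℕ j , subst (toℕ j <_) (len-n rd) (toℕ<n j) , inj₁ (switch⇒Rot {Z} {Z′} {W} {W′} rd rd′ (toℕ j) sw)

      misses : (∀ k → k < p → ¬ Dih (U k) W′) → NormalizedSignature V d Z Z′ (0 , 0)
      misses none = z≤n , inj₁
        ( ∈ᶻ-count (Count-none λ j turns → never j (inj₁ turns))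
        , ∈ᵗ-count (Count-none λ j flips → never j (inj₂ flips)) )
        where
        never : ∀ (j : Fin n) → ¬ Dih (U (toℕ j)) W′
        never j dih = let k , k<p , dih′ = cov W (toℕ<n j) in
          none k k<p (Dih-trans (Dih-sym dih′) dih)

    intersectionVector : IntersectionVector V d Z (a , b) p
    intersectionVector =
      ( tabulate neighbour , length-tabulate neighbour
      , AllPairsₚ.tabulate⁺-< (λ {r} {s} r<s eq → apart W r<s (toℕ<n s)
          (~⇒Dih {neighbour r} {neighbour s} {U (toℕ r)} {U (toℕ s)}
            (zigzag-reads (U (toℕ r))) (zigzag-reads (U (toℕ s))) eq))
      , Allₚ.tabulate⁺ (λ r →
          (λ eq → swap-¬Dih-self W (toℕ r)
            (~⇒Dih {Z} {neighbour r} {W} {U (toℕ r)} rd (zigzag-reads (U (toℕ r))) eq))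
        , meets (neighbour r) (toℕ<n r) (inj₁ (reads-unique {neighbour r} {U (toℕ r)} {word (neighbour r)}
            (zigzag-reads (U (toℕ r))) (reads (neighbour r)))))
      , λ Z′ (_ , sig) → let k , k<p , dih = met Z′ sig in
          Anyₚ.tabulate⁺ (fromℕ< k<p)
            (Dih⇒~ {Z′} {neighbour (fromℕ< k<p)} {word Z′} {U (toℕ (fromℕ< k<p))}
              (reads Z′) (zigzag-reads (U (toℕ (fromℕ< k<p))))
              (subst (λ k → Dih (word Z′) (U k)) (sym (toℕ-fromℕ< k<p)) (Dih-sym dih))) )
      , λ Z′ _ → dichotomy Z′
      where
      neighbour : Fin p → Zigzag V d
      neighbour r = zigzag (U (toℕ r))
      dichotomy : ∀ Z′ → NormalizedSignature V d Z Z′ (a , b) ⊎ NormalizedSignature V d Z Z′ (0 , 0)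
      dichotomy Z′ = decide (any? {p} (λ r → Dih? (U (toℕ r)) (word Z′)))
        where
        decide : Dec (∃ λ (r : Fin p) → Dih (U (toℕ r)) (word Z′)) →
                 NormalizedSignature V d Z Z′ (a , b) ⊎ NormalizedSignature V d Z Z′ (0 , 0)
        decide (yes (r , dih)) = inj₁ (meets Z′ (toℕ<n r) dih)
        decide (no none) = inj₂ (misses Z′ λ k k<p dih → none (fromℕ< k<p ,
          subst (λ k → Dih (U k) (word Z′)) (sym (toℕ-fromℕ< k<p)) dih))

  module _ {a b c : Fin n} (a≢b : a ≢ b) (a≢c : a ≢ c) (b≢c : b ≢ c) where
    open Canonical C a≢b a≢c b≢c

    record Transversal (m : ℕ) : Set where
      field
        representative : Fin m → Word
        canonical      : ∀ i → Canon (representative i)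
        irredundant    : ∀ {i j} → (∀ r → letter (representative i) r ≡ letter (representative j) r) → i ≡ j
        complete       : ∀ W → Canon W → ∃ λ i → ∀ r → letter W r ≡ letter (representative i) r

    module _ {m} (t : Transversal m) where
      open Transversal t

      zVector : ZVector V d n m
      zVector =
        ( tabulate Zs , length-tabulate Zs
        , AllPairsₚ.tabulate⁺ (λ {i} {j} i≢j eq → i≢j (irredundant (canonical-unique (canonical i) (canonical j)
            (~⇒Dih {Zs i} {Zs j} {representative i} {representative j}
              (zigzag-reads (representative i)) (zigzag-reads (representative j)) eq))))
        , Allₚ.tabulate⁺ (λ _ → _)
        , λ Z _ → let W′ , canon , dih = canonical-exists (word Z)
                      i , eq = complete W′ canon in
            Anyₚ.tabulate⁺ i (Dih⇒~ {Z} {Zs i} {word Z} {representative i} (reads Z) (zigzag-reads (representative i))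
              (Dih-trans dih (inj₁ (aligned⇒Rot 0 0 λ m → eq (m + 0))))) )
        , λ Z → len-n (reads Z) , noSelfIntersections Z
        where
        Zs : Fin m → Zigzag V d
        Zs = zigzag ∘ representative

∣⁅⁆∪∣ : ∀ {n} {i : Fin n} {S} → i ∉ S → ∣ ⁅ i ⁆ ∪ S ∣ ≡ suc ∣ S ∣
∣⁅⁆∪∣ {i = zero} {inside ∷ S} i∉ = contradiction here i∉
∣⁅⁆∪∣ {i = zero} {outside ∷ S} i∉ = cong (λ A → suc ∣ A ∣) (Subsetₚ.∪-identityˡ S)
∣⁅⁆∪∣ {i = suc i} {inside ∷ S} i∉ = cong suc (∣⁅⁆∪∣ (i∉ ∘ there))
∣⁅⁆∪∣ {i = suc i} {outside ∷ S} i∉ = ∣⁅⁆∪∣ (i∉ ∘ there)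

Count-one : ∀ {l} {P : Fin l → Set} i → P i → (∀ j → P j → j ≡ i) → Count P 1
Count-one {P = P} i Pi only = ⁅ i ⁆ , ∣⁅x⁆∣≡1 i , λ j →
  mk⇔ (λ j∈ → subst P (sym (x∈⁅y⁆⇒x≡y i j∈)) Pi) (λ Pj → subst (_∈ ⁅ i ⁆) (sym (only j Pj)) (x∈⁅x⁆ i))

Count-two : ∀ {l} {P : Fin l → Set} i k → i ≢ k → P i → P k → (∀ j → P j → j ≡ i ⊎ j ≡ k) → Count P 2
Count-two {P = P} i k i≢k Pi Pk only = ⁅ i ⁆ ∪ ⁅ k ⁆ ,
  trans (∣⁅⁆∪∣ (i≢k ∘ x∈⁅y⁆⇒x≡y k)) (cong suc (∣⁅x⁆∣≡1 k)) , λ j → mk⇔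
    (λ j∈ → [ (λ e → subst P (sym (x∈⁅y⁆⇒x≡y i e)) Pi) , (λ e → subst P (sym (x∈⁅y⁆⇒x≡y k e)) Pk) ]′ (x∈p∪q⁻ ⁅ i ⁆ _ j∈))
    (λ Pj → x∈p∪q⁺ (Sum.map (λ e → subst (_∈ ⁅ i ⁆) (sym e) (x∈⁅x⁆ i)) (λ e → subst (_∈ ⁅ k ⁆) (sym e) (x∈⁅x⁆ k)) (only j Pj)))

-- Which exchanges agree

module SwapClassification {C : Complex} (R : Realisation C) where
  open Words C
  open Swaps C
  open Intersections R

  module _ (5≤n : 5 ≤ n) where

    n≤q+q : n ≤ q + q
    n≤q+q with shape
    ... | untwisted _ n≡q _ = subst (_≤ q + q) (sym n≡q) (m≤m+n q q)
    ... | twisted _ n≡q+q _ = ℕₚ.≤-reflexive n≡q+q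

    reduce : ∀ {j} → j < n → ∃ λ k → k < q × (j ≡ k ⊎ j ≡ q + k)
    reduce {j} j<n with ℕₚ.<-≤-connex j q
    ... | inj₁ j<q = j , j<q , inj₁ refl
    ... | inj₂ q≤j = j ∸ q , ℕₚ.+-cancelˡ-< q _ _ (subst (_< q + q) (sym (m+[n∸m]≡n q≤j)) (<-≤-trans j<n n≤q+q)) ,
      inj₂ (sym (m+[n∸m]≡n q≤j))

    reduced-Rot : ∀ W {j k} → j ≡ k ⊎ j ≡ q + k → Rot (swap W j) (swap W k)
    reduced-Rot W (inj₁ refl) = Rot-refl
    reduced-Rot W (inj₂ refl) = swap-turn W _

    Dih⇒≡ : ∀ W {k k′} → k < q → k′ < q → Dih (swap W k) (swap W k′) → k ≡ k′
    Dih⇒≡ W {k} {k′} k<q k′<q dih with ℕₚ.<-cmp k k′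
    ... | tri< k<k′ _ _ = contradiction dih (swap-¬Dih 5≤n W k<k′ k′<q)
    ... | tri≈ _ k≡k′ _ = k≡k′
    ... | tri> _ _ k′<k = contradiction (Dih-sym dih) (swap-¬Dih 5≤n W k′<k k<q)

    Dih⇒reduced : ∀ W {j k} → j < n → k < q → Dih (swap W j) (swap W k) → j ≡ k ⊎ j ≡ q + k
    Dih⇒reduced W j<n k<q dih with k′ , k′<q , red ← reduce j<n
      with refl ← Dih⇒≡ W k′<q k<q (Dih-trans (Dih-sym (inj₁ (reduced-Rot W red))) dih) = red

    -- A position whose exchange is equivalent to the one at k must be k or q + k, where it is a
    -- rotation of it. Being a reversal as well would make `swap W k` its own reverse.
    no-antis : ∀ W {k} → k < q → Count {n} (λ j → Anti (swap W (toℕ j)) (swap W k)) 0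
    no-antis W {k} k<q = Count-none λ j flips → ¬Anti-self (swap W k)
      (Rot-Anti (Rot-sym (reduced-Rot W (Dih⇒reduced W (toℕ<n j) k<q (inj₂ flips)))) flips)

    swapClasses : ∀ {b} → 0 < b → (∀ W {k} → k < q → Count {n} (λ j → Rot (swap W (toℕ j)) (swap W k)) b) →
                  SwapClasses q 0 b
    swapClasses 0<b rots = record
      { a≤b = z≤n ; 0<b = 0<b
      ; cover = λ W j<n → let k , k<q , red = reduce j<n in k , k<q , inj₁ (reduced-Rot W red)
      ; apart = swap-¬Dih 5≤n ; rots = rots ; antis = no-antis }

    untwistedClasses : n ≡ q → SwapClasses q 0 1
    untwistedClasses n≡q = swapClasses z<s λ W {k} k<q → let k<n = <-≤-trans k<q q≤n in
      Count-one (fromℕ< k<n) (subst (λ i → Rot (swap W i) (swap W k)) (sym (toℕ-fromℕ< k<n)) Rot-refl)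
        λ j turns → toℕ-injective (trans
          ([ id , (λ j≡q+k → contradiction (subst (_< q) j≡q+k (subst (toℕ j <_) n≡q (toℕ<n j))) (ℕₚ.m+n≮m q k)) ]′
            (Dih⇒reduced W (toℕ<n j) k<q (inj₁ turns)))
          (sym (toℕ-fromℕ< k<n)))

    twistedClasses : n ≡ q + q → SwapClasses q 0 2
    twistedClasses n≡q+q = swapClasses z<s λ W {k} k<q →
      let k<n = <-≤-trans k<q q≤n
          q+k<n = subst (q + k <_) (sym n≡q+q) (ℕₚ.+-monoʳ-< q k<q) in
      Count-two (fromℕ< k<n) (fromℕ< q+k<n)
        (λ eq → ℕₚ.<-irrefl (Finₚ.fromℕ<-injective _ _ k<n q+k<n eq) (<-≤-trans k<q (m≤m+n q k)))
        (subst (λ i → Rot (swap W i) (swap W k)) (sym (toℕ-fromℕ< k<n)) Rot-refl)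
        (subst (λ i → Rot (swap W i) (swap W k)) (sym (toℕ-fromℕ< q+k<n)) (swap-turn W k))
        λ j turns → Sum.map
          (λ e → toℕ-injective (trans e (sym (toℕ-fromℕ< k<n))))
          (λ e → toℕ-injective (trans e (sym (toℕ-fromℕ< q+k<n))))
          (Dih⇒reduced W (toℕ<n j) k<q (inj₁ turns))

  module _ (n≡4 : n ≡ 4) (q≡4 : q ≡ 4) where

    halve : ∀ {j} → j < 4 → ∃ λ k → k < 2 × (j ≡ k ⊎ j ≡ 2 + k)
    halve {0} _ = 0 , z<s , inj₁ refl
    halve {1} _ = 1 , s<s z<s , inj₁ refl
    halve {2} _ = 0 , z<s , inj₂ refl
    halve {3} _ = 1 , s<s z<s , inj₂ refl
    halve {suc (suc (suc (suc _)))} (s≤s (s≤s (s≤s (s≤s ()))))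

    opposite-Anti : ∀ W k → Anti (swap W (2 + k)) (swap W k)
    opposite-Anti W k = Anti-sym (swap-opposite n≡4 q≡4 W k)

    halved-Dih : ∀ W {j k} → j ≡ k ⊎ j ≡ 2 + k → Dih (swap W j) (swap W k)
    halved-Dih W (inj₁ refl) = inj₁ Rot-refl
    halved-Dih W (inj₂ refl) = inj₂ (opposite-Anti W _)

    apart₂ : ∀ W {k j} → k < j → j < 2 → ¬ Dih (swap W k) (swap W j)
    apart₂ W {zero} {suc zero} _ _ = swap-¬Dih-suc W 0
    apart₂ W {suc k} {suc zero} (s≤s ()) _
    apart₂ W {k} {suc (suc j)} _ (s≤s (s≤s ()))

    Dih⇒halved : ∀ W {j k} → j < 4 → k < 2 → Dih (swap W j) (swap W k) → j ≡ k ⊎ j ≡ 2 + k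
    Dih⇒halved W {j} {k} j<4 k<2 dih with k′ , k′<2 , red ← halve j<4 with ℕₚ.<-cmp k′ k
    ... | tri< k′<k _ _ = contradiction (Dih-trans (Dih-sym (halved-Dih W red)) dih) (apart₂ W k′<k k<2)
    ... | tri≈ _ refl _ = red
    ... | tri> _ _ k<k′ = contradiction (Dih-trans (Dih-sym dih) (halved-Dih W red)) (apart₂ W k<k′ k′<2)

    -- Positions k and k + 2 reach the same zigzag in opposite orientations, while 0 and 1 reach
    -- different ones.
    tetrahedronClasses : SwapClasses 2 1 1
    tetrahedronClasses = record
      { a≤b = ≤-refl ; 0<b = z<s
      ; cover = λ W j<n → let k , k<2 , red = halve (<4 j<n) in k , k<2 , halved-Dih W red
      ; apart = apart₂
      ; rots = λ W {k} k<2 → let k<n = <n (<-trans k<2 (s≤s (s≤s z<s))) in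
          Count-one (fromℕ< k<n) (subst (λ i → Rot (swap W i) (swap W k)) (sym (toℕ-fromℕ< k<n)) Rot-refl)
            λ j turns → toℕ-injective (trans
              ([ id , (λ e → contradiction
                  (Rot-Anti (Rot-sym turns) (subst (λ i → Anti (swap W i) (swap W k)) (sym e) (opposite-Anti W k)))
                  (¬Anti-self (swap W k))) ]′
                (Dih⇒halved W (<4 (toℕ<n j)) k<2 (inj₁ turns)))
              (sym (toℕ-fromℕ< k<n)))
      ; antis = λ W {k} k<2 → let k<n = <n (s≤s (s≤s k<2)) in
          Count-one (fromℕ< k<n) (subst (λ i → Anti (swap W i) (swap W k)) (sym (toℕ-fromℕ< k<n)) (opposite-Anti W k))
            λ j flips → toℕ-injective (trans
              ([ (λ e → contradiction (subst (λ i → Anti (swap W i) (swap W k)) e flips) (¬Anti-self (swap W k))) , id ]′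
                (Dih⇒halved W (<4 (toℕ<n j)) k<2 (inj₂ flips)))
              (sym (toℕ-fromℕ< k<n)))
      }
      where
      <4 : ∀ {j} → j < n → j < 4
      <4 = subst (_ <_) n≡4
      <n : ∀ {j} → j < 4 → j < n
      <n = subst (_ <_) (sym n≡4)

-- Counting

record Enumeration (k m : ℕ) (Cond : (Fin k → Fin k) → Set) : Set where
  field
    perm     : Fin m → Fin k → Fin k
    perm-inj : ∀ c → Injective _≡_ _≡_ (perm c)
    cond     : ∀ c → Cond (perm c)
    distinct : ∀ {c c′} → (∀ i → perm c i ≡ perm c′ i) → c ≡ c′
    complete : ∀ f → Injective _≡_ _≡_ f → Cond f → ∃ λ c → ∀ i → f i ≡ perm c i

Fin1-unique : (i j : Fin 1) → i ≡ j
Fin1-unique zero zero = refl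

insert : ∀ {k} → Fin (suc k) → (Fin k → Fin k) → Fin (suc k) → Fin (suc k)
insert i f zero    = i
insert i f (suc j) = punchIn i (f j)

-- A permutation amounts to the image of 0 together with a permutation of the rest, renumbered after
-- deleting that image. The two hypotheses say that the condition depends on the rest only.
extend : ∀ {k m Cond Cond′} → Enumeration k m Cond →
         (∀ i f → Cond f → Cond′ (insert i f)) →
         (∀ i f g → (∀ j → g j ≡ insert i f j) → Cond′ g → Cond f) →
         Enumeration (suc k) (suc k * m) Cond′
extend {k} {m} {Cond} {Cond′} E step⁺ step⁻ = record
  { perm     = λ c → insert (proj₁ (split c)) (perm (proj₂ (split c)))
  ; perm-inj = λ c → insert-injective (proj₁ (split c)) (perm-inj (proj₂ (split c)))
  ; cond     = λ c → step⁺ (proj₁ (split c)) _ (cond (proj₂ (split c)))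
  ; distinct = λ {c} {c′} eq → trans (sym (combine-remQuot {suc k} m c)) (trans
      (cong₂ combine (eq zero) (Enumeration.distinct E λ i → punchIn-injective (proj₁ (split c)) _ _
        (trans (eq (suc i)) (cong (λ j → punchIn j (perm (proj₂ (split c′)) i)) (sym (eq zero))))))
      (combine-remQuot {suc k} m c′))
  ; complete = λ f f-inj c → find f f-inj c
  }
  where
  open Enumeration E using (perm; perm-inj; cond)
  split : Fin (suc k * m) → Fin (suc k) × Fin m
  split = remQuot m
  insert-injective : ∀ i {f} → Injective _≡_ _≡_ f → Injective _≡_ _≡_ (insert i f)
  insert-injective i f-inj {zero} {zero} eq = refl
  insert-injective i f-inj {zero} {suc y} eq = contradiction (sym eq) (punchInᵢ≢i i _)
  insert-injective i f-inj {suc x} {zero} eq = contradiction eq (punchInᵢ≢i i _)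
  insert-injective i f-inj {suc x} {suc y} eq = cong suc (f-inj (punchIn-injective i _ _ eq))
  module _ (f : Fin (suc k) → Fin (suc k)) (f-inj : Injective _≡_ _≡_ f) (c : Cond′ f) where
    avoids : ∀ j → f zero ≢ f (suc j)
    avoids j eq = contradiction (f-inj eq) λ ()
    rest : Fin k → Fin k
    rest j = punchOut (avoids j)
    f≗ : ∀ j → f j ≡ insert (f zero) rest j
    f≗ zero = refl
    f≗ (suc j) = sym (punchIn-punchOut (avoids j))
    find : ∃ λ c → ∀ i → f i ≡ insert (proj₁ (split c)) (perm (proj₂ (split c))) i
    find = let c₀ , eq = Enumeration.complete E rest
                 (λ {x} {y} e → Finₚ.suc-injective (f-inj (punchOut-injective (avoids x) (avoids y) e)))
                 (step⁻ (f zero) rest f f≗ c) in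
      combine (f zero) c₀ , λ where
        zero → sym (cong proj₁ (remQuot-combine (f zero) c₀))
        (suc j) → trans (f≗ (suc j)) (cong₂ punchIn
          (sym (cong proj₁ (remQuot-combine (f zero) c₀)))
          (trans (eq j) (cong (λ c → perm c j) (sym (cong proj₂ (remQuot-combine (f zero) c₀))))))

inverse : ∀ {k} {f : Fin k → Fin k} → Injective _≡_ _≡_ f → Fin k → Fin k
inverse inj y = proj₁ (injective⇒surjective inj y)

inverseʳ : ∀ {k} {f : Fin k → Fin k} (inj : Injective _≡_ _≡_ f) y → f (inverse inj y) ≡ y
inverseʳ inj y = proj₂ (injective⇒surjective inj y)

inverseˡ : ∀ {k} {f : Fin k → Fin k} (inj : Injective _≡_ _≡_ f) i → inverse inj (f i) ≡ i
inverseˡ inj i = inj (inverseʳ inj _)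

module Increasing where

  -- The two largest letters: as insert adds a new smallest letter, suc maps them
  -- to the two largest letters of the next stage.
  t₁ t₂ : ∀ {e} → Fin (2 + e)
  t₁ {e} = inject₁ (fromℕ e)
  t₂ {e} = fromℕ (suc e)

  Increasing : ∀ {e} → (Fin (2 + e) → Fin (2 + e)) → Set
  Increasing f = f t₁ Fin.< f t₂

  -- The product 3 · 4 ⋯ (e + 2): each `extend` contributes a factor, starting from the only
  -- increasing permutation of two letters.
  half! : ℕ → ℕ
  half! zero    = 1
  half! (suc e) = (3 + e) * half! e

  half!-correct : ∀ e → (2 + e) ! / 2 ≡ half! e
  half!-correct e = trans (cong (_/ 2) (double e)) (m*n/n≡m (half! e) 2)
    where
    double : ∀ e → (2 + e) ! ≡ half! e * 2
    double zero    = refl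
    double (suc e) = trans (cong ((3 + e) *_) (double e)) (sym (ℕₚ.*-assoc (3 + e) (half! e) 2))

  punchIn-mono-< : ∀ {k} i {j l : Fin k} → j Fin.< l → punchIn i j Fin.< punchIn i l
  punchIn-mono-< i {j} {l} j<l = ℕₚ.≰⇒> (λ le → ℕₚ.<⇒≱ j<l (punchIn-cancel-≤ i l j le))

  punchIn-cancel-< : ∀ {k} i {j l : Fin k} → punchIn i j Fin.< punchIn i l → j Fin.< l
  punchIn-cancel-< i {j} {l} lt = ℕₚ.≰⇒> (λ le → ℕₚ.<⇒≱ lt (punchIn-mono-≤ i l j le))

  identity-only : ∀ (f : Fin 2 → Fin 2) → f zero Fin.< f (suc zero) → ∀ i → f i ≡ i
  identity-only f lt i with f zero in eq₀ | f (suc zero) in eq₁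
  identity-only f lt zero       | zero | suc zero = eq₀
  identity-only f lt (suc zero) | zero | suc zero = eq₁
  identity-only f (s≤s ()) i    | suc zero | suc zero

  increasing : ∀ e → Enumeration (2 + e) (half! e) Increasing
  increasing zero = record
    { perm     = λ _ → id
    ; perm-inj = λ _ → id
    ; cond     = λ _ → s≤s z≤n
    ; distinct = λ {c} {c′} _ → Fin1-unique c c′
    ; complete = λ f _ lt → zero , identity-only f lt
    }
  increasing (suc e) = extend (increasing e)
    (λ i f lt → punchIn-mono-< i lt)
    (λ i f g eq lt → punchIn-cancel-< i (subst₂ Fin._<_ (eq _) (eq _) lt))

-- The simplex

module Simplex (d : ℕ) (3≤d : 3 ≤ d) where

  complex : Complex
  complex = record
    { n = suc d ; d = d ; q = suc d ; τ = id ; 3≤d = 3≤d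
    ; τ-involutive = λ _ → refl
    ; shape = untwisted refl refl (λ _ → refl)
    ; cover = λ v v-# y → let r , eq = injective⇒surjective (λ {r} {s} eq → distinct-# v v-# eq) y in r , inj₁ (sym eq)
    }
    where
    distinct-# : (v : Fin (suc d) → Fin (suc d)) → (∀ {r s} → r ≢ s → v r ≢ v s × v r ≢ v s) →
                 ∀ {r s} → v r ≡ v s → r ≡ s
    distinct-# v v-# {r} {s} eq with r ≟ s
    ... | yes r≡s = r≡s
    ... | no r≢s = contradiction eq (proj₁ (v-# r≢s))

  -- Serves as the normal of a hyperplane with offset 1 that supports the simplex along S.
  indicator : ∀ {k} → Subset k → Vector ℤ k
  indicator S v = if does (v ∈? S) then 1ℤ else 0ℤ

  indicator-≤ : ∀ {k} (S : Subset k) v → indicator S v ℤ.≤ 1ℤ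
  indicator-≤ S v with v ∈? S
  ... | yes _ = +≤+ ≤-refl
  ... | no _ = +≤+ z≤n

  indicator-∈ : ∀ {k} (S : Subset k) v → v ∈ S ⇔ indicator S v ≡ 1ℤ
  indicator-∈ S v with v ∈? S
  ... | yes v∈ = mk⇔ (λ _ → refl) (λ _ → v∈)
  ... | no v∉ = mk⇔ (λ v∈ → contradiction v∈ v∉) (λ ())

  realisation : Realisation complex
  realisation = record
    { V = simplex d
    ; face-# = λ _ _ _ x≢y → x≢y , x≢y
    ; face-size = λ {S} isF → let v , v∉ = IsFace.proper isF in
        s≤s⁻¹ (subst (∣ S ∣ <_) (∣⊤∣≡n (suc d)) (p⊂q⇒∣p∣<∣q∣ (⊆⊤ , v , ∈⊤ , v∉)))
    ; #-isFace = λ {S} ne pr _ → record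
        { nonempty = ne ; proper = pr ; normal = indicator S ; offset = 1ℤ
        ; bound = λ v → subst (ℤ._≤ 1ℤ) (sym (·-basis (indicator S) v)) (indicator-≤ S v)
        ; tight = λ v → subst (λ c → v ∈ S ⇔ c ≡ 1ℤ) (sym (·-basis (indicator S) v)) (indicator-∈ S v) }
    ; #-independent = λ {k} {w} w-# a _ Σ≡0 i → trans (sym (ℤₚ.*-identityʳ (a i))) (trans
        (cong (a i ℤ.*_) (sym (basis-same (w i)))) (trans
          (sym (Σℤ-single i (λ j j≢i → trans (cong (a j ℤ.*_) (basis-other (proj₁ (w-# j≢i)))) (ℤₚ.*-zeroʳ (a j)))))
          (Σ≡0 (w i))))
    }

  open Words complex using (4≤n)
  open Intersections realisation
  open SwapClassification realisation

  intersections : 4 ≤ d → (Z : Zigzag (simplex d) d) → IntersectionVector (simplex d) d Z (0 , 1) (suc d)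
  intersections 4≤d = intersectionVector (untwistedClasses (s≤s 4≤d) refl)

  intersections₃ : d ≡ 3 → (Z : Zigzag (simplex d) d) → IntersectionVector (simplex d) d Z (1 , 1) 2
  intersections₃ d≡3 = intersectionVector (tetrahedronClasses (cong suc d≡3) (cong suc d≡3))

module SimplexCount (e : ℕ) (3≤d : 3 ≤ 2 + e) where
  open Increasing
  private d₀ = 2 + e
  open Simplex d₀ 3≤d
  open Words complex
  open Blocks complex
  open Intersections realisation
  open Enumeration (increasing e)

  b c : Fin (suc d₀)
  b = suc t₁
  c = suc t₂

  b≢c : b ≢ c
  b≢c eq = Finₚ.fromℕ≢inject₁ (sym (Finₚ.suc-injective eq))

  open Canonical complex {zero} {b} {c} (λ ()) (λ ()) b≢c

  -- The normal form compares the positions of two letters, so `perm i` is read as the map from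
  -- letters to positions; the letters in order are then given by its inverse.
  block : Fin (half! e) → Fin (suc d₀) → Fin (suc d₀)
  block i zero    = zero
  block i (suc r) = suc (inverse (perm-inj i) r)

  block-injective : ∀ i {r s} → block i r ≡ block i s → r ≡ s
  block-injective i {zero}  {zero}  _  = refl
  block-injective i {suc r} {suc s} eq = cong suc (trans (sym (inverseʳ (perm-inj i) r))
    (trans (cong (perm i) (Finₚ.suc-injective eq)) (inverseʳ (perm-inj i) s)))

  block-# : ∀ i {r s} → r ≢ s → block i r # block i s
  block-# i r≢s = (r≢s ∘ block-injective i) , (r≢s ∘ block-injective i)

  representative : Fin (half! e) → Word
  representative i = blockWord (block i) (block-# i)

  representative-letter : ∀ i x → letter (representative i) (suc (toℕ (perm i x))) ≡ suc x
  representative-letter i x = trans (blockWord-letter (block i) (block-# i) (suc (perm i x)))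
    (cong suc (inverseˡ (perm-inj i) x))

  representative-index : ∀ i x → index (representative i) (suc x) ≡ suc (toℕ (perm i x))
  representative-index i x = trans (cong (index (representative i)) (sym (representative-letter i x)))
    (index-letter (representative i) (s≤s (toℕ<n (perm i x))))

  canonical : ∀ i → Canon (representative i)
  canonical i = blockWord-letter (block i) (block-# i) zero ,
    subst₂ _<_ (sym (representative-index i t₁)) (sym (representative-index i t₂)) (s≤s (cond i))

  irredundant : ∀ {i j} → (∀ r → letter (representative i) r ≡ letter (representative j) r) → i ≡ j
  irredundant {i} {j} eq = Enumeration.distinct (increasing e) λ x → toℕ-injective (ℕₚ.suc-injective
    (letter-injective (representative j) (s≤s (toℕ<n _)) (s≤s (toℕ<n _))
      (trans (sym (eq (suc (toℕ (perm i x))))) (trans (representative-letter i x) (sym (representative-letter j x))))))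

  module _ (W : Word) (canon : Canon W) where

    index-suc : ∀ x → suc (pred (index W (suc x))) ≡ index W (suc x)
    index-suc x = ℕₚ.suc-pred _ {{>-nonZero (index>0 W (λ eq → contradiction (trans (sym eq) (proj₁ canon)) λ ()))}}

    pred-index< : ∀ x → pred (index W (suc x)) < d₀
    pred-index< x = s≤s⁻¹ (subst (_< suc d₀) (sym (index-suc x)) (index<n W (suc x)))

    place : Fin d₀ → Fin d₀
    place x = fromℕ< (pred-index< x)

    suc-place : ∀ x → suc (toℕ (place x)) ≡ index W (suc x)
    suc-place x = trans (cong suc (toℕ-fromℕ< (pred-index< x))) (index-suc x)

    place-letter : ∀ x → letter W (suc (toℕ (place x))) ≡ suc x
    place-letter x = trans (cong (letter W) (suc-place x)) (letter-index W (suc x))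

    place-injective : Injective _≡_ _≡_ place
    place-injective {x} {y} eq = Finₚ.suc-injective
      (trans (sym (place-letter x)) (trans (cong (letter W ∘ suc ∘ toℕ) eq) (place-letter y)))

    place-increasing : Increasing place
    place-increasing = s≤s⁻¹ (subst₂ _<_ (sym (suc-place t₁)) (sym (suc-place t₂)) (proj₂ canon))

    agrees : ∀ i → (∀ x → place x ≡ perm i x) → ∀ r → letter W r ≡ letter (representative i) r
    agrees i eq = ≗-block {W} {representative i} λ r → trans (on-block r) (sym (blockWord-letter (block i) (block-# i) r))
      where
      on-block : ∀ r → letter W (toℕ r) ≡ block i r
      on-block zero = proj₁ canon
      on-block (suc r) = trans (cong (λ r → letter W (suc (toℕ r)))
          (trans (sym (inverseʳ (perm-inj i) r)) (sym (eq (inverse (perm-inj i) r)))))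
        (place-letter (inverse (perm-inj i) r))

  transversal : Transversal (λ ()) (λ ()) b≢c (half! e)
  transversal = record
    { representative = representative ; canonical = canonical ; irredundant = irredundant
    ; complete = λ W canon →
        let i , eq = complete (place W canon) (place-injective W canon) (place-increasing W canon)
        in i , agrees W canon i eq
    }

  zVec : ZVector (simplex d₀) d₀ (suc d₀) (d₀ ! / 2)
  zVec = subst (ZVector (simplex d₀) d₀ (suc d₀)) (sym (half!-correct e)) (zVector (λ ()) (λ ()) b≢c transversal)

-- The cross-polytope

funToFin-cong : ∀ {m k} {f g : Fin m → Fin k} → (∀ i → f i ≡ g i) → funToFin f ≡ funToFin g
funToFin-cong {zero}  eq = refl
funToFin-cong {suc m} eq = cong₂ combine (eq zero) (funToFin-cong (eq ∘ suc))

finToFun-injective : ∀ {m k} {s t : Fin (k ^ m)} → (∀ i → finToFun {k} {m} s i ≡ finToFun t i) → s ≡ t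
finToFun-injective {m} {k} {s} {t} eq =
  trans (sym (funToFin-finToFin {m} {k} s)) (trans (funToFin-cong eq) (funToFin-finToFin {m} {k} t))

permutations : ∀ k → Enumeration k (k !) (λ _ → ⊤)
permutations zero = record
  { perm     = λ _ ()
  ; perm-inj = λ { _ {()} }
  ; cond     = _
  ; distinct = λ {c} {c′} _ → Fin1-unique c c′
  ; complete = λ _ _ _ → zero , λ ()
  }
permutations (suc k) = extend (permutations k) _ _

≡-⇒0 : ∀ {i} → i ≡ ℤ.- i → i ≡ 0ℤ
≡-⇒0 {ℤ.+ zero} _ = refl
≡-⇒0 {ℤ.+ suc _} ()
≡-⇒0 {ℤ.-[1+ _ ]} ()

≤0∧-≤0⇒≡0 : ∀ {i} → i ℤ.≤ 0ℤ → ℤ.- i ℤ.≤ 0ℤ → i ≡ 0ℤ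
≤0∧-≤0⇒≡0 {ℤ.+ zero} _ _ = refl
≤0∧-≤0⇒≡0 {ℤ.+ suc _} (+≤+ ()) _
≤0∧-≤0⇒≡0 {ℤ.-[1+ _ ]} _ (+≤+ ())

module SignedVertices (d : ℕ) where

  data Signed : Fin (d + d) → Set where
    plus  : ∀ c → Signed (c ↑ˡ d)
    minus : ∀ c → Signed (d ↑ʳ c)

  signed : ∀ v → Signed v
  signed v with splitAt d v in eq
  ... | inj₁ c = subst Signed (splitAt⁻¹-↑ˡ eq) (plus c)
  ... | inj₂ c = subst Signed (splitAt⁻¹-↑ʳ eq) (minus c)

  τ : Fin (d + d) → Fin (d + d)
  τ v = [ d ↑ʳ_ , _↑ˡ d ]′ (splitAt d v)

  axis : Fin (d + d) → Fin d
  axis v = [ id , id ]′ (splitAt d v)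

  sign : Fin (d + d) → Fin 2
  sign v = [ (λ _ → zero) , (λ _ → suc zero) ]′ (splitAt d v)

  vertex : Fin 2 → Fin d → Fin (d + d)
  vertex zero    c = c ↑ˡ d
  vertex (suc _) c = d ↑ʳ c

  τ-plus : ∀ c → τ (c ↑ˡ d) ≡ d ↑ʳ c
  τ-plus c = cong [ d ↑ʳ_ , _↑ˡ d ]′ (splitAt-↑ˡ d c d)

  τ-minus : ∀ c → τ (d ↑ʳ c) ≡ c ↑ˡ d
  τ-minus c = cong [ d ↑ʳ_ , _↑ˡ d ]′ (splitAt-↑ʳ d d c)

  axis-vertex : ∀ s c → axis (vertex s c) ≡ c
  axis-vertex zero c = cong [ id , id ]′ (splitAt-↑ˡ d c d)
  axis-vertex (suc _) c = cong [ id , id ]′ (splitAt-↑ʳ d d c)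

  sign-vertex : ∀ s c → sign (vertex s c) ≡ s
  sign-vertex zero c = cong [ (λ _ → zero) , (λ _ → suc zero) ]′ (splitAt-↑ˡ d c d)
  sign-vertex (suc zero) c = cong [ (λ _ → zero) , (λ _ → suc zero) ]′ (splitAt-↑ʳ d d c)

  vertex-sign-axis : ∀ v → vertex (sign v) (axis v) ≡ v
  vertex-sign-axis v with signed v
  ... | plus c = cong₂ vertex (sign-vertex zero c) (axis-vertex zero c)
  ... | minus c = cong₂ vertex (sign-vertex (suc zero) c) (axis-vertex (suc zero) c)

  plus≢minus : ∀ {c c′} → c ↑ˡ d ≢ d ↑ʳ c′
  plus≢minus {c} {c′} eq with trans (sym (sign-vertex zero c)) (trans (cong sign eq) (sign-vertex (suc zero) c′))
  ... | ()

  τ-involutive : ∀ v → τ (τ v) ≡ v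
  τ-involutive v with signed v
  ... | plus c = trans (cong τ (τ-plus c)) (τ-minus c)
  ... | minus c = trans (cong τ (τ-minus c)) (τ-plus c)

  τ≢id : ∀ v → τ v ≢ v
  τ≢id v eq with signed v
  ... | plus c = plus≢minus (sym (trans (sym (τ-plus c)) eq))
  ... | minus c = plus≢minus (trans (sym (τ-minus c)) eq)

  axis-τ : ∀ v → axis (τ v) ≡ axis v
  axis-τ v with signed v
  ... | plus c = trans (cong axis (τ-plus c)) (trans (axis-vertex (suc zero) c) (sym (axis-vertex zero c)))
  ... | minus c = trans (cong axis (τ-minus c)) (trans (axis-vertex zero c) (sym (axis-vertex (suc zero) c)))

  axis-≡ : ∀ x y → axis x ≡ axis y → x ≡ y ⊎ x ≡ τ y
  axis-≡ x y eq with signed x | signed y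
  ... | plus c | plus c′ = inj₁ (cong (_↑ˡ d) (trans (sym (axis-vertex zero c)) (trans eq (axis-vertex zero c′))))
  ... | plus c | minus c′ = inj₂ (trans (cong (_↑ˡ d) (trans (sym (axis-vertex zero c)) (trans eq (axis-vertex (suc zero) c′)))) (sym (τ-minus c′)))
  ... | minus c | plus c′ = inj₂ (trans (cong (d ↑ʳ_) (trans (sym (axis-vertex (suc zero) c)) (trans eq (axis-vertex zero c′)))) (sym (τ-plus c′)))
  ... | minus c | minus c′ = inj₁ (cong (d ↑ʳ_) (trans (sym (axis-vertex (suc zero) c)) (trans eq (axis-vertex (suc zero) c′))))

  axis-≢⇒# : ∀ {x y} → axis x ≢ axis y → x ≢ y × x ≢ τ y
  axis-≢⇒# ≢ = ≢ ∘ cong axis , λ eq → ≢ (trans (cong axis eq) (axis-τ _))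

  #⇒axis-≢ : ∀ {x y} → x ≢ y × x ≢ τ y → axis x ≢ axis y
  #⇒axis-≢ {x} {y} (x≢y , x≢τy) eq = [ x≢y , x≢τy ]′ (axis-≡ x y eq)

  axis-injective : ∀ {k} {f : Fin k → Fin (d + d)} → (∀ {r s} → r ≢ s → f r ≢ f s × f r ≢ τ (f s)) →
                   Injective _≡_ _≡_ (axis ∘ f)
  axis-injective f-# {r} {s} eq with r ≟ s
  ... | yes r≡s = r≡s
  ... | no r≢s = contradiction eq (#⇒axis-≢ (f-# r≢s))

module CrossPolytope (d : ℕ) (3≤d : 3 ≤ d) where
  open SignedVertices d hiding (τ-involutive)

  complex : Complex
  complex = record
    { n = d + d ; d = d ; q = d ; τ = τ ; 3≤d = 3≤d
    ; τ-involutive = SignedVertices.τ-involutive d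
    ; shape = twisted refl refl τ≢id
    ; cover = λ v v-# y → let r , eq = injective⇒surjective (axis-injective v-#) (axis y)
                          in r , axis-≡ y (v r) (sym eq)
    }

  V₀ : Fin (d + d) → Vector ℤ d
  V₀ = crossPolytope d

  V-plus : ∀ c → V₀ (c ↑ˡ d) ≡ basis c
  V-plus c = cong [ basis , (λ i k → ℤ.- basis i k) ]′ (splitAt-↑ˡ d c d)

  V-minus : ∀ c → V₀ (d ↑ʳ c) ≡ λ k → ℤ.- basis c k
  V-minus c = cong [ basis , (λ i k → ℤ.- basis i k) ]′ (splitAt-↑ʳ d d c)

  ·-plus : ∀ (a : Vector ℤ d) c → a · V₀ (c ↑ˡ d) ≡ a c
  ·-plus a c = trans (cong (a ·_) (V-plus c)) (·-basis a c)

  ·-minus : ∀ (a : Vector ℤ d) c → a · V₀ (d ↑ʳ c) ≡ ℤ.- a c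
  ·-minus a c = trans (cong (a ·_) (V-minus c)) (trans
    (Σℤ-single c (λ j j≢c → trans (cong (λ b → a j ℤ.* ℤ.- b) (basis-other (j≢c ∘ sym))) (ℤₚ.*-zeroʳ (a j))))
    (trans (cong (λ b → a c ℤ.* ℤ.- b) (basis-same c)) (trans (ℤₚ.*-comm (a c) ℤ.-1ℤ) (ℤₚ.-1*i≡-i (a c)))))

  ·-τ : ∀ (a : Vector ℤ d) v → a · V₀ (τ v) ≡ ℤ.- (a · V₀ v)
  ·-τ a v with signed v
  ... | plus c = trans (cong (λ v → a · V₀ v) (τ-plus c)) (trans (·-minus a c) (cong ℤ.-_ (sym (·-plus a c))))
  ... | minus c = trans (cong (λ v → a · V₀ v) (τ-minus c)) (trans (·-plus a c)
    (trans (sym (ℤₚ.neg-involutive (a c))) (cong ℤ.-_ (sym (·-minus a c)))))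

  -- If a face contained antipodes, its offset would equal its own negative and vanish. The bounds
  -- at v and τ v would then make the functional zero at every vertex, and the face would not be
  -- proper.
  antipodal-free : ∀ {S} → IsFace V₀ d S → ∀ {x y} → x ∈ S → y ∈ S → x ≢ τ y
  antipodal-free {S} isF {x} {y} x∈ y∈ x≡τy = proj₂ proper (Equivalence.from (tight v) (trans (all-zero v) (sym o≡0)))
    where
    open IsFace isF
    v = proj₁ proper
    o≡0 : offset ≡ 0ℤ
    o≡0 = ≡-⇒0 (trans (sym (Equivalence.to (tight x) x∈)) (trans (cong (λ v → normal · V₀ v) x≡τy)
      (trans (·-τ normal y) (cong ℤ.-_ (Equivalence.to (tight y) y∈)))))
    all-zero : ∀ v → normal · V₀ v ≡ 0ℤ
    all-zero v = ≤0∧-≤0⇒≡0 (subst (normal · V₀ v ℤ.≤_) o≡0 (bound v))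
      (subst₂ ℤ._≤_ (·-τ normal v) o≡0 (bound (τ v)))

  module _ (S : Subset (d + d)) where

    -- If S has no antipodal pair, this is the sum of its vertices: as a functional it is 1 on S, -1
    -- on the antipodes of S and 0 at the other vertices.
    support : Vector ℤ d
    support c with c ↑ˡ d ∈? S | d ↑ʳ c ∈? S
    ... | yes _ | _     = 1ℤ
    ... | no _  | yes _ = ℤ.-1ℤ
    ... | no _  | no _  = 0ℤ

    support-plus-≤ : ∀ c → support c ℤ.≤ 1ℤ
    support-plus-≤ c with c ↑ˡ d ∈? S | d ↑ʳ c ∈? S
    ... | yes _ | _     = +≤+ ≤-refl
    ... | no _  | yes _ = -≤+
    ... | no _  | no _  = +≤+ z≤n

    support-minus-≤ : ∀ c → ℤ.- support c ℤ.≤ 1ℤ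
    support-minus-≤ c with c ↑ˡ d ∈? S | d ↑ʳ c ∈? S
    ... | yes _ | _     = -≤+
    ... | no _  | yes _ = +≤+ ≤-refl
    ... | no _  | no _  = +≤+ z≤n

    support-plus : ∀ c → c ↑ˡ d ∈ S ⇔ support c ≡ 1ℤ
    support-plus c with c ↑ˡ d ∈? S | d ↑ʳ c ∈? S
    ... | yes p | _     = mk⇔ (λ _ → refl) (λ _ → p)
    ... | no ¬p | yes _ = mk⇔ (λ p → contradiction p ¬p) (λ ())
    ... | no ¬p | no _  = mk⇔ (λ p → contradiction p ¬p) (λ ())

    support-minus : (∀ c → c ↑ˡ d ∈ S → d ↑ʳ c ∉ S) → ∀ c → d ↑ʳ c ∈ S ⇔ ℤ.- support c ≡ 1ℤ
    support-minus apart c with c ↑ˡ d ∈? S | d ↑ʳ c ∈? S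
    ... | yes p | _     = mk⇔ (λ q → contradiction q (apart c p)) (λ ())
    ... | no _  | yes q = mk⇔ (λ _ → refl) (λ _ → q)
    ... | no _  | no ¬q = mk⇔ (λ q → contradiction q ¬q) (λ ())

    support-bound : ∀ v → support · V₀ v ℤ.≤ 1ℤ
    support-bound v with signed v
    ... | plus c = subst (ℤ._≤ 1ℤ) (sym (·-plus support c)) (support-plus-≤ c)
    ... | minus c = subst (ℤ._≤ 1ℤ) (sym (·-minus support c)) (support-minus-≤ c)

    support-tight : (∀ c → c ↑ˡ d ∈ S → d ↑ʳ c ∉ S) → ∀ v → v ∈ S ⇔ support · V₀ v ≡ 1ℤ
    support-tight apart v with signed v
    ... | plus c = subst (λ i → c ↑ˡ d ∈ S ⇔ i ≡ 1ℤ) (sym (·-plus support c)) (support-plus c)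
    ... | minus c = subst (λ i → d ↑ʳ c ∈ S ⇔ i ≡ 1ℤ) (sym (·-minus support c)) (support-minus apart c)

  V-other : ∀ v {t} → axis v ≢ t → V₀ v t ≡ 0ℤ
  V-other v ≢t with signed v
  ... | plus c = trans (cong (λ p → p _) (V-plus c)) (basis-other (≢t ∘ trans (axis-vertex zero c)))
  ... | minus c = trans (cong (λ p → p _) (V-minus c)) (cong ℤ.-_ (basis-other (≢t ∘ trans (axis-vertex (suc zero) c))))

  V-cancel : ∀ v a → a ℤ.* V₀ v (axis v) ≡ 0ℤ → a ≡ 0ℤ
  V-cancel v a eq with signed v
  ... | plus c = trans (sym (ℤₚ.*-identityʳ a)) (trans (cong (a ℤ.*_) (sym at)) eq)
    where
    at : V₀ (c ↑ˡ d) (axis (c ↑ˡ d)) ≡ 1ℤ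
    at = trans (cong₂ (λ p t → p t) (V-plus c) (axis-vertex zero c)) (basis-same c)
  ... | minus c = ℤₚ.neg-injective (trans (sym (ℤₚ.-1*i≡-i a)) (trans (ℤₚ.*-comm ℤ.-1ℤ a)
      (trans (cong (a ℤ.*_) (sym at)) eq)))
    where
    at : V₀ (d ↑ʳ c) (axis (d ↑ʳ c)) ≡ ℤ.-1ℤ
    at = trans (cong₂ (λ p t → p t) (V-minus c) (axis-vertex (suc zero) c)) (cong ℤ.-_ (basis-same c))

  realisation : Realisation complex
  realisation = record
    { V = V₀
    ; face-# = λ isF x∈ y∈ x≢y → x≢y , antipodal-free isF x∈ y∈
    ; face-size = λ {S} isF → injective⇒≤ (axis-injective {f = members S} λ {r} {s} r≢s →
        (r≢s ∘ members-injective S) , antipodal-free isF (members-∈ S r) (members-∈ S s))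
    ; #-isFace = λ {S} ne pr S-# → record
        { nonempty = ne ; proper = pr ; normal = support S ; offset = 1ℤ
        ; bound = support-bound S
        ; tight = support-tight S (λ c p q → proj₂ (S-# p q plus≢minus) (sym (τ-minus c))) }
    ; #-independent = λ {k} {w} w-# a _ Σ≡0 i → V-cancel (w i) (a i) (trans
        (sym (Σℤ-single i (λ j j≢i → trans
          (cong (a j ℤ.*_) (V-other (w j) (#⇒axis-≢ (w-# j≢i)))) (ℤₚ.*-zeroʳ (a j)))))
        (Σ≡0 (axis (w i))))
    }

  open Intersections realisation
  open SwapClassification realisation

  intersections : (Z : Zigzag (crossPolytope d) d) → IntersectionVector (crossPolytope d) d Z (0 , 2) d
  intersections = intersectionVector (twistedClasses (≤-trans (s≤s (s≤s (s≤s (s≤s (s≤s z≤n))))) (ℕₚ.+-mono-≤ 3≤d 3≤d)) refl)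

module CrossPolytopeCount (k : ℕ) (3≤d : 3 ≤ 2 + k) where
  private d₀ = 2 + k
  open SignedVertices d₀ hiding (τ; τ-involutive)
  open CrossPolytope d₀ 3≤d
  open Words complex
  open Blocks complex
  open Intersections realisation
  open Enumeration (permutations (suc k)) using (perm; perm-inj)

  a b c : Fin (d₀ + d₀)
  a = vertex zero zero
  b = vertex zero (suc zero)
  c = vertex (suc zero) (suc zero)

  a≢b : a ≢ b
  a≢b ()

  a≢c : a ≢ c
  a≢c ()

  b≢c : b ≢ c
  b≢c = plus≢minus

  open Canonical complex a≢b a≢c b≢c

  -- The normal form puts the vertex b before its antipode c, that is, it fixes
  -- the sign of one axis; the other k signs are free.
  Code : ℕ
  Code = 2 ^ k * (suc k) !

  ordering : Fin Code → Fin (suc k) → Fin (suc k)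
  ordering i = perm (proj₂ (remQuot {2 ^ k} ((suc k) !) i))

  ordering-inj : ∀ i → Injective _≡_ _≡_ (ordering i)
  ordering-inj i = perm-inj (proj₂ (remQuot {2 ^ k} ((suc k) !) i))

  signs : Fin Code → Fin (suc k) → Fin 2
  -- Axis 0 belongs to the starting letter a, so index x stands for axis x + 1; index zero is the
  -- axis of b and c, whose sign is the fixed one.
  signs i zero    = zero
  signs i (suc x) = finToFun (proj₁ (remQuot {2 ^ k} ((suc k) !) i)) x

  block : Fin Code → Fin d₀ → Fin (d₀ + d₀)
  block i zero    = a
  block i (suc r) = vertex (signs i (ordering i r)) (suc (ordering i r))

  block-axis-injective : ∀ i {r s} → axis (block i r) ≡ axis (block i s) → r ≡ s
  block-axis-injective i {zero}  {zero}  _  = refl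
  block-axis-injective i {zero}  {suc s} eq = contradiction
    (trans (sym (axis-vertex zero zero)) (trans eq (axis-vertex (signs i (ordering i s)) (suc (ordering i s))))) λ ()
  block-axis-injective i {suc r} {zero}  eq = contradiction
    (trans (sym (axis-vertex zero zero)) (trans (sym eq) (axis-vertex (signs i (ordering i r)) (suc (ordering i r))))) λ ()
  block-axis-injective i {suc r} {suc s} eq = cong suc (ordering-inj i (Finₚ.suc-injective
    (trans (sym (axis-vertex (signs i (ordering i r)) (suc (ordering i r))))
      (trans eq (axis-vertex (signs i (ordering i s)) (suc (ordering i s)))))))

  block-# : ∀ i {r s} → r ≢ s → block i r # block i s
  block-# i r≢s = axis-≢⇒# (r≢s ∘ block-axis-injective i)

  representative : Fin Code → Word
  representative i = blockWord (block i) (block-# i)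

  representative-letter : ∀ i r → letter (representative i) (toℕ r) ≡ block i r
  representative-letter i = blockWord-letter (block i) (block-# i)

  -- Since c is the antipode of b, it follows d₀ positions later. So b precedes c exactly when b is
  -- the one in the first block, and the normal form becomes a condition on a sign.
  ↑-index : ∀ W {i} → i < d₀ → letter W i ≡ b → index W b ≡ i × index W c ≡ d₀ + i
  ↑-index W {i} i<d at =
    trans (cong (index W) (sym at)) (index-letter W (<-≤-trans i<d (m≤m+n d₀ d₀))) ,
    trans (cong (index W) (sym (trans (turn W i) (trans (cong τ at) (τ-plus (suc zero))))))
      (index-letter W (ℕₚ.+-monoʳ-< d₀ i<d))

  ↓-index : ∀ W {i} → i < d₀ → letter W i ≡ c → index W c ≡ i × index W b ≡ d₀ + i
  ↓-index W {i} i<d at =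
    trans (cong (index W) (sym at)) (index-letter W (<-≤-trans i<d (m≤m+n d₀ d₀))) ,
    trans (cong (index W) (sym (trans (turn W i) (trans (cong τ at) (τ-minus (suc zero))))))
      (index-letter W (ℕₚ.+-monoʳ-< d₀ i<d))

  canonical : ∀ i → Canon (representative i)
  canonical i = representative-letter i zero ,
    subst₂ _<_ (sym (proj₁ ix)) (sym (proj₂ ix)) (<-≤-trans (toℕ<n (suc r)) (m≤m+n d₀ _))
    where
    r = inverse (ordering-inj i) zero
    block-b : block i (suc r) ≡ b
    block-b = cong (λ x → vertex (signs i x) (suc x)) (inverseʳ (ordering-inj i) zero)
    ix = ↑-index (representative i) (toℕ<n (suc r)) (trans (representative-letter i (suc r)) block-b)

  module _ {i j : Fin Code} (eq : ∀ r → letter (representative i) r ≡ letter (representative j) r) where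

    blocks-equal : ∀ r → block i r ≡ block j r
    blocks-equal r = trans (sym (representative-letter i r)) (trans (eq (toℕ r)) (representative-letter j r))

    orderings-equal : ∀ r → ordering i r ≡ ordering j r
    orderings-equal r = Finₚ.suc-injective (trans (sym (axis-vertex (signs i (ordering i r)) _))
      (trans (cong axis (blocks-equal (suc r))) (axis-vertex (signs j (ordering j r)) _)))

    signs-equal : ∀ x → signs i x ≡ signs j x
    signs-equal x = begin
      signs i x                            ≡⟨ cong (signs i) (inverseʳ (ordering-inj i) x) ⟨
      signs i (ordering i r)               ≡⟨ sign-vertex _ (suc (ordering i r)) ⟨
      sign (block i (suc r))               ≡⟨ cong sign (blocks-equal (suc r)) ⟩
      sign (block j (suc r))               ≡⟨ sign-vertex _ (suc (ordering j r)) ⟩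
      signs j (ordering j r)               ≡⟨ cong (signs j) (trans (sym (orderings-equal r)) (inverseʳ (ordering-inj i) x)) ⟩
      signs j x                            ∎
      where
      open ≡-Reasoning
      r = inverse (ordering-inj i) x

    irredundant : i ≡ j
    irredundant = trans (sym (combine-remQuot {2 ^ k} ((suc k) !) i)) (trans
      (cong₂ combine (finToFun-injective {k} {2} (λ x → signs-equal (suc x)))
        (Enumeration.distinct (permutations (suc k)) orderings-equal))
      (combine-remQuot {2 ^ k} ((suc k) !) j))

  module _ (W : Word) (canon : Canon W) where

    u : Fin (suc k) → Fin (d₀ + d₀)
    u r = letter W (suc (toℕ r))

    u-axis : ∀ r → zero ≢ axis (u r)
    u-axis r eq = #⇒axis-≢ (letters-# W {zero} {suc r} (λ ()))
      (trans (cong axis (proj₁ canon)) (trans (axis-vertex zero zero) eq))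

    order : Fin (suc k) → Fin (suc k)
    order r = punchOut (u-axis r)

    suc-order : ∀ r → suc (order r) ≡ axis (u r)
    suc-order r = punchIn-punchOut (u-axis r)

    order-injective : Injective _≡_ _≡_ order
    order-injective {r} {s} eq with r ≟ s
    ... | yes r≡s = r≡s
    ... | no r≢s = contradiction (trans (sym (suc-order r)) (trans (cong suc eq) (suc-order s)))
      (#⇒axis-≢ (letters-# W (r≢s ∘ Finₚ.suc-injective)))

    -- Indexed by axes rather than by positions, to match `signs`.
    sgn : Fin (suc k) → Fin 2
    sgn x = sign (u (inverse order-injective x))

    u-vertex : ∀ r → u r ≡ vertex (sgn (order r)) (suc (order r))
    u-vertex r = trans (sym (vertex-sign-axis (u r)))
      (cong₂ vertex (cong (sign ∘ u) (sym (inverseˡ order-injective r))) (sym (suc-order r)))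

    -- With the other sign c would stand in the first block and b only d₀ positions later, against
    -- the normal form.
    sgn-zero : sgn zero ≡ zero
    sgn-zero with sgn zero in eq
    ... | zero = refl
    ... | suc zero = contradiction (proj₂ canon) (ℕₚ.<-asym
      (subst₂ _<_ (sym (proj₁ ix)) (sym (proj₂ ix)) (<-≤-trans (toℕ<n (suc r)) (m≤m+n d₀ _))))
      where
      r = inverse order-injective zero
      u-c : u r ≡ c
      u-c = trans (u-vertex r) (cong₂ vertex
        (trans (cong sgn (inverseʳ order-injective zero)) eq)
        (cong suc (inverseʳ order-injective zero)))
      ix = ↓-index W (toℕ<n (suc r)) u-c

    agrees : ∀ i → (∀ r → order r ≡ ordering i r) → (∀ x → sgn x ≡ signs i x) →
             ∀ r → letter W r ≡ letter (representative i) r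
    agrees i same-order same-sign = ≗-block {W} {representative i} λ r → trans (on-block r) (sym (representative-letter i r))
      where
      on-block : ∀ r → letter W (toℕ r) ≡ block i r
      on-block zero = proj₁ canon
      on-block (suc r) = trans (u-vertex r) (trans
        (cong (λ x → vertex (sgn x) (suc x)) (same-order r))
        (cong (λ s → vertex s (suc (ordering i r))) (same-sign (ordering i r))))

    agreeing : ∃ λ i → ∀ r → letter W r ≡ letter (representative i) r
    agreeing = let p , eq = Enumeration.complete (permutations (suc k)) order order-injective _ in with-order p eq
      where
      s : Fin (2 ^ k)
      s = funToFin (sgn ∘ suc)
      with-order : ∀ p → (∀ r → order r ≡ perm p r) → ∃ λ i → ∀ r → letter W r ≡ letter (representative i) r
      with-order p eq = combine s p , agrees (combine s p)
        (λ r → trans (eq r) (cong (λ sp → perm (proj₂ sp) r) (sym split)))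
        (λ where
          zero → sgn-zero
          (suc x) → trans (sym (finToFun-funToFin (sgn ∘ suc) x)) (cong (λ sp → finToFun (proj₁ sp) x) (sym split)))
        where
        split : remQuot {2 ^ k} ((suc k) !) (combine s p) ≡ (s , p)
        split = remQuot-combine s p

  transversal : Transversal a≢b a≢c b≢c Code
  transversal = record
    { representative = representative ; canonical = canonical
    ; irredundant = irredundant ; complete = agreeing }

  zVec : ZVector (crossPolytope d₀) d₀ (2 * d₀) (2 ^ k * (suc k) !)
  zVec = subst (λ l → ZVector (crossPolytope d₀) d₀ l Code)
    (cong (d₀ +_) (sym (ℕₚ.+-identityʳ d₀))) (zVector a≢b a≢c b≢c transversal)

proposition4p1 : (d : ℕ) → 3 ≤ d →
    ( ZVector (simplex d) d (suc d) (d ! / 2)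
    × (4 ≤ d → (Z : Zigzag (simplex d) d) → IntersectionVector (simplex d) d Z (0 , 1) (suc d))
    × (d ≡ 3 → (Z : Zigzag (simplex d) d) → IntersectionVector (simplex d) d Z (1 , 1) 2) )
    ×
    ( ZVector (crossPolytope d) d (2 * d) (2 ^ (d ∸ 2) * (d ∸ 1) !)
    × ((Z : Zigzag (crossPolytope d) d) → IntersectionVector (crossPolytope d) d Z (0 , 2) d) )
proposition4p1 d@(suc (suc e)) 3≤d =
  (SimplexCount.zVec e 3≤d , Simplex.intersections d 3≤d , Simplex.intersections₃ d 3≤d) ,
  (CrossPolytopeCount.zVec e 3≤d , CrossPolytope.intersections d 3≤d)
proposition4p1 (suc zero) (s≤s ())
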